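{- Let $n>k\ge 1$ be integers and let $T\in\mathscr{T}_{n,k}$ have vertex degree sequence $(d_i:i\in[n])$. Then for every $x=(x_1,\dots,x_n)\in(\mathbb{R}\setminus\{0\})^n$, $$|\tilde{H}_{k-1}(T)|^2\le\frac{\prod_{i\in[n]}(x_i^2)^{m_1-d_i}}{\left(\sum_{i\in[n]}x_i^2\right)^{m_1}}\prod_{\tau\in T}\sum_{i\in\tau}x_i^2 .$$ Consequently $|\tilde{H}_{k-1}(T)|^2$ is at most the infimum of the right-hand side over all such $x$. The paper states this infimum over $x\in\mathbb{R}^n\setminus\{\mathbf 0\}$, where points having some, but not all, coordinates equal to $0$ are understood as limits of points with all coordinates nonzero.
   Context: Let $n>k\ge1$ be integers and $[n]=\{1,\dots,n\}$. For $j\ge0$, $\binom{[n]}{j}$ denotes the set of $j$-element subsets of $[n]$. A $k$-dimensional simplicial complex $T$ on vertex set $[n]$ is called $\mathbb{Q}$-acyclic if all three of the following hold: - it contains every subset of $[n]$ of size at most $k$ as a face (a full $(k-1)$-skeleton); - it has exactly $\binom{n-1}{k}$ faces of dimension $k$; - its $k$th homology group $H_k(T)$ is zero. $\mathscr{T}_{n,k}$ denotes the set of such complexes. Each $T\in\mathscr{T}_{n,k}$ is identified with its set of $k$-dimensional faces, which is a subset of $\binom{[n]}{k+1}$ of size $\binom{n-1}{k}$. Accordingly, $\prod_{\tau\in T}$ ranges over these $k$-faces. $\tilde H_{k-1}(T)$ denotes the reduced $(k-1)$st homology group of $T$ with integer coefficients. For $T\in\mathscr{T}_{n,k}$ it is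 a finite abelian group, and $|\tilde H_{k-1}(T)|$ denotes its order. The degree $d_i=d_i(T)$ of a vertex $i\in[n]$ is the number of $k$-dimensional faces of $T$ containing $i$. Set $m_1=\binom{n-2}{k-1}$, $m_2=\binom{n-2}{k}$ and $m_3=\binom{n-1}{k}$. -}

module Defs where

open import Algebra.Bundles using (AbelianGroup)
open import Data.Bool.Base using (if_then_else_)
open import Data.Fin.Base as Fin using (Fin; fromℕ<)
open import Data.Fin.Properties using (_<?_)
open import Data.Fin.Subset using (Subset; inside; outside; _∈_; _⊆_; ∣_∣; _-_)
open import Data.Fin.Subset.Properties using (_∈?_)
open import Data.Integer.Base as ℤ using (ℤ; +_; -[1+_]; 0ℤ; -1ℤ; _⊖_)
import Data.Integer.Properties as ℤₚ
import Data.Integer.Solver as ℤSolver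
open import Data.List.Base as List using (List; _++_; length; filter; allFin)
open import Data.Nat.Base as ℕ using (ℕ; zero; suc; _∸_)
open import Data.Nat.Combinatorics using (_C_)
import Data.Nat.Properties as ℕₚ
open import Data.Product.Base using (Σ; ∃; ∃-syntax; _×_; _,_; proj₁; proj₂)
open import Data.Rational.Base as ℚ using (ℚ; 0ℚ; 1ℚ)
import Data.Rational.Properties as ℚₚ
import Data.Rational.Solver as ℚSolver
open import Data.Sum.Base using (inj₁; inj₂)
open import Data.Unit.Base using (⊤; tt)
open import Data.Vec.Base as Vec using ()
import Data.Vec.Properties as Vecₚ
open import Data.Vec.Functional using (Vector; foldr)
open import Function.Bundles using (Bijection)
open import Level using (0ℓ)
open import Relation.Binary.Bundles using (Setoid)
open import Relation.Binary.PropositionalEquality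
  using (_≡_; refl; sym; trans; cong; cong₂; subst; setoid)
open import Relation.Nullary.Decidable using (yes; no; does; _×-dec_)
open import Relation.Nullary.Negation using (contradiction)
open import Relation.Unary using (Pred; Decidable)
import Data.Bool.Properties as Boolₚ

-- Real numbers: Cauchy sequences of rationals with a modulus of
-- convergence, with the equality _≈ᴿ_.

record ℝ : Set where
  constructor mkℝ
  field
    seq    : ℕ → ℚ
    cauchy : ∀ ε → 0ℚ ℚ.< ε →
             ∃[ N ] ∀ m n → N ℕ.≤ m → N ℕ.≤ n → ℚ.∣ seq m ℚ.- seq n ∣ ℚ.≤ ε

open ℝ public

infix 4 _≤ᴿ_ _≈ᴿ_ _#0

_≤ᴿ_ : ℝ → ℝ → Set
x ≤ᴿ y = ∀ ε → 0ℚ ℚ.< ε → ∃[ N ] ∀ n → N ℕ.≤ n → seq x n ℚ.≤ seq y n ℚ.+ ε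

_≈ᴿ_ : ℝ → ℝ → Set
x ≈ᴿ y = x ≤ᴿ y × y ≤ᴿ x

-- Being nonzero, in the constructive sense of apartness from 0: this is
-- what inversion needs, and it is classically equivalent to ¬ (x ≈ᴿ 0ᴿ).
_#0 : ℝ → Set
x #0 = ∃[ δ ] 0ℚ ℚ.< δ × ∃[ N ] ∀ n → N ℕ.≤ n → δ ℚ.≤ ℚ.∣ seq x n ∣

private
  -- The largest of the moduli involved serves as a common modulus.
  ⊔ˡ : ∀ {a b n} → a ℕ.⊔ b ℕ.≤ n → a ℕ.≤ n
  ⊔ˡ {a} {b} = ℕₚ.≤-trans (ℕₚ.m≤m⊔n a b)

  ⊔ʳ : ∀ {a b n} → a ℕ.⊔ b ℕ.≤ n → b ℕ.≤ n
  ⊔ʳ {a} {b} = ℕₚ.≤-trans (ℕₚ.m≤n⊔m a b)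

  0<1 : 0ℚ ℚ.< 1ℚ
  0<1 = ℚₚ.positive⁻¹ 1ℚ

  *-pos : ∀ {p q} → 0ℚ ℚ.< p → 0ℚ ℚ.< q → 0ℚ ℚ.< p ℚ.* q
  *-pos {p} {q} 0<p 0<q =
    ℚₚ.positive⁻¹ _ {{ℚₚ.pos*pos⇒pos p {{ℚ.positive 0<p}} q {{ℚ.positive 0<q}}}}

  +-pos : ∀ {p q} → 0ℚ ℚ.< p → 0ℚ ℚ.< q → 0ℚ ℚ.< p ℚ.+ q
  +-pos = ℚₚ.+-mono-<

  *-mono : ∀ {p q r s} → 0ℚ ℚ.≤ r → 0ℚ ℚ.≤ q → p ℚ.≤ q → r ℚ.≤ s → p ℚ.* r ℚ.≤ q ℚ.* s
  *-mono {p} {q} {r} {s} 0≤r 0≤q p≤q r≤s = ℚₚ.≤-trans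
    (ℚₚ.*-monoʳ-≤-nonNeg r {{ℚ.nonNegative 0≤r}} p≤q)
    (ℚₚ.*-monoˡ-≤-nonNeg q {{ℚ.nonNegative 0≤q}} r≤s)

  quotient : ∀ {B ε} → 0ℚ ℚ.< B → 0ℚ ℚ.< ε → ∃[ η ] 0ℚ ℚ.< η × B ℚ.* η ≡ ε
  quotient {B} {ε} 0<B 0<ε = 1/B ℚ.* ε , *-pos 0<1/B 0<ε , eq
    where
    instance
      _ = ℚ.positive 0<B
      _ = ℚₚ.pos⇒nonZero B
    1/B = ℚ.1/ B
    0<1/B : 0ℚ ℚ.< 1/B
    0<1/B = ℚₚ.positive⁻¹ 1/B {{ℚₚ.1/pos⇒pos B}}
    eq : B ℚ.* (1/B ℚ.* ε) ≡ ε
    eq = trans (sym (ℚₚ.*-assoc B 1/B ε))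
               (trans (cong (ℚ._* ε) (ℚₚ.*-inverseʳ B)) (ℚₚ.*-identityˡ ε))

  eventuallyBounded : ∀ x → ∃[ B ] 0ℚ ℚ.< B × ∃[ N ] ∀ n → N ℕ.≤ n → ℚ.∣ seq x n ∣ ℚ.≤ B
  eventuallyBounded x with cauchy x 1ℚ 0<1
  ... | N , c = 1ℚ ℚ.+ ℚ.∣ seq x N ∣
              , ℚₚ.+-mono-<-≤ 0<1 (ℚₚ.0≤∣p∣ (seq x N))
              , N , λ n N≤n → begin
    ℚ.∣ seq x n ∣                                   ≡⟨ cong ℚ.∣_∣ (split (seq x n) (seq x N)) ⟩
    ℚ.∣ (seq x n ℚ.- seq x N) ℚ.+ seq x N ∣         ≤⟨ ℚₚ.∣p+q∣≤∣p∣+∣q∣ (seq x n ℚ.- seq x N) (seq x N) ⟩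
    ℚ.∣ seq x n ℚ.- seq x N ∣ ℚ.+ ℚ.∣ seq x N ∣     ≤⟨ ℚₚ.+-monoˡ-≤ ℚ.∣ seq x N ∣ (c n N N≤n ℕₚ.≤-refl) ⟩
    1ℚ ℚ.+ ℚ.∣ seq x N ∣                            ∎
    where
    open ℚₚ.≤-Reasoning
    open ℚSolver.+-*-Solver
    split : ∀ a b → a ≡ (a ℚ.- b) ℚ.+ b
    split = solve 2 (λ a b → a := (a :- b) :+ b) refl

ℚ→ℝ : ℚ → ℝ
ℚ→ℝ q = mkℝ (λ _ → q) λ ε 0<ε → 0 , λ _ _ _ _ →
  subst (λ d → ℚ.∣ d ∣ ℚ.≤ ε) (sym (ℚₚ.+-inverseʳ q)) (ℚₚ.<⇒≤ 0<ε)

ℕ→ℝ : ℕ → ℝ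
ℕ→ℝ n = ℚ→ℝ (+ n ℚ./ 1)

0ᴿ 1ᴿ : ℝ
0ᴿ = ℚ→ℝ 0ℚ
1ᴿ = ℚ→ℝ 1ℚ

infixl 6 _+ᴿ_
infixl 7 _*ᴿ_ _/ᴿ_[_]
infixr 8 _^ᴿ_ _^ᴿ_[_]

_+ᴿ_ : ℝ → ℝ → ℝ
x +ᴿ y = mkℝ (λ n → seq x n ℚ.+ seq y n) λ ε 0<ε →
  let η , 0<η , eq = quotient {1ℚ ℚ.+ 1ℚ} (+-pos 0<1 0<1) 0<ε
      M , cx = cauchy x η 0<η
      N , cy = cauchy y η 0<η
  in M ℕ.⊔ N , λ m n p q → begin
    ℚ.∣ (seq x m ℚ.+ seq y m) ℚ.- (seq x n ℚ.+ seq y n) ∣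
      ≡⟨ cong ℚ.∣_∣ (regroup (seq x m) (seq y m) (seq x n) (seq y n)) ⟩
    ℚ.∣ (seq x m ℚ.- seq x n) ℚ.+ (seq y m ℚ.- seq y n) ∣
      ≤⟨ ℚₚ.∣p+q∣≤∣p∣+∣q∣ (seq x m ℚ.- seq x n) (seq y m ℚ.- seq y n) ⟩
    ℚ.∣ seq x m ℚ.- seq x n ∣ ℚ.+ ℚ.∣ seq y m ℚ.- seq y n ∣
      ≤⟨ ℚₚ.+-mono-≤ (cx m n (⊔ˡ p) (⊔ˡ q)) (cy m n (⊔ʳ {M} p) (⊔ʳ {M} q)) ⟩
    η ℚ.+ η                  ≡⟨ double η ⟩
    (1ℚ ℚ.+ 1ℚ) ℚ.* η        ≡⟨ eq ⟩
    ε                        ∎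
  where
  open ℚₚ.≤-Reasoning
  open ℚSolver.+-*-Solver
  regroup : ∀ a b c d → (a ℚ.+ b) ℚ.- (c ℚ.+ d) ≡ (a ℚ.- c) ℚ.+ (b ℚ.- d)
  regroup = solve 4 (λ a b c d → (a :+ b) :- (c :+ d) := (a :- c) :+ (b :- d)) refl
  double : ∀ a → a ℚ.+ a ≡ (1ℚ ℚ.+ 1ℚ) ℚ.* a
  double = solve 1 (λ a → a :+ a := (con 1ℚ :+ con 1ℚ) :* a) refl

_*ᴿ_ : ℝ → ℝ → ℝ
x *ᴿ y = mkℝ (λ n → seq x n ℚ.* seq y n) λ ε 0<ε →
  let A , 0<A , K , bx = eventuallyBounded x
      B , 0<B , L , by = eventuallyBounded y
      η , 0<η , eq = quotient (+-pos 0<A 0<B) 0<ε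
      M , cx = cauchy x η 0<η
      N , cy = cauchy y η 0<η
  in (K ℕ.⊔ L) ℕ.⊔ (M ℕ.⊔ N) , λ m n p q → begin
    ℚ.∣ (seq x m ℚ.* seq y m) ℚ.- (seq x n ℚ.* seq y n) ∣
      ≡⟨ cong ℚ.∣_∣ (regroup (seq x m) (seq y m) (seq x n) (seq y n)) ⟩
    ℚ.∣ seq x m ℚ.* (seq y m ℚ.- seq y n) ℚ.+ seq y n ℚ.* (seq x m ℚ.- seq x n) ∣
      ≤⟨ ℚₚ.∣p+q∣≤∣p∣+∣q∣ (seq x m ℚ.* (seq y m ℚ.- seq y n)) (seq y n ℚ.* (seq x m ℚ.- seq x n)) ⟩
    ℚ.∣ seq x m ℚ.* (seq y m ℚ.- seq y n) ∣ ℚ.+ ℚ.∣ seq y n ℚ.* (seq x m ℚ.- seq x n) ∣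
      ≡⟨ cong₂ ℚ._+_ (ℚₚ.∣p*q∣≡∣p∣*∣q∣ (seq x m) (seq y m ℚ.- seq y n))
                     (ℚₚ.∣p*q∣≡∣p∣*∣q∣ (seq y n) (seq x m ℚ.- seq x n)) ⟩
    ℚ.∣ seq x m ∣ ℚ.* ℚ.∣ seq y m ℚ.- seq y n ∣ ℚ.+ ℚ.∣ seq y n ∣ ℚ.* ℚ.∣ seq x m ℚ.- seq x n ∣
      ≤⟨ ℚₚ.+-mono-≤
           (*-mono (ℚₚ.0≤∣p∣ (seq y m ℚ.- seq y n)) (ℚₚ.<⇒≤ 0<A)
             (bx m (⊔ˡ (⊔ˡ {K ℕ.⊔ L} p)))
             (cy m n (⊔ʳ {M} (⊔ʳ {K ℕ.⊔ L} p)) (⊔ʳ {M} (⊔ʳ {K ℕ.⊔ L} q))))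
           (*-mono (ℚₚ.0≤∣p∣ (seq x m ℚ.- seq x n)) (ℚₚ.<⇒≤ 0<B)
             (by n (⊔ʳ {K} (⊔ˡ {K ℕ.⊔ L} q)))
             (cx m n (⊔ˡ {M} (⊔ʳ {K ℕ.⊔ L} p)) (⊔ˡ {M} (⊔ʳ {K ℕ.⊔ L} q)))) ⟩
    A ℚ.* η ℚ.+ B ℚ.* η      ≡⟨ ℚₚ.*-distribʳ-+ η A B ⟨
    (A ℚ.+ B) ℚ.* η          ≡⟨ eq ⟩
    ε                        ∎
  where
  open ℚₚ.≤-Reasoning
  open ℚSolver.+-*-Solver
  regroup : ∀ a b c d →
    (a ℚ.* b) ℚ.- (c ℚ.* d) ≡ a ℚ.* (b ℚ.- d) ℚ.+ d ℚ.* (a ℚ.- c)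
  regroup = solve 4 (λ a b c d →
    (a :* b) :- (c :* d) := a :* (b :- d) :+ d :* (a :- c)) refl

-- The rational inverse, extended by the junk value 0 at 0; a sequence that
-- is bounded away from 0 only meets the junk value finitely often.
invℚ : ℚ → ℚ
invℚ p with p ℚₚ.≟ 0ℚ
... | yes _  = 0ℚ
... | no p≢0 = (ℚ.1/ p) {{ℚ.≢-nonZero p≢0}}

private
  *-invℚ : ∀ {δ} p → 0ℚ ℚ.< δ → δ ℚ.≤ ℚ.∣ p ∣ → p ℚ.* invℚ p ≡ 1ℚ
  *-invℚ p 0<δ δ≤ with p ℚₚ.≟ 0ℚ
  ... | yes refl = contradiction (ℚₚ.<-≤-trans 0<δ δ≤) (ℚₚ.<-irrefl refl)
  ... | no p≢0   = ℚₚ.*-inverseʳ p {{ℚ.≢-nonZero p≢0}}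

  invℚ-lipschitz : ∀ {δ η} p q → 0ℚ ℚ.< δ → δ ℚ.≤ ℚ.∣ p ∣ → δ ℚ.≤ ℚ.∣ q ∣ →
                   ℚ.∣ q ℚ.- p ∣ ℚ.≤ (δ ℚ.* δ) ℚ.* η → ℚ.∣ invℚ p ℚ.- invℚ q ∣ ℚ.≤ η
  invℚ-lipschitz {δ} {η} p q 0<δ δ≤p δ≤q close =
    ℚₚ.*-cancelˡ-≤-pos (δ ℚ.* δ) {{ℚ.positive (*-pos 0<δ 0<δ)}} (begin
      (δ ℚ.* δ) ℚ.* ℚ.∣ d ∣
        ≤⟨ ℚₚ.*-monoʳ-≤-nonNeg ℚ.∣ d ∣ {{ℚₚ.∣-∣-nonNeg d}}
             (*-mono (ℚₚ.<⇒≤ 0<δ) (ℚₚ.0≤∣p∣ p) δ≤p δ≤q) ⟩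
      (ℚ.∣ p ∣ ℚ.* ℚ.∣ q ∣) ℚ.* ℚ.∣ d ∣   ≡⟨ cong (ℚ._* ℚ.∣ d ∣) (ℚₚ.∣p*q∣≡∣p∣*∣q∣ p q) ⟨
      ℚ.∣ p ℚ.* q ∣ ℚ.* ℚ.∣ d ∣           ≡⟨ ℚₚ.∣p*q∣≡∣p∣*∣q∣ (p ℚ.* q) d ⟨
      ℚ.∣ (p ℚ.* q) ℚ.* d ∣               ≡⟨ cong ℚ.∣_∣ clear ⟩
      ℚ.∣ q ℚ.- p ∣                       ≤⟨ close ⟩
      (δ ℚ.* δ) ℚ.* η                     ∎)
    where
    open ℚₚ.≤-Reasoning
    d = invℚ p ℚ.- invℚ q
    expand : ∀ p q a b → (p ℚ.* q) ℚ.* (a ℚ.- b) ≡ (p ℚ.* a) ℚ.* q ℚ.- (q ℚ.* b) ℚ.* p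
    expand = solve 4 (λ p q a b → (p :* q) :* (a :- b) := (p :* a) :* q :- (q :* b) :* p) refl
      where open ℚSolver.+-*-Solver
    clear : (p ℚ.* q) ℚ.* d ≡ q ℚ.- p
    clear = trans (expand p q (invℚ p) (invℚ q))
      (cong₂ ℚ._-_ (trans (cong (ℚ._* q) (*-invℚ p 0<δ δ≤p)) (ℚₚ.*-identityˡ q))
                   (trans (cong (ℚ._* p) (*-invℚ q 0<δ δ≤q)) (ℚₚ.*-identityˡ p)))

invᴿ : (x : ℝ) → x #0 → ℝ
invᴿ x (δ , 0<δ , K , away) = mkℝ (λ n → invℚ (seq x n)) λ ε 0<ε →
  let N , c = cauchy x ((δ ℚ.* δ) ℚ.* ε) (*-pos (*-pos 0<δ 0<δ) 0<ε)
  in K ℕ.⊔ N , λ m n p q →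
     invℚ-lipschitz (seq x m) (seq x n) 0<δ (away m (⊔ˡ p)) (away n (⊔ˡ q))
       (c n m (⊔ʳ {K} q) (⊔ʳ {K} p))

_/ᴿ_[_] : ℝ → (y : ℝ) → y #0 → ℝ
x /ᴿ y [ y#0 ] = x *ᴿ invᴿ y y#0

_² : ℝ → ℝ
x ² = x *ᴿ x

_^ᴿ_ : ℝ → ℕ → ℝ
x ^ᴿ zero  = 1ᴿ
x ^ᴿ suc n = x *ᴿ x ^ᴿ n

_^ᴿ_[_] : (x : ℝ) → ℤ → x #0 → ℝ
x ^ᴿ (+ n)    [ _   ] = x ^ᴿ n
x ^ᴿ -[1+ n ] [ x#0 ] = invᴿ x x#0 ^ᴿ suc n

∑ᴿ ∏ᴿ : ∀ {n} → Vector ℝ n → ℝ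
∑ᴿ = foldr _+ᴿ_ 0ᴿ
∏ᴿ = foldr _*ᴿ_ 1ᴿ

1#0 : 1ᴿ #0
1#0 = 1ℚ , 0<1 , 0 , λ _ _ → ℚₚ.≤-refl

*-#0 : ∀ {x y} → x #0 → y #0 → (x *ᴿ y) #0
*-#0 {x} {y} (δ , 0<δ , M , p) (η , 0<η , N , q) =
  δ ℚ.* η , *-pos 0<δ 0<η , M ℕ.⊔ N , λ n r →
  subst (δ ℚ.* η ℚ.≤_) (sym (ℚₚ.∣p*q∣≡∣p∣*∣q∣ (seq x n) (seq y n)))
    (*-mono (ℚₚ.<⇒≤ 0<η) (ℚₚ.0≤∣p∣ (seq x n)) (p n (⊔ˡ r)) (q n (⊔ʳ {M} r)))

²-#0 : ∀ {x} → x #0 → (x ²) #0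
²-#0 {x} x#0 = *-#0 {x} {x} x#0 x#0

^-#0 : ∀ {x} m → x #0 → (x ^ᴿ m) #0
^-#0     zero    x#0 = 1#0
^-#0 {x} (suc m) x#0 = *-#0 {x} {x ^ᴿ m} x#0 (^-#0 m x#0)

private
  0≤²ℚ : ∀ p → 0ℚ ℚ.≤ p ℚ.* p
  0≤²ℚ p with ℚₚ.≤-total 0ℚ p
  ... | inj₁ 0≤p = ℚₚ.nonNegative⁻¹ (p ℚ.* p)
    {{ℚₚ.nonNeg*nonNeg⇒nonNeg p {{ℚ.nonNegative 0≤p}} p {{ℚ.nonNegative 0≤p}}}}
  ... | inj₂ p≤0 = ℚₚ.nonNegative⁻¹ (p ℚ.* p)
    {{ℚₚ.nonPos*nonPos⇒nonPos p {{ℚ.nonPositive p≤0}} p {{ℚ.nonPositive p≤0}}}}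

  0≤∑² : ∀ {n} (x : Vector ℝ n) m → 0ℚ ℚ.≤ seq (∑ᴿ (λ i → x i ²)) m
  0≤∑² {zero}  x m = ℚₚ.≤-refl
  0≤∑² {suc n} x m = ℚₚ.+-mono-≤ (0≤²ℚ (seq (x Fin.zero) m)) (0≤∑² (λ i → x (Fin.suc i)) m)

  ≤-addʳ : ∀ p q → 0ℚ ℚ.≤ q → p ℚ.≤ p ℚ.+ q
  ≤-addʳ p q 0≤q = ℚₚ.≤-trans (ℚₚ.≤-reflexive (sym (ℚₚ.+-identityʳ p))) (ℚₚ.+-monoʳ-≤ p 0≤q)

  ≤-addˡ : ∀ p q r → 0ℚ ℚ.≤ p → q ℚ.≤ r → q ℚ.≤ p ℚ.+ r
  ≤-addˡ p q r 0≤p q≤r = ℚₚ.≤-trans (ℚₚ.≤-reflexive (sym (ℚₚ.+-identityˡ q))) (ℚₚ.+-mono-≤ 0≤p q≤r)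

  ²≤∑² : ∀ {n} (x : Vector ℝ n) i m → seq (x i ²) m ℚ.≤ seq (∑ᴿ (λ i → x i ²)) m
  ²≤∑² x Fin.zero    m =
    ≤-addʳ (seq (x Fin.zero ²) m) (seq (∑ᴿ (λ i → x (Fin.suc i) ²)) m)
      (0≤∑² (λ i → x (Fin.suc i)) m)
  ²≤∑² x (Fin.suc i) m =
    ≤-addˡ (seq (x Fin.zero ²) m) (seq (x (Fin.suc i) ²) m) (seq (∑ᴿ (λ i → x (Fin.suc i) ²)) m)
      (0≤²ℚ (seq (x Fin.zero) m)) (²≤∑² (λ i → x (Fin.suc i)) i m)

  #0-mono : ∀ x y → (∀ m → 0ℚ ℚ.≤ seq x m) → (∀ m → seq x m ℚ.≤ seq y m) → x #0 → y #0
  #0-mono x y 0≤x x≤y (δ , 0<δ , N , away) = δ , 0<δ , N , λ m N≤m → begin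
    δ               ≤⟨ away m N≤m ⟩
    ℚ.∣ seq x m ∣   ≡⟨ ℚₚ.0≤p⇒∣p∣≡p (0≤x m) ⟩
    seq x m         ≤⟨ x≤y m ⟩
    seq y m         ≡⟨ ℚₚ.0≤p⇒∣p∣≡p (ℚₚ.≤-trans (0≤x m) (x≤y m)) ⟨
    ℚ.∣ seq y m ∣   ∎
    where open ℚₚ.≤-Reasoning

∑²-#0 : ∀ {n} (x : Vector ℝ n) (i : Fin n) → x i #0 → ∑ᴿ (λ i → x i ²) #0
∑²-#0 x i x#0 = #0-mono (x i ²) (∑ᴿ (λ i → x i ²))
  (λ m → 0≤²ℚ (seq (x i) m)) (²≤∑² x i) (²-#0 {x i} x#0)

_⟶_ : (ℕ → ℝ) → ℝ → Set
u ⟶ l = ∀ ε → 0ℚ ℚ.< ε →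
  ∃[ J ] ∀ j → J ℕ.≤ j → u j ≤ᴿ l +ᴿ ℚ→ℝ ε × l ≤ᴿ u j +ᴿ ℚ→ℝ ε

IsInfimum : Pred ℝ 0ℓ → ℝ → Set
IsInfimum P l = (∀ v → P v → l ≤ᴿ v) × (∀ b → (∀ v → P v → b ≤ᴿ v) → b ≤ᴿ l)

record SimplicialComplex (n : ℕ) : Set₁ where
  field
    Face   : Pred (Subset n) 0ℓ
    face?  : Decidable Face
    closed : ∀ {σ τ} → σ ⊆ τ → Face τ → Face σ

open SimplicialComplex public

subsets : ∀ n → List (Subset n)
subsets zero    = List.[ Vec.[] ]
subsets (suc n) = List.map (inside Vec.∷_) (subsets n) ++ List.map (outside Vec.∷_) (subsets n)

-- Faces are graded by cardinality: the faces of dimension d are those with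
-- d + 1 elements, and the empty face has dimension -1.
faces : ∀ {n} → SimplicialComplex n → ℕ → List (Subset n)
faces {n} T p = filter (λ σ → face? T σ ×-dec (∣ σ ∣ ℕₚ.≟ p)) (subsets n)

#faces : ∀ {n} → SimplicialComplex n → ℕ → ℕ
#faces T p = length (faces T p)

face : ∀ {n} (T : SimplicialComplex n) {p} → Fin (#faces T p) → Subset n
face T = List.lookup (faces T _)

position : ∀ {n} → Fin n → Subset n → ℕ
position v τ = length (filter (λ u → (u ∈? τ) ×-dec (u <? v)) (allFin _))

∑ᶻ : ∀ {n} → Vector ℤ n → ℤ
∑ᶻ = foldr ℤ._+_ 0ℤ

-- The coefficient of σ in ∂[v₀ < … < v_d] = Σᵢ (-1)ⁱ [v₀, …, v̂ᵢ, …, v_d],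
-- where τ = {v₀, …, v_d}.
incidence : ∀ {n} → Subset n → Subset n → ℤ
incidence τ σ = ∑ᶻ λ v →
  if does ((v ∈? τ) ×-dec Vecₚ.≡-dec Boolₚ._≟_ σ (τ - v))
  then -1ℤ ℤ.^ position v τ
  else 0ℤ

Chain : ∀ {n} → SimplicialComplex n → ℕ → Set
Chain T p = Vector ℤ (#faces T p)

∂ : ∀ {n} (T : SimplicialComplex n) {p} → Chain T (suc p) → Chain T p
∂ T c i = ∑ᶻ λ j → incidence (face T j) (face T i) ℤ.* c j

IsCycle : ∀ {n} (T : SimplicialComplex n) {p} → Chain T p → Set
IsCycle T {zero}  c = ⊤
IsCycle T {suc p} c = ∀ i → ∂ T c i ≡ 0ℤ

Homologous : ∀ {n} (T : SimplicialComplex n) {p} → Chain T p → Chain T p → Set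
Homologous T {p} c c′ = Σ (Chain T (suc p)) λ b → ∀ i → c i ℤ.- c′ i ≡ ∂ T b i

private
  ∑-+ : ∀ {n} (a f g : Vector ℤ n) →
        ∑ᶻ (λ j → a j ℤ.* (f j ℤ.+ g j)) ≡ ∑ᶻ (λ j → a j ℤ.* f j) ℤ.+ ∑ᶻ (λ j → a j ℤ.* g j)
  ∑-+ {zero}  a f g = refl
  ∑-+ {suc n} a f g = trans
    (cong (λ s → a Fin.zero ℤ.* (f Fin.zero ℤ.+ g Fin.zero) ℤ.+ s)
      (∑-+ (λ j → a (Fin.suc j)) (λ j → f (Fin.suc j)) (λ j → g (Fin.suc j))))
    (solve 5 (λ a f g s t → a :* (f :+ g) :+ (s :+ t) := (a :* f :+ s) :+ (a :* g :+ t)) refl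
      (a Fin.zero) (f Fin.zero) (g Fin.zero) _ _)
    where open ℤSolver.+-*-Solver

  ∑-neg : ∀ {n} (a f : Vector ℤ n) →
          ∑ᶻ (λ j → a j ℤ.* (ℤ.- f j)) ≡ ℤ.- ∑ᶻ (λ j → a j ℤ.* f j)
  ∑-neg {zero}  a f = refl
  ∑-neg {suc n} a f = trans
    (cong (λ s → a Fin.zero ℤ.* (ℤ.- f Fin.zero) ℤ.+ s)
      (∑-neg (λ j → a (Fin.suc j)) (λ j → f (Fin.suc j))))
    (solve 3 (λ a f s → a :* (:- f) :+ (:- s) := :- (a :* f :+ s)) refl
      (a Fin.zero) (f Fin.zero) _)
    where open ℤSolver.+-*-Solver

  ∑-0 : ∀ {n} (a : Vector ℤ n) → ∑ᶻ (λ j → a j ℤ.* 0ℤ) ≡ 0ℤ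
  ∑-0 {zero}  a = refl
  ∑-0 {suc n} a = cong₂ ℤ._+_ (ℤₚ.*-zeroʳ (a Fin.zero)) (∑-0 (λ j → a (Fin.suc j)))

module _ {n} (T : SimplicialComplex n) where

  private
    ∂-+ : ∀ {p} (b c : Chain T (suc p)) i → ∂ T (λ j → b j ℤ.+ c j) i ≡ ∂ T b i ℤ.+ ∂ T c i
    ∂-+ b c i = ∑-+ (λ j → incidence (face T j) (face T i)) b c

    ∂-neg : ∀ {p} (b : Chain T (suc p)) i → ∂ T (λ j → ℤ.- b j) i ≡ ℤ.- ∂ T b i
    ∂-neg b i = ∑-neg (λ j → incidence (face T j) (face T i)) b

    ∂-0 : ∀ {p} i → ∂ T {p} (λ _ → 0ℤ) i ≡ 0ℤ
    ∂-0 i = ∑-0 (λ j → incidence (face T j) (face T i))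

    cycle-+ : ∀ {p} (b c : Chain T p) → IsCycle T b → IsCycle T c → IsCycle T (λ j → b j ℤ.+ c j)
    cycle-+ {zero}  b c _ _ = tt
    cycle-+ {suc p} b c x y i = trans (∂-+ b c i) (cong₂ ℤ._+_ (x i) (y i))

    cycle-neg : ∀ {p} (b : Chain T p) → IsCycle T b → IsCycle T (λ j → ℤ.- b j)
    cycle-neg {zero}  b _ = tt
    cycle-neg {suc p} b x i = trans (∂-neg b i) (cong ℤ.-_ (x i))

    cycle-0 : ∀ {p} → IsCycle T {p} (λ _ → 0ℤ)
    cycle-0 {zero}  = tt
    cycle-0 {suc p} = ∂-0

    ≗⇒~ : ∀ {p} (c c′ : Chain T p) → (∀ i → c i ≡ c′ i) → Homologous T c c′
    ≗⇒~ c c′ eq = (λ _ → 0ℤ) , λ i → trans (ℤₚ.i≡j⇒i-j≡0 (eq i)) (sym (∂-0 i))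

    ~-sym : ∀ {p} (c d : Chain T p) → Homologous T c d → Homologous T d c
    ~-sym c d (b , eq) = (λ j → ℤ.- b j) , λ i → trans
      (solve 2 (λ c d → d :- c := :- (c :- d)) refl (c i) (d i))
      (trans (cong ℤ.-_ (eq i)) (sym (∂-neg b i)))
      where open ℤSolver.+-*-Solver

    ~-trans : ∀ {p} (c d e : Chain T p) → Homologous T c d → Homologous T d e → Homologous T c e
    ~-trans c d e (a , p) (b , q) = (λ j → a j ℤ.+ b j) , λ i → trans
      (solve 3 (λ c d e → c :- e := (c :- d) :+ (d :- e)) refl (c i) (d i) (e i))
      (trans (cong₂ ℤ._+_ (p i) (q i)) (sym (∂-+ a b i)))
      where open ℤSolver.+-*-Solver

    ~-+ : ∀ {p} (c c′ d d′ : Chain T p) → Homologous T c c′ → Homologous T d d′ →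
          Homologous T (λ i → c i ℤ.+ d i) (λ i → c′ i ℤ.+ d′ i)
    ~-+ c c′ d d′ (a , p) (b , q) = (λ j → a j ℤ.+ b j) , λ i → trans
      (solve 4 (λ c c′ d d′ → (c :+ d) :- (c′ :+ d′) := (c :- c′) :+ (d :- d′)) refl
        (c i) (c′ i) (d i) (d′ i))
      (trans (cong₂ ℤ._+_ (p i) (q i)) (sym (∂-+ a b i)))
      where open ℤSolver.+-*-Solver

    ~-neg : ∀ {p} (c d : Chain T p) → Homologous T c d →
            Homologous T (λ i → ℤ.- c i) (λ i → ℤ.- d i)
    ~-neg c d (b , eq) = (λ j → ℤ.- b j) , λ i → trans
      (solve 2 (λ c d → (:- c) :- (:- d) := :- (c :- d)) refl (c i) (d i))
      (trans (cong ℤ.-_ (eq i)) (sym (∂-neg b i)))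
      where open ℤSolver.+-*-Solver

  -- Reduced integral homology at the faces with p elements, so that
  -- H̃ T p is H̃_{p-1}(T).
  H̃ : ℕ → AbelianGroup 0ℓ 0ℓ
  H̃ p = record
    { Carrier = Σ (Chain T p) (IsCycle T)
    ; _≈_     = λ z z′ → Homologous T (proj₁ z) (proj₁ z′)
    ; _∙_     = λ (z , x) (z′ , y) → (λ i → z i ℤ.+ z′ i) , cycle-+ z z′ x y
    ; ε       = (λ _ → 0ℤ) , cycle-0
    ; _⁻¹     = λ (z , x) → (λ i → ℤ.- z i) , cycle-neg z x
    ; isAbelianGroup = record
      { isGroup = record
        { isMonoid = record
          { isSemigroup = record
            { isMagma = record
              { isEquivalence = record
                { refl  = λ {(c , _)} → ≗⇒~ c c (λ _ → refl)
                ; sym   = λ {(c , _)} {(d , _)} → ~-sym c d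
                ; trans = λ {(c , _)} {(d , _)} {(e , _)} → ~-trans c d e
                }
              ; ∙-cong = λ {(c , _)} {(c′ , _)} {(d , _)} {(d′ , _)} → ~-+ c c′ d d′
              }
            ; assoc = λ (c , _) (d , _) (e , _) → ≗⇒~ _ _ (λ i → ℤₚ.+-assoc (c i) (d i) (e i))
            }
          ; identity = (λ (c , _) → ≗⇒~ _ _ (λ i → ℤₚ.+-identityˡ (c i)))
                     , (λ (c , _) → ≗⇒~ _ _ (λ i → ℤₚ.+-identityʳ (c i)))
          }
        ; inverse = (λ (c , _) → ≗⇒~ _ _ (λ i → ℤₚ.+-inverseˡ (c i)))
                  , (λ (c , _) → ≗⇒~ _ _ (λ i → ℤₚ.+-inverseʳ (c i)))
        ; ⁻¹-cong = λ {(c , _)} {(d , _)} → ~-neg c d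
        }
      ; comm = λ (c , _) (d , _) → ≗⇒~ _ _ (λ i → ℤₚ.+-comm (c i) (d i))
      }
    }

IsZero : AbelianGroup 0ℓ 0ℓ → Set
IsZero A = ∀ a → a ≈ ε
  where open AbelianGroup A

HasOrder : AbelianGroup 0ℓ 0ℓ → ℕ → Set
HasOrder A h = Bijection (setoid (Fin h)) (AbelianGroup.setoid A)

-- Membership in 𝒯_{n,k}. As k ≥ 1 is assumed throughout, reduced and
-- unreduced homology agree in dimension k.
record IsℚAcyclic {n} (k : ℕ) (T : SimplicialComplex n) : Set where
  field
    dimension : (∃[ σ ] Face T σ × ∣ σ ∣ ≡ suc k) × (∀ σ → Face T σ → ∣ σ ∣ ℕ.≤ suc k)
    skeleton  : ∀ σ → ∣ σ ∣ ℕ.≤ k → Face T σ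
    count     : #faces T (suc k) ≡ (n ∸ 1) C k
    acyclic   : IsZero (H̃ T (suc k))

degree : ∀ {n} → ℕ → SimplicialComplex n → Fin n → ℕ
degree k T i = length (filter (i ∈?_) (faces T (suc k)))

∑∈ : ∀ {n} → Subset n → Vector ℝ n → ℝ
∑∈ τ y = ∑ᴿ λ i → if does (i ∈? τ) then y i else 0ᴿ

bound : ∀ {n k} → k ℕ.< n → SimplicialComplex n →
        (x : Vector ℝ n) → (∀ i → x i #0) → ℝ
bound {n} {k} k<n T x x#0 =
  ∏ᴿ (λ i → (x i ²) ^ᴿ (m₁ ⊖ degree k T i) [ ²-#0 {x i} (x#0 i) ])
    /ᴿ (S ^ᴿ m₁) [ ^-#0 m₁ (∑²-#0 x (fromℕ< k<n) (x#0 _)) ]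
    *ᴿ ∏ᴿ (λ j → ∑∈ (face T {suc k} j) (λ i → x i ²))
  where
  m₁ = (n ∸ 2) C (k ∸ 1)
  S  = ∑ᴿ (λ i → x i ²)

module _ {n k} (k<n : k ℕ.< n) (T : SimplicialComplex n) where

  IsValue : Pred ℝ 0ℓ
  IsValue v = Σ (Vector ℝ n) λ x → Σ (∀ i → x i #0) λ x#0 → v ≈ᴿ bound k<n T x x#0

  -- The values taken on ℝⁿ ∖ {0}: at a point x the value may be any limit of
  -- values along points tending to x with all coordinates nonzero. (Constant
  -- sequences give back IsValue.)
  IsLimitValue : Pred ℝ 0ℓ
  IsLimitValue v =
    Σ (Vector ℝ n) λ x → (∃[ i ] x i #0) ×
    Σ (ℕ → Vector ℝ n) λ y → Σ (∀ j i → y j i #0) λ y#0 →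
      (∀ i → (λ j → y j i) ⟶ x i) ×
      (λ j → bound k<n T (y j) (y#0 j)) ⟶ v

{-# OPTIONS --safe #-}
module Submission where

-- Scale the row of the boundary matrix of T at σ by 1/∏_{i∈σ} x_i and the column
-- at τ by ∏_{i∈τ} x_i: the column at τ gets squared norm Σ_{i∈τ} x_i². The
-- columns generate a sublattice of index |H̃_{k-1}(T)| in the lattice of integral
-- (k-1)-cycles of the full simplex, so Hadamard's inequality bounds the squared
-- index times the Gram determinant of a basis of that lattice. The basis of the
-- boundaries of the faces through a fixed apex has, with only the rows scaled,
-- Gram determinant (Σ x_i²)^{m₁} / ∏ x_i^{2 m₁}: eliminate one vertex at a time by
-- completing the square, which merges the vertex with the apex and adds up their
-- weights.
--
-- Gram determinants are computed by successive Schur complements; this makes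
-- Hadamard's inequality immediate. Everything takes place over ℚ, at each index
-- of the sequences that represent the x_i.

open import Defs
open import Data.Nat.Base using (ℕ; _≤_; _<_; _^_; _∸_)
open import Data.Fin.Base using (Fin)
open import Data.Product.Base using (_×_)
open import Data.Vec.Functional using (Vector)

open import Data.Bool.Base using (true; false; if_then_else_)
import Data.Bool.Properties as Boolₚ
open import Data.Fin.Base as Fin using (toℕ; fromℕ<; combine; remQuot)
open import Data.Fin.Properties as Finₚ using (_<?_)
open import Data.Fin.Subset as Subset using (Subset; inside; outside; ∣_∣; ⊥) renaming (_-_ to _∖_)
open import Data.Fin.Subset.Properties as Subsetₚ using (_∈?_)
open import Data.Integer.Base as ℤ using (ℤ; +_; -[1+_]; 0ℤ; 1ℤ; -1ℤ; _⊖_)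
import Data.Integer.DivMod as ℤDivMod
import Data.Integer.Properties as ℤₚ
import Data.Integer.Solver as ℤSolver
open import Data.List.Base as List
  using (List; []; _∷_; _++_; map; length; tabulate; filter; lookup; allFin)
open import Data.List.Membership.Propositional using (_∈_)
open import Data.List.Membership.Propositional.Properties
  using (∈-map⁻; ∈-++⁻; ∈-++⁺ˡ; ∈-++⁺ʳ; ∈-map⁺; ∈-filter⁺; ∈-filter⁻; ∈-lookup)
import Data.List.Properties as Listₚ
open import Data.List.Relation.Unary.All as All using (All; []; _∷_)
open import Data.List.Relation.Unary.AllPairs using ([]; _∷_)
open import Data.List.Relation.Unary.Any using (here; there; index)
open import Data.List.Relation.Unary.Any.Properties using (lookup-index)
open import Data.List.Relation.Unary.Unique.Propositional using (Unique)
import Data.List.Relation.Unary.Unique.Propositional.Properties as Uniqueₚ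
open import Data.Nat.Base as ℕ using (zero; suc)
open import Data.Nat.Combinatorics using (_C_; nCk+nC[k+1]≡[n+1]C[k+1])
import Data.Nat.Properties as ℕₚ
open import Data.Product.Base using (Σ; ∃-syntax; _,_; proj₁; proj₂)
open import Data.Rational.Base as ℚ using (ℚ; 0ℚ; 1ℚ; _+_; _*_; _-_; -_)
import Data.Rational.Properties as ℚₚ
import Data.Rational.Solver as ℚSolver
import Data.Rational.Unnormalised.Base as ℚᵘ
import Data.Rational.Unnormalised.Properties as ℚᵘₚ
open import Data.Sum.Base using (inj₁; inj₂)
open import Data.Vec.Base as Vec using (Vec; []; _∷_; toList; replicate)
open import Data.Vec.Functional using (foldr)
import Data.Vec.Properties as Vecₚ
open import Function.Base using (_∘_; id)
open import Function.Bundles using (Bijection)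
open import Relation.Binary.Definitions using (DecidableEquality)
open import Relation.Binary.PropositionalEquality
  using (_≡_; _≢_; refl; sym; trans; cong; cong₂; subst; subst₂; module ≡-Reasoning)
open import Relation.Nullary.Decidable using (Dec; yes; no; does; dec-true; dec-false; _×-dec_)
open import Relation.Nullary.Negation using (¬_; contradiction)
open import Relation.Unary using (Decidable)

open ℚSolver.+-*-Solver using (solve; _:=_; _:+_; _:*_; _:-_; :-_; con)
open ℤSolver.+-*-Solver using ()
  renaming (solve to solveᶻ; con to conᶻ; _:=_ to _≔_; _:+_ to _⊕_; _:*_ to _⊗_; _:-_ to _⊝_; :-_ to ⊝′_)

-- A cycle of the simplex is determined by its values off the apex, and any integral values there
-- extend to a cycle, the boundary of a cone. So the cycle lattice becomes a full coordinate
-- lattice, indexed by the sets off the apex, with its weighted norm transported to the form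
-- `energy`; the boundary matrix loses its rows through the apex and becomes square. Its determinant
-- is never formed: integral operations make the columns triangular, and the homology classes inject
-- into the box of residues modulo the pivots. That yields the inequality between the order and the
-- index in the direction the bound asks for. The obstacle in working with Schur complements is that
-- they acquire a radical, so forms are only semidefinite and pivots may vanish. Semidefiniteness
-- makes an isotropic vector orthogonal to everything, and together with `invℚ 0ℚ ≡ 0ℚ` this keeps
-- the determinant identities valid in the degenerate cases. The weights occur only as squares, so
-- at each index they are positive rationals and no roots arise.

-- Rational arithmetic with a total inverse

-- Lets the ring solver work modulo a relation `p ≡ q`, with cofactor `z`. Inverses are atoms for
-- the solver; the relations are mostly `p * invℚ p ≡ 1ℚ`, and nested uses combine several of them.
modulo : ∀ {a b} p q z → p ≡ q → a ≡ b + (p - q) * z → a ≡ b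
modulo {a} {b} p _ z refl eq =
  trans eq (solve 3 (λ b p z → b :+ (p :- p) :* z := b) refl b p z)

*-invℚ : ∀ {p} → p ≢ 0ℚ → p * invℚ p ≡ 1ℚ
*-invℚ {p} p≢0 with p ℚₚ.≟ 0ℚ
... | yes p≡0 = contradiction p≡0 p≢0
... | no p≢0′ = ℚₚ.*-inverseʳ p {{ℚ.≢-nonZero p≢0′}}

-- No hypothesis on p is needed since invℚ 0 = 0.
inv*inv : ∀ p → p * (invℚ p * invℚ p) ≡ invℚ p
inv*inv p with p ℚₚ.≟ 0ℚ
... | yes refl = refl
... | no p≢0 = modulo (p * i) 1ℚ i (ℚₚ.*-inverseʳ p {{ℚ.≢-nonZero p≢0}})
    (solve 2 (λ p i → p :* (i :* i) := i :+ (p :* i :- con 1ℚ) :* i) refl p i)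
  where i = (ℚ.1/ p) {{ℚ.≢-nonZero p≢0}}

invℚ-unique : ∀ p q → p * q ≡ 1ℚ → invℚ p ≡ q
invℚ-unique p q pq≡1 with p ℚₚ.≟ 0ℚ
... | yes refl = contradiction (trans (sym (ℚₚ.*-zeroˡ q)) pq≡1) (λ ())
... | no p≢0 = modulo (p * i) 1ℚ q (ℚₚ.*-inverseʳ p {{ℚ.≢-nonZero p≢0}})
    (modulo (p * q) 1ℚ (- i) pq≡1
      (solve 3 (λ p i q → i := (q :+ (p :* i :- con 1ℚ) :* q) :+ (p :* q :- con 1ℚ) :* (:- i)) refl p i q))
  where i = (ℚ.1/ p) {{ℚ.≢-nonZero p≢0}}

*≢0 : ∀ {p q} → p ≢ 0ℚ → q ≢ 0ℚ → p * q ≢ 0ℚ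
*≢0 {p} {q} p≢0 q≢0 pq≡0 = p≢0 (begin
  p                   ≡⟨ ℚₚ.*-identityʳ p ⟨
  p * 1ℚ              ≡⟨ cong (p *_) (*-invℚ q≢0) ⟨
  p * (q * invℚ q)    ≡⟨ ℚₚ.*-assoc p q (invℚ q) ⟨
  p * q * invℚ q      ≡⟨ cong (_* invℚ q) pq≡0 ⟩
  0ℚ * invℚ q         ≡⟨ ℚₚ.*-zeroˡ (invℚ q) ⟩
  0ℚ                  ∎)
  where open ≡-Reasoning

invℚ-* : ∀ p q → invℚ (p * q) ≡ invℚ p * invℚ q
invℚ-* p q = cases (p ℚₚ.≟ 0ℚ) (q ℚₚ.≟ 0ℚ)
  where
  cases : Dec (p ≡ 0ℚ) → Dec (q ≡ 0ℚ) → invℚ (p * q) ≡ invℚ p * invℚ q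
  cases (yes refl) _ = trans (cong invℚ (ℚₚ.*-zeroˡ q)) (sym (ℚₚ.*-zeroˡ (invℚ q)))
  cases (no _) (yes refl) = trans (cong invℚ (ℚₚ.*-zeroʳ p)) (sym (ℚₚ.*-zeroʳ (invℚ p)))
  cases (no p≢0) (no q≢0) = invℚ-unique (p * q) (invℚ p * invℚ q) (begin
    p * q * (invℚ p * invℚ q)
      ≡⟨ solve 4 (λ p q i j → p :* q :* (i :* j) := (p :* i) :* (q :* j)) refl p q (invℚ p) (invℚ q) ⟩
    p * invℚ p * (q * invℚ q)   ≡⟨ cong₂ _*_ (*-invℚ p≢0) (*-invℚ q≢0) ⟩
    1ℚ                          ∎)
    where open ≡-Reasoning

0≤² : ∀ p → 0ℚ ℚ.≤ p * p
0≤² p with ℚₚ.≤-total 0ℚ p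
... | inj₁ 0≤p = ℚₚ.nonNegative⁻¹ (p * p)
  {{ℚₚ.nonNeg*nonNeg⇒nonNeg p {{ℚ.nonNegative 0≤p}} p {{ℚ.nonNegative 0≤p}}}}
... | inj₂ p≤0 = ℚₚ.nonNegative⁻¹ (p * p)
  {{ℚₚ.nonPos*nonPos⇒nonPos p {{ℚ.nonPositive p≤0}} p {{ℚ.nonPositive p≤0}}}}

0≤* : ∀ {p q} → 0ℚ ℚ.≤ p → 0ℚ ℚ.≤ q → 0ℚ ℚ.≤ p * q
0≤* {p} {q} 0≤p 0≤q = ℚₚ.nonNegative⁻¹ (p * q)
  {{ℚₚ.nonNeg*nonNeg⇒nonNeg p {{ℚ.nonNegative 0≤p}} q {{ℚ.nonNegative 0≤q}}}}

0<* : ∀ {p q} → 0ℚ ℚ.< p → 0ℚ ℚ.< q → 0ℚ ℚ.< p * q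
0<* {p} {q} 0<p 0<q =
  ℚₚ.positive⁻¹ _ {{ℚₚ.pos*pos⇒pos p {{ℚ.positive 0<p}} q {{ℚ.positive 0<q}}}}

*-mono-≤₀ : ∀ {p q r s} → 0ℚ ℚ.≤ r → 0ℚ ℚ.≤ q → p ℚ.≤ q → r ℚ.≤ s → p * r ℚ.≤ q * s
*-mono-≤₀ {p} {q} {r} {s} 0≤r 0≤q p≤q r≤s = ℚₚ.≤-trans
  (ℚₚ.*-monoʳ-≤-nonNeg r {{ℚ.nonNegative 0≤r}} p≤q)
  (ℚₚ.*-monoˡ-≤-nonNeg q {{ℚ.nonNegative 0≤q}} r≤s)

0≤invℚ : ∀ {p} → 0ℚ ℚ.≤ p → 0ℚ ℚ.≤ invℚ p
0≤invℚ {p} 0≤p = subst (0ℚ ℚ.≤_) (inv*inv p) (0≤* 0≤p (0≤² (invℚ p)))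

-- Schur complements and Gram determinants

infix 4 _≐_
_≐_ : ∀ {X Y : Set} → (X → Y) → (X → Y) → Set
f ≐ g = ∀ x → f x ≡ g x

infixl 6 _+[_]_
_+[_]_ : {X : Set} → (X → ℚ) → ℚ → (X → ℚ) → X → ℚ
(u +[ c ] w) x = u x + c * w x

-- Positive semidefinite, not definite, so that the notion is stable under Schur complements.
-- `congˡ` stands in for function extensionality.
record Form (X : Set) : Set where
  field
    ⟪_,_⟫     : (X → ℚ) → (X → ℚ) → ℚ
    symmetric : ∀ u v → ⟪ u , v ⟫ ≡ ⟪ v , u ⟫
    linearˡ   : ∀ u c w v → ⟪ u +[ c ] w , v ⟫ ≡ ⟪ u , v ⟫ + c * ⟪ w , v ⟫
    congˡ     : ∀ {u u′} v → u ≐ u′ → ⟪ u , v ⟫ ≡ ⟪ u′ , v ⟫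
    nonneg    : ∀ u → 0ℚ ℚ.≤ ⟪ u , u ⟫

  linearʳ : ∀ v u c w → ⟪ v , u +[ c ] w ⟫ ≡ ⟪ v , u ⟫ + c * ⟪ v , w ⟫
  linearʳ v u c w = trans (symmetric v _) (trans (linearˡ u c w v)
    (cong₂ (λ p q → p + c * q) (symmetric u v) (symmetric w v)))

  congʳ : ∀ v {u u′} → u ≐ u′ → ⟪ v , u ⟫ ≡ ⟪ v , u′ ⟫
  congʳ v eq = trans (symmetric v _) (trans (congˡ v eq) (symmetric _ v))

  zeroˡ : ∀ v → ⟪ (λ _ → 0ℚ) , v ⟫ ≡ 0ℚ
  zeroˡ v = begin
    ⟪ O , v ⟫             ≡⟨ solve 1 (λ p → p := (p :+ con 1ℚ :* p) :- p) refl ⟪ O , v ⟫ ⟩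
    ⟪ O , v ⟫ + 1ℚ * ⟪ O , v ⟫ - ⟪ O , v ⟫ ≡⟨ cong (_- ⟪ O , v ⟫) (linearˡ O 1ℚ O v) ⟨
    ⟪ O +[ 1ℚ ] O , v ⟫ - ⟪ O , v ⟫ ≡⟨ cong (_- ⟪ O , v ⟫) (congˡ v (λ _ → refl)) ⟩
    ⟪ O , v ⟫ - ⟪ O , v ⟫ ≡⟨ ℚₚ.+-inverseʳ ⟪ O , v ⟫ ⟩
    0ℚ                    ∎
    where
    open ≡-Reasoning
    O = λ _ → 0ℚ

  scaleˡ : ∀ c u v → ⟪ (λ x → c * u x) , v ⟫ ≡ c * ⟪ u , v ⟫
  scaleˡ c u v = begin
    ⟪ (λ x → c * u x) , v ⟫         ≡⟨ congˡ v (λ x → sym (ℚₚ.+-identityˡ (c * u x))) ⟩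
    ⟪ (λ _ → 0ℚ) +[ c ] u , v ⟫     ≡⟨ linearˡ _ c u v ⟩
    ⟪ (λ _ → 0ℚ) , v ⟫ + c * ⟪ u , v ⟫ ≡⟨ cong (_+ c * ⟪ u , v ⟫) (zeroˡ v) ⟩
    0ℚ + c * ⟪ u , v ⟫              ≡⟨ ℚₚ.+-identityˡ _ ⟩
    c * ⟪ u , v ⟫                   ∎
    where open ≡-Reasoning

  scale² : ∀ c u → ⟪ (λ x → c * u x) , (λ x → c * u x) ⟫ ≡ c * c * ⟪ u , u ⟫
  scale² c u = trans (scaleˡ c u _) (trans
    (cong (c *_) (trans (symmetric u _) (scaleˡ c u u)))
    (sym (ℚₚ.*-assoc c c _)))

  expand : ∀ u c w → ⟪ u +[ c ] w , u +[ c ] w ⟫ ≡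
           ⟪ u , u ⟫ + c * ⟪ u , w ⟫ + c * (⟪ u , w ⟫ + c * ⟪ w , w ⟫)
  expand u c w = trans (linearˡ u c w _)
    (cong₂ (λ p q → p + c * q) (linearʳ u u c w)
      (trans (linearʳ w u c w) (cong (_+ c * ⟪ w , w ⟫) (symmetric w u))))

  -- ⟪ u , v ⟫ ≢ 0 would let ⟪ v + c u , v + c u ⟫ = ⟪ v , v ⟫ + 2 c ⟪ u , v ⟫ take the value -1.
  degenerate : ∀ u → ⟪ u , u ⟫ ≡ 0ℚ → ∀ v → ⟪ u , v ⟫ ≡ 0ℚ
  degenerate u uu≡0 v with ⟪ u , v ⟫ ℚₚ.≟ 0ℚ
  ... | yes eq = eq
  ... | no uv≢0 = contradiction (subst (0ℚ ℚ.≤_) eq (nonneg (v +[ c ] u)))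
                    (λ 0≤ → ℚₚ.<-irrefl refl (ℚₚ.<-≤-trans (ℚₚ.negative⁻¹ (- 1ℚ)) 0≤))
    where
    b = ⟪ v , v ⟫
    g = ⟪ u , v ⟫
    i = invℚ g
    c = - (b + 1ℚ) * i * ℚ.½
    eq : ⟪ v +[ c ] u , v +[ c ] u ⟫ ≡ - 1ℚ
    eq = trans (expand v c u) (trans
      (cong₂ (λ p q → b + c * p + c * (p + c * q)) (symmetric v u) uu≡0)
      (modulo (g * i) 1ℚ (- (b + 1ℚ)) (*-invℚ uv≢0)
        (solve 3 (λ b g i →
          let c = (:- (b :+ con 1ℚ)) :* i :* con ℚ.½ in
          b :+ c :* g :+ c :* (g :+ c :* con 0ℚ) :=
          con (- 1ℚ) :+ (g :* i :- con 1ℚ) :* (:- (b :+ con 1ℚ))) refl b g i)))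

open Form using (⟪_,_⟫)

-- The form evaluated on the components orthogonal to `a`, kept as a form on all of `X → ℚ` so that
-- the construction iterates. If `a` is isotropic, the value `invℚ 0ℚ ≡ 0ℚ` gives back `B`.
schur : {X : Set} → Form X → (X → ℚ) → Form X
schur {X} B a = record
  { ⟪_,_⟫     = S
  ; symmetric = λ u v → trans (cong (_- u∙ u * u∙ v * i) (B.symmetric u v))
      (solve 4 (λ p q r i → p :- q :* r :* i := p :- r :* q :* i) refl B.⟪ v , u ⟫ (u∙ u) (u∙ v) i)
  ; linearˡ   = λ u c w v → trans
      (cong₂ (λ p q → p - q * u∙ v * i) (B.linearˡ u c w v) (B.linearˡ u c w a))
      (solve 7 (λ uv wv c ua wa va i →
        (uv :+ c :* wv) :- (ua :+ c :* wa) :* va :* i :=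
        (uv :- ua :* va :* i) :+ c :* (wv :- wa :* va :* i)) refl
        B.⟪ u , v ⟫ B.⟪ w , v ⟫ c (u∙ u) (u∙ w) (u∙ v) i)
  ; congˡ     = λ v eq → cong₂ (λ p q → p - q * u∙ v * i) (B.congˡ v eq) (B.congˡ a eq)
  ; nonneg    = λ u → subst (0ℚ ℚ.≤_) (projection u) (B.nonneg (u +[ - (u∙ u * i) ] a))
  }
  where
  module B = Form B
  u∙ : (X → ℚ) → ℚ
  u∙ u = B.⟪ u , a ⟫
  i = invℚ B.⟪ a , a ⟫
  S : (X → ℚ) → (X → ℚ) → ℚ
  S u v = B.⟪ u , v ⟫ - u∙ u * u∙ v * i
  projection : ∀ u → B.⟪ u +[ - (u∙ u * i) ] a , u +[ - (u∙ u * i) ] a ⟫ ≡ S u u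
  projection u = trans (B.expand u (- (u∙ u * i)) a)
    (modulo (α * (i * i)) i (u∙ u * u∙ u) (inv*inv α)
      (solve 4 (λ uu g α i →
        let c = :- (g :* i) in
        uu :+ c :* g :+ c :* (g :+ c :* α) :=
        (uu :- g :* g :* i) :+ (α :* (i :* i) :- i) :* (g :* g)) refl
        B.⟪ u , u ⟫ (u∙ u) α i))
    where α = B.⟪ a , a ⟫

opaque
  -- The product of the squared Gram-Schmidt norms, which is the determinant of the matrix of inner
  -- products. A zero pivot makes both vanish, since the form is semidefinite.
  gram : {X : Set} → Form X → List (X → ℚ) → ℚ
  gram B []       = 1ℚ
  gram B (a ∷ as) = ⟪_,_⟫ B a a * gram (schur B a) as

  gram-[] : ∀ {X} (B : Form X) → gram B [] ≡ 1ℚ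
  gram-[] B = refl

  gram-∷ : ∀ {X} (B : Form X) a as → gram B (a ∷ as) ≡ ⟪_,_⟫ B a a * gram (schur B a) as
  gram-∷ B a as = refl

infix 4 _≅_
_≅_ : {X : Set} → Form X → Form X → Set
B ≅ B′ = ∀ u v → ⟪_,_⟫ B u v ≡ ⟪_,_⟫ B′ u v

schur-≅ : ∀ {X} {B B′ : Form X} a → B ≅ B′ → schur B a ≅ schur B′ a
schur-≅ a eq u v = cong₂ _-_ (eq u v)
  (cong₂ _*_ (cong₂ _*_ (eq u a) (eq v a)) (cong invℚ (eq a a)))

schur-≐ : ∀ {X} (B : Form X) {a a′} → a ≐ a′ → schur B a ≅ schur B a′
schur-≐ B {a} {a′} eq u v = cong (λ p → ⟪_,_⟫ B u v - p)
  (cong₂ _*_ (cong₂ _*_ (B.congʳ u eq) (B.congʳ v eq))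
             (cong invℚ (trans (B.congˡ a eq) (B.congʳ a′ eq))))
  where module B = Form B

opaque
  unfolding gram

  gram-≅ : ∀ {X} {B B′ : Form X} as → B ≅ B′ → gram B as ≡ gram B′ as
  gram-≅ []       eq = refl
  gram-≅ {B = B} {B′} (a ∷ as) eq = cong₂ _*_ (eq a a) (gram-≅ as (schur-≅ {B = B} {B′} a eq))

-- Projecting away `a` puts it into the radical. If `a` is isotropic nothing is projected, but then
-- `degenerate` says that it was in the radical already.
schur-kill : ∀ {X} (B : Form X) a v → ⟪_,_⟫ (schur B a) a v ≡ 0ℚ
schur-kill B a v with ⟪_,_⟫ B a a ℚₚ.≟ 0ℚ
... | yes aa≡0 = trans (cong₂ (λ p q → p - q * B.⟪ v , a ⟫ * 0ℚ) (B.degenerate a aa≡0 v) aa≡0)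
                       (solve 1 (λ p → con 0ℚ :- con 0ℚ :* p :* con 0ℚ := con 0ℚ) refl B.⟪ v , a ⟫)
  where module B = Form B
... | no aa≢0 = trans (cong (λ p → p - α * B.⟪ v , a ⟫ * i) (B.symmetric a v))
    (modulo (α * i) 1ℚ (- B.⟪ v , a ⟫) (ℚₚ.*-inverseʳ α {{ℚ.≢-nonZero aa≢0}})
      (solve 3 (λ α p i → p :- α :* p :* i := con 0ℚ :+ (α :* i :- con 1ℚ) :* (:- p)) refl
        α B.⟪ v , a ⟫ i))
  where
  module B = Form B
  α = B.⟪ a , a ⟫
  i = (ℚ.1/ α) {{ℚ.≢-nonZero aa≢0}}

-- As `a` lies in the radical of `schur B a`, a multiple of it changes neither inner products with
-- `b` nor the norm of `b`.
schur-absorb : ∀ {X} (B : Form X) a b c → schur (schur B a) (b +[ c ] a) ≅ schur (schur B a) b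
schur-absorb B a b c u v = cong (λ p → S.⟪ u , v ⟫ - p)
  (cong₂ _*_ (cong₂ _*_ (red u) (red v))
    (cong invℚ (trans (red (b +[ c ] a)) (trans (S.symmetric _ b) (red b)))))
  where
  module S = Form (schur B a)
  red : ∀ u → S.⟪ u , b +[ c ] a ⟫ ≡ S.⟪ u , b ⟫
  red u = trans (S.linearʳ u b c a) (trans
    (cong (λ p → S.⟪ u , b ⟫ + c * p) (trans (S.symmetric u a) (schur-kill B a u)))
    (solve 2 (λ p c → p :+ c :* con 0ℚ := p) refl S.⟪ u , b ⟫ c))

opaque
  unfolding gram

  gram-add : ∀ {X} (B : Form X) a b c as → gram B (a ∷ b ∷ as) ≡ gram B (a ∷ (b +[ c ] a) ∷ as)
  gram-add B a b c as = cong (B.⟪ a , a ⟫ *_) (cong₂ _*_ norm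
      (gram-≅ {B = schur (schur B a) b} {schur (schur B a) (b +[ c ] a)} as
        (λ u v → sym (schur-absorb B a b c u v))))
    where
    module B = Form B
    module S = Form (schur B a)
    red : ∀ u → S.⟪ u , b +[ c ] a ⟫ ≡ S.⟪ u , b ⟫
    red u = trans (S.linearʳ u b c a) (trans
      (cong (λ p → S.⟪ u , b ⟫ + c * p) (trans (S.symmetric u a) (schur-kill B a u)))
      (solve 2 (λ p c → p :+ c :* con 0ℚ := p) refl S.⟪ u , b ⟫ c))
    norm : S.⟪ b , b ⟫ ≡ S.⟪ b +[ c ] a , b +[ c ] a ⟫
    norm = sym (trans (red _) (trans (S.symmetric _ b) (red b)))

opaque
  unfolding gram

  gram-≐₂ : ∀ {X} (B : Form X) a {b b′} → b ≐ b′ → ∀ as → gram B (a ∷ b ∷ as) ≡ gram B (a ∷ b′ ∷ as)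
  gram-≐₂ {X} B a {b} {b′} eq as = cong (⟪_,_⟫ B a a *_)
    (cong₂ _*_ (trans (S.congˡ b eq) (S.congʳ b′ eq))
      (gram-≅ {B = schur S b} {schur S b′} as (schur-≐ S eq)))
    where
    S : Form X
    S = schur B a
    module S = Form S

-- The leading two-by-two minor. If the first pivot is 0, so is the mixed product, by `degenerate`.
gram₂ : ∀ {X} (B : Form X) a b → ⟪_,_⟫ B a a * ⟪_,_⟫ (schur B a) b b ≡
        ⟪_,_⟫ B a a * ⟪_,_⟫ B b b - ⟪_,_⟫ B a b * ⟪_,_⟫ B a b
gram₂ B a b = cases (α ℚₚ.≟ 0ℚ)
  where
  module B = Form B
  α = B.⟪ a , a ⟫
  β = B.⟪ b , b ⟫
  γ = B.⟪ a , b ⟫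
  i = invℚ α
  cases : Dec (α ≡ 0ℚ) → α * (β - B.⟪ b , a ⟫ * B.⟪ b , a ⟫ * i) ≡ α * β - γ * γ
  cases (yes α≡0) = trans (cong (_* (β - B.⟪ b , a ⟫ * B.⟪ b , a ⟫ * i)) α≡0)
    (trans (ℚₚ.*-zeroˡ (β - B.⟪ b , a ⟫ * B.⟪ b , a ⟫ * i)) (sym (trans
      (cong₂ (λ p q → p * β - q * q) α≡0 (B.degenerate a α≡0 b))
      (solve 1 (λ β → con 0ℚ :* β :- con 0ℚ :* con 0ℚ := con 0ℚ) refl β))))
  cases (no α≢0) = trans (cong (λ g → α * (β - g * g * i)) (B.symmetric b a))
    (modulo (α * i) 1ℚ (- (γ * γ)) (*-invℚ α≢0)
      (solve 4 (λ α β γ i → α :* (β :- γ :* γ :* i) :=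
         (α :* β :- γ :* γ) :+ (α :* i :- con 1ℚ) :* (:- (γ :* γ))) refl α β γ i))

-- Symmetric in a and b, whence gram-swap.
schur₂ : ∀ {X} (B : Form X) a b → let open Form B renaming (⟪_,_⟫ to f) in
  f a a ≢ 0ℚ → f a a * f b b - f a b * f a b ≢ 0ℚ → ∀ u v →
  ⟪_,_⟫ (schur (schur B a) b) u v ≡ f u v - invℚ (f a a * f b b - f a b * f a b) *
    (f b b * f u a * f v a - f a b * (f u b * f v a + f u a * f v b) + f a a * f u b * f v b)
schur₂ B a b α≢0 δ≢0 u v = begin
    (uv - ua * va * i) - (ub - ua * B.⟪ b , a ⟫ * i) * (vb - va * B.⟪ b , a ⟫ * i) * invℚ (β - B.⟪ b , a ⟫ * B.⟪ b , a ⟫ * i)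
      ≡⟨ cong (λ γ → (uv - ua * va * i) - (ub - ua * γ * i) * (vb - va * γ * i) * invℚ (β - γ * γ * i)) (B.symmetric b a) ⟩
    (uv - ua * va * i) - (ub - ua * γ * i) * (vb - va * γ * i) * invℚ (β - γ * γ * i)
      ≡⟨ cong (λ j → (uv - ua * va * i) - (ub - ua * γ * i) * (vb - va * γ * i) * j) j≡ ⟩
    (uv - ua * va * i) - (ub - ua * γ * i) * (vb - va * γ * i) * (α * k)
      ≡⟨ step ⟩
    uv - k * (β * ua * va - γ * (ub * va + ua * vb) + α * ub * vb) ∎
  where
  open ≡-Reasoning
  module B = Form B
  α = B.⟪ a , a ⟫
  β = B.⟪ b , b ⟫
  γ = B.⟪ a , b ⟫
  ua = B.⟪ u , a ⟫
  ub = B.⟪ u , b ⟫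
  va = B.⟪ v , a ⟫
  vb = B.⟪ v , b ⟫
  uv = B.⟪ u , v ⟫
  i = invℚ α
  k = invℚ (α * β - γ * γ)
  αi≡1 = *-invℚ α≢0
  δk≡1 = *-invℚ δ≢0
  j≡ : invℚ (β - γ * γ * i) ≡ α * k
  j≡ = invℚ-unique (β - γ * γ * i) (α * k)
    (modulo (α * i) 1ℚ (- (γ * γ * k)) αi≡1
    (modulo ((α * β - γ * γ) * k) 1ℚ 1ℚ δk≡1
      (solve 5 (λ α β γ i k → (β :- γ :* γ :* i) :* (α :* k) :=
        con 1ℚ :+ (α :* i :- con 1ℚ) :* (:- (γ :* γ :* k)) :+ ((α :* β :- γ :* γ) :* k :- con 1ℚ) :* con 1ℚ)
        refl α β γ i k)))
  step : (uv - ua * va * i) - (ub - ua * γ * i) * (vb - va * γ * i) * (α * k) ≡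
         uv - k * (β * ua * va - γ * (ub * va + ua * vb) + α * ub * vb)
  step = modulo (α * i) 1ℚ (γ * k * (ub * va + ua * vb) - ua * va * γ * γ * i * k - ua * va * β * k) αi≡1
    (modulo ((α * β - γ * γ) * k) 1ℚ (ua * va * i) δk≡1
      (solve 10 (λ α β γ i k ua ub va vb uv →
        (uv :- ua :* va :* i) :- (ub :- ua :* γ :* i) :* (vb :- va :* γ :* i) :* (α :* k) :=
        uv :- k :* (β :* ua :* va :- γ :* (ub :* va :+ ua :* vb) :+ α :* ub :* vb)
          :+ (α :* i :- con 1ℚ) :* (γ :* k :* (ub :* va :+ ua :* vb) :- ua :* va :* γ :* γ :* i :* k :- ua :* va :* β :* k)
          :+ ((α :* β :- γ :* γ) :* k :- con 1ℚ) :* (ua :* va :* i))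
        refl α β γ i k ua ub va vb uv))

opaque
  unfolding gram

  -- Both sides start with the two-by-two minor `δ`. Either it vanishes and with it both products,
  -- or the twofold complement has the closed form `schur₂`, which does not see the order of `a` and
  -- `b`.
  gram-swap : ∀ {X} (B : Form X) a b as → gram B (a ∷ b ∷ as) ≡ gram B (b ∷ a ∷ as)
  gram-swap {X} B a b as = begin
      α * (S.⟪ b , b ⟫ * gram (schur S b) as)   ≡⟨ ℚₚ.*-assoc α S.⟪ b , b ⟫ _ ⟨
      α * S.⟪ b , b ⟫ * gram (schur S b) as     ≡⟨ cong (_* gram (schur S b) as) (gram₂ B a b) ⟩
      δ * gram (schur S b) as                   ≡⟨ cases (δ ℚₚ.≟ 0ℚ) ⟩
      δ * gram (schur S′ a) as                  ≡⟨ cong (_* gram (schur S′ a) as) δ-sym ⟨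
      δ′ * gram (schur S′ a) as                 ≡⟨ cong (_* gram (schur S′ a) as) (gram₂ B b a) ⟨
      β * S′.⟪ a , a ⟫ * gram (schur S′ a) as   ≡⟨ ℚₚ.*-assoc β S′.⟪ a , a ⟫ _ ⟩
      β * (S′.⟪ a , a ⟫ * gram (schur S′ a) as) ∎
    where
    open ≡-Reasoning
    module B = Form B
    S S′ : Form X
    S = schur B a
    S′ = schur B b
    module S = Form S
    module S′ = Form S′
    α β γ γ′ δ δ′ : ℚ
    α = B.⟪ a , a ⟫
    β = B.⟪ b , b ⟫
    γ = B.⟪ a , b ⟫
    γ′ = B.⟪ b , a ⟫
    δ = α * β - γ * γ
    δ′ = β * α - γ′ * γ′
    δ-sym : δ′ ≡ δ
    δ-sym = cong₂ (λ p g → p - g * g) (ℚₚ.*-comm β α) (B.symmetric b a)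
    α≢0 : δ ≢ 0ℚ → α ≢ 0ℚ
    α≢0 δ≢0 α≡0 = δ≢0 (trans (cong₂ (λ p q → p * β - q * q) α≡0 (B.degenerate a α≡0 b))
      (solve 1 (λ β → con 0ℚ :* β :- con 0ℚ :* con 0ℚ := con 0ℚ) refl β))
    β≢0 : δ ≢ 0ℚ → β ≢ 0ℚ
    β≢0 δ≢0 β≡0 = δ≢0 (trans
      (cong₂ (λ p q → α * p - q * q) β≡0 (trans (B.symmetric a b) (B.degenerate b β≡0 a)))
      (solve 1 (λ α → α :* con 0ℚ :- con 0ℚ :* con 0ℚ := con 0ℚ) refl α))
    cases : Dec (δ ≡ 0ℚ) → δ * gram (schur S b) as ≡ δ * gram (schur S′ a) as
    cases (yes δ≡0) = trans (cong (_* gram (schur S b) as) δ≡0) (trans (ℚₚ.*-zeroˡ (gram (schur S b) as))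
      (sym (trans (cong (_* gram (schur S′ a) as) δ≡0) (ℚₚ.*-zeroˡ (gram (schur S′ a) as)))))
    cases (no δ≢0) = cong (δ *_) (gram-≅ {B = schur S b} {schur S′ a} as λ u v →
      trans (schur₂ B a b (α≢0 δ≢0) δ≢0 u v)
      (trans (cong₂ (λ k p → B.⟪ u , v ⟫ - k * p) (cong invℚ (sym δ-sym)) (trans
        (solve 7 (λ α β γ ua ub va vb →
          β :* ua :* va :- γ :* (ub :* va :+ ua :* vb) :+ α :* ub :* vb :=
          α :* ub :* vb :- γ :* (ua :* vb :+ ub :* va) :+ β :* ua :* va) refl
          α β γ B.⟪ u , a ⟫ B.⟪ u , b ⟫ B.⟪ v , a ⟫ B.⟪ v , b ⟫)
        (cong (λ g → α * B.⟪ u , b ⟫ * B.⟪ v , b ⟫ - g * (B.⟪ u , a ⟫ * B.⟪ v , b ⟫ + B.⟪ u , b ⟫ * B.⟪ v , a ⟫)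
                     + β * B.⟪ u , a ⟫ * B.⟪ v , a ⟫) (B.symmetric a b))))
      (sym (schur₂ B b a (β≢0 δ≢0) (λ δ′≡0 → δ≢0 (trans (sym δ-sym) δ′≡0)) u v))))

-- Hadamard's inequality

product : List ℚ → ℚ
product = List.foldr _*_ 1ℚ

norms : ∀ {X} → Form X → List (X → ℚ) → ℚ
norms B as = product (map (λ a → ⟪_,_⟫ B a a) as)

0≤norms : ∀ {X} (B : Form X) as → 0ℚ ℚ.≤ norms B as
0≤norms B []       = ℚₚ.nonNegative⁻¹ 1ℚ
0≤norms B (a ∷ as) = 0≤* (Form.nonneg B a) (0≤norms B as)

opaque
  unfolding gram

  0≤gram : ∀ {X} (B : Form X) as → 0ℚ ℚ.≤ gram B as
  0≤gram B []       = ℚₚ.nonNegative⁻¹ 1ℚ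
  0≤gram B (a ∷ as) = 0≤* (Form.nonneg B a) (0≤gram (schur B a) as)

schur-≤ : ∀ {X} (B : Form X) a u → ⟪_,_⟫ (schur B a) u u ℚ.≤ ⟪_,_⟫ B u u
schur-≤ B a u = ℚₚ.≤-trans
  (ℚₚ.+-monoʳ-≤ B.⟪ u , u ⟫ (ℚₚ.neg-antimono-≤ (0≤* (0≤² B.⟪ u , a ⟫) (0≤invℚ (B.nonneg a)))))
  (ℚₚ.≤-reflexive (ℚₚ.+-identityʳ B.⟪ u , u ⟫))
  where module B = Form B

norms-schur : ∀ {X} (B : Form X) a as → norms (schur B a) as ℚ.≤ norms B as
norms-schur B a []       = ℚₚ.≤-refl
norms-schur B a (u ∷ as) = *-mono-≤₀ (0≤norms (schur B a) as) (Form.nonneg B u)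
  (schur-≤ B a u) (norms-schur B a as)

opaque
  unfolding gram

  -- Every factor of `gram` is a norm in some iterated complement, and each projection can only
  -- shorten a vector.
  hadamard : ∀ {X} (B : Form X) as → gram B as ℚ.≤ norms B as
  hadamard B []       = ℚₚ.≤-refl
  hadamard B (a ∷ as) = *-mono-≤₀ (0≤gram (schur B a) as) (Form.nonneg B a) ℚₚ.≤-refl
    (ℚₚ.≤-trans (hadamard (schur B a) as) (norms-schur B a as))

-- Integer lattices

opaque
  ι : ℤ → ℚ
  ι z = z ℚ./ 1

  toℚᵘ-ι : ∀ z → ℚ.toℚᵘ (ι z) ℚᵘ.≃ ℚᵘ.mkℚᵘ z 0
  toℚᵘ-ι z = ℚₚ.toℚᵘ-fromℚᵘ (ℚᵘ.mkℚᵘ z 0)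

  ι-0 : ι 0ℤ ≡ 0ℚ
  ι-0 = refl

  ι-1 : ι 1ℤ ≡ 1ℚ
  ι-1 = refl

  ι-/1 : ∀ z → ι z ≡ z ℚ./ 1
  ι-/1 z = refl

  ι-+ : ∀ a b → ι (a ℤ.+ b) ≡ ι a + ι b
  ι-+ a b = ℚₚ.toℚᵘ-injective (ℚᵘₚ.≃-trans (toℚᵘ-ι (a ℤ.+ b)) (ℚᵘₚ.≃-sym (ℚᵘₚ.≃-trans
    (ℚₚ.toℚᵘ-homo-+ (ι a) (ι b)) (ℚᵘₚ.≃-trans (ℚᵘₚ.+-cong (toℚᵘ-ι a) (toℚᵘ-ι b))
    (ℚᵘ.*≡* (cong (ℤ._* 1ℤ) (cong₂ ℤ._+_ (ℤₚ.*-identityʳ a) (ℤₚ.*-identityʳ b))))))))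

  ι-* : ∀ a b → ι (a ℤ.* b) ≡ ι a * ι b
  ι-* a b = ℚₚ.toℚᵘ-injective (ℚᵘₚ.≃-trans (toℚᵘ-ι (a ℤ.* b)) (ℚᵘₚ.≃-sym (ℚᵘₚ.≃-trans
    (ℚₚ.toℚᵘ-homo-* (ι a) (ι b)) (ℚᵘₚ.*-cong (toℚᵘ-ι a) (toℚᵘ-ι b)))))

  ι-injective : ∀ {a b} → ι a ≡ ι b → a ≡ b
  ι-injective {a} {b} eq
    with ℚᵘₚ.≃-trans (ℚᵘₚ.≃-sym (toℚᵘ-ι a)) (ℚᵘₚ.≃-trans (ℚₚ.toℚᵘ-cong eq) (toℚᵘ-ι b))
  ... | ℚᵘ.*≡* a1≡b1 = trans (sym (ℤₚ.*-identityʳ a)) (trans a1≡b1 (ℤₚ.*-identityʳ b))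

  ι-mono-≤ : ∀ {a b} → a ℤ.≤ b → ι a ℚ.≤ ι b
  ι-mono-≤ {a} {b} a≤b = ℚₚ.toℚᵘ-cancel-≤ (ℚᵘₚ.≤-trans
    (ℚᵘₚ.≤-reflexive (toℚᵘ-ι a)) (ℚᵘₚ.≤-trans
    (ℚᵘ.*≤* (subst₂ ℤ._≤_ (sym (ℤₚ.*-identityʳ a)) (sym (ℤₚ.*-identityʳ b)) a≤b))
    (ℚᵘₚ.≤-reflexive (ℚᵘₚ.≃-sym (toℚᵘ-ι b)))))

ι-abs² : ∀ z → ι z * ι z ≡ ι (+ ℤ.∣ z ∣) * ι (+ ℤ.∣ z ∣)
ι-abs² z = trans (sym (ι-* z z)) (trans (cong ι (lemma z)) (ι-* (+ ℤ.∣ z ∣) (+ ℤ.∣ z ∣)))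
  where
  lemma : ∀ z → z ℤ.* z ≡ + ℤ.∣ z ∣ ℤ.* + ℤ.∣ z ∣
  lemma (+ n)    = refl
  lemma -[1+ n ] = refl

-- Unimodular operations on integer vectors

rational : ∀ {X : Set} {M} → Vec (X → ℤ) M → List (X → ℚ)
rational as = map (ι ∘_) (toList as)

comb : ∀ {X : Set} {M} → Vec ℤ M → Vec (X → ℤ) M → X → ℤ
comb []      []       x = 0ℤ
comb (d ∷ ds) (a ∷ as) x = d ℤ.* a x ℤ.+ comb ds as x

infix 4 _~_
-- Elementary operations between neighbours, enough for Euclid's algorithm. Having them as data lets
-- the Gram determinant and the generated lattice be followed by two separate inductions, `gram-~`
-- and `comb-~`.
data _~_ {X : Set} : ∀ {M} → Vec (X → ℤ) M → Vec (X → ℤ) M → Set where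
  done  : ∀ {M} {as : Vec (X → ℤ) M} → as ~ as
  _⨾_   : ∀ {M} {as bs cs : Vec (X → ℤ) M} → as ~ bs → bs ~ cs → as ~ cs
  keep  : ∀ {M} a {as bs : Vec (X → ℤ) M} → as ~ bs → a ∷ as ~ a ∷ bs
  swap  : ∀ {M} a b {as : Vec (X → ℤ) M} → a ∷ b ∷ as ~ b ∷ a ∷ as
  add   : ∀ {M} a b q {as : Vec (X → ℤ) M} → a ∷ b ∷ as ~ a ∷ (λ x → b x ℤ.+ q ℤ.* a x) ∷ as

gram-~ : ∀ {X M} {as bs : Vec (X → ℤ) M} → as ~ bs → ∀ B → gram B (rational as) ≡ gram B (rational bs)
gram-~ done B = refl
gram-~ (r ⨾ s) B = trans (gram-~ r B) (gram-~ s B)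
gram-~ (keep a {as} {bs} r) B = trans (gram-∷ B (ι ∘ a) (rational as)) (trans
  (cong (⟪_,_⟫ B (ι ∘ a) (ι ∘ a) *_) (gram-~ r (schur B (ι ∘ a))))
  (sym (gram-∷ B (ι ∘ a) (rational bs))))
gram-~ (swap a b {as}) B = gram-swap B (ι ∘ a) (ι ∘ b) (rational as)
gram-~ (add a b q {as}) B = trans (gram-add B (ι ∘ a) (ι ∘ b) (ι q) (rational as))
  (gram-≐₂ B (ι ∘ a) eq (rational as))
  where
  eq : ∀ x → ι (b x) + ι q * ι (a x) ≡ ι (b x ℤ.+ q ℤ.* a x)
  eq x = sym (trans (ι-+ (b x) (q ℤ.* a x)) (cong (λ p → ι (b x) + p) (ι-* q (a x))))

zeros : ∀ {M} → Vec ℤ M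
zeros = replicate _ 0ℤ

∷-injective-zeros : ∀ {M d} {ds : Vec ℤ M} → d ∷ ds ≡ zeros → d ≡ 0ℤ × ds ≡ zeros
∷-injective-zeros = Vecₚ.∷-injective

-- Rewrites a combination of the new vectors over the old ones. The last component says that the
-- change of coefficients is injective and carries linear independence over; the first carries
-- membership in the lattice.
comb-~ : ∀ {X M} {as bs : Vec (X → ℤ) M} → as ~ bs → ∀ ds →
         ∃[ es ] comb es as ≐ comb ds bs × (es ≡ zeros → ds ≡ zeros)
comb-~ done ds = ds , (λ _ → refl) , λ eq → eq
comb-~ (r ⨾ s) ds with comb-~ s ds
... | es , eq , z with comb-~ r es
...   | fs , eq′ , z′ = fs , (λ x → trans (eq′ x) (eq x)) , z ∘ z′
comb-~ (keep a r) (d ∷ ds) with comb-~ r ds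
... | es , eq , z = d ∷ es , (λ x → cong (λ p → d ℤ.* a x ℤ.+ p) (eq x)) ,
  λ e≡0 → let d≡0 , es≡0 = ∷-injective-zeros e≡0 in cong₂ _∷_ d≡0 (z es≡0)
comb-~ (swap a b {as}) (d ∷ e ∷ ds) = e ∷ d ∷ ds ,
  (λ x → solveᶻ 3 (λ p q r → p ⊕ (q ⊕ r) ≔ q ⊕ (p ⊕ r)) refl
    (e ℤ.* a x) (d ℤ.* b x) (comb ds as x)) ,
  λ eq → let e≡0 , eq′ = ∷-injective-zeros eq ; d≡0 , ds≡0 = ∷-injective-zeros eq′
         in cong₂ _∷_ d≡0 (cong₂ _∷_ e≡0 ds≡0)
comb-~ (add a b q {as}) (d ∷ e ∷ ds) = (d ℤ.+ e ℤ.* q) ∷ e ∷ ds ,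
  (λ x → regroup d e q (a x) (b x) (comb ds as x)) ,
  λ eq → let d≡0 , eq′ = ∷-injective-zeros eq ; e≡0 , ds≡0 = ∷-injective-zeros eq′
         in cong₂ _∷_ (trans (sym (trans (cong (λ p → d ℤ.+ p ℤ.* q) e≡0) (ℤₚ.+-identityʳ d))) d≡0)
                      (cong₂ _∷_ e≡0 ds≡0)
  where
  regroup : ∀ d e q a b r → (d ℤ.+ e ℤ.* q) ℤ.* a ℤ.+ (e ℤ.* b ℤ.+ r) ≡
            d ℤ.* a ℤ.+ (e ℤ.* (b ℤ.+ q ℤ.* a) ℤ.+ r)
  regroup = solveᶻ 6 (λ d e q a b r → (d ⊕ e ⊗ q) ⊗ a ⊕ (e ⊗ b ⊕ r) ≔
            d ⊗ a ⊕ (e ⊗ (b ⊕ q ⊗ a) ⊕ r)) refl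

-- Triangular form by Euclid's algorithm

module _ {X : Set} where

  Vanishes : List X → (X → ℤ) → Set
  Vanishes L a = ∀ x → x ∈ L → a x ≡ 0ℤ

  -- The pivot of a vector sits at the head of the list at that stage, and the vector is zero at the
  -- pivots that follow.
  data Triangular : ∀ {M} → List X → Vec (X → ℤ) M → Set where
    []  : Triangular [] []
    _∷_ : ∀ {M x L c} {cs : Vec (X → ℤ) M} →
          Vanishes L c → Triangular L cs → Triangular (x ∷ L) (c ∷ cs)

  -- An intermediate state of the elimination: vectors already cleared on the treated coordinates
  -- `L`, followed by a triangular block for `L`.
  data Echelon : ∀ {M} → List X → Vec (X → ℤ) M → Set where
    triangular : ∀ {M L} {cs : Vec (X → ℤ) M} → Triangular L cs → Echelon L cs
    skip       : ∀ {M L c} {cs : Vec (X → ℤ) M} → Vanishes L c → Echelon L cs → Echelon L (c ∷ cs)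

  size : ∀ {M L} {cs : Vec (X → ℤ) M} → Triangular L cs → length L ≡ M
  size []      = refl
  size (_ ∷ t) = cong suc (size t)

  size-≤ : ∀ {M L} {cs : Vec (X → ℤ) M} → Echelon L cs → length L ≤ M
  size-≤ (triangular t) = ℕₚ.≤-reflexive (size t)
  size-≤ (skip _ s)     = ℕₚ.m≤n⇒m≤1+n (size-≤ s)

  vanishes-add : ∀ {L a b} q → Vanishes L a → Vanishes L b → Vanishes L (λ x → b x ℤ.+ q ℤ.* a x)
  vanishes-add {L} {a} {b} q va vb x x∈L =
    trans (cong₂ (λ s t → t ℤ.+ q ℤ.* s) (va x x∈L) (vb x x∈L))
          (trans (ℤₚ.+-identityˡ (q ℤ.* 0ℤ)) (ℤₚ.*-zeroʳ q))

  -- Division with remainder on the values at `x`, with the remainder moved to the front, so that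
  -- `n` bounds a decreasing absolute value. Zeros on `L` survive because both vectors have them.
  euclid : ∀ (n : ℕ) {M} L x u v {as : Vec (X → ℤ) M} → ℤ.∣ u x ∣ ≤ n → Vanishes L u → Vanishes L v →
           ∃[ u′ ] ∃[ v′ ] (u ∷ v ∷ as ~ u′ ∷ v′ ∷ as) × u′ x ≡ 0ℤ × Vanishes L u′ × Vanishes L v′
  euclid n L x u v {as} ux≤n vu vv with u x ℤₚ.≟ 0ℤ
  ... | yes ux≡0 = u , v , done , ux≡0 , vu , vv
  euclid zero L x u v {as} ux≤n vu vv | no ux≢0 =
    contradiction (ℤₚ.∣i∣≡0⇒i≡0 (ℕₚ.n≤0⇒n≡0 ux≤n)) ux≢0
  euclid (suc n) L x u v {as} ux≤n vu vv | no ux≢0 =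
    let u′ , v′ , r , eqs = euclid n L x w u {as} small (vanishes-add q vu vv) vu
    in u′ , v′ , (add u v q ⨾ (swap u w ⨾ r)) , eqs
    where
    instance _ = ℤ.≢-nonZero ux≢0
    q = ℤ.- (v x ℤ./ u x)
    w : X → ℤ
    w y = v y ℤ.+ q ℤ.* u y
    remainder : w x ≡ + (v x ℤ.% u x)
    remainder = trans (cong (ℤ._+ q ℤ.* u x) (ℤDivMod.a≡a%n+[a/n]*n (v x) (u x)))
      (solveᶻ 3 (λ r d p → (r ⊕ d ⊗ p) ⊕ (⊝′ d) ⊗ p ≔ r) refl
        (+ (v x ℤ.% u x)) (v x ℤ./ u x) (u x))
    small : ℤ.∣ w x ∣ ≤ n
    small = subst (λ z → ℤ.∣ z ∣ ≤ n) (sym remainder)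
      (ℕₚ.≤-pred (ℕₚ.≤-trans (ℤDivMod.n%d<d (v x) (u x)) ux≤n))

  -- The vector `c` collects the greatest common divisor of the values at `x` while it travels down
  -- the cleared vectors; on reaching the triangular block it becomes the row with pivot `x`.
  eliminate : ∀ {M} L x c {cs : Vec (X → ℤ) M} → Vanishes L c → Echelon L cs →
              ∃[ ds ] c ∷ cs ~ ds × Echelon (x ∷ L) ds
  eliminate L x c vc (triangular t) = _ , done , triangular (vc ∷ t)
  eliminate L x c vc (skip {c = d} {cs} vd s) with euclid _ L x c d {cs} ℕₚ.≤-refl vc vd
  ... | c′ , d′ , r , c′x≡0 , vc′ , vd′ with eliminate L x d′ vd′ s
  ...   | ds , r′ , s′ = c′ ∷ ds , (r ⨾ keep c′ r′) , skip v s′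
    where
    v : Vanishes (x ∷ L) c′
    v y (here refl) = c′x≡0
    v y (there y∈L) = vc′ y y∈L

  echelon : ∀ {M} L (as : Vec (X → ℤ) M) → length L ≤ M → ∃[ bs ] as ~ bs × Echelon L bs
  echelon [] [] _ = [] , done , triangular []
  echelon [] (a ∷ as) _ with echelon [] as ℕ.z≤n
  ... | bs , r , s = a ∷ bs , keep a r , skip (λ _ ()) s
  echelon (x ∷ L) as L<M with echelon L as (ℕₚ.<⇒≤ L<M)
  -- As `length L` is below `M`, some vector is still outside the triangular block and can supply
  -- the next row.
  ... | bs , r , triangular t = contradiction (size t) (ℕₚ.<⇒≢ L<M)
  ... | c ∷ cs , r , skip vc s with eliminate L x c vc s
  ...   | ds , r′ , s′ = ds , (r ⨾ r′) , s′

  hermite : ∀ {M} L (as : Vec (X → ℤ) M) → length L ≡ M → ∃[ bs ] as ~ bs × Triangular L bs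
  hermite L as |L|≡M with echelon L as (ℕₚ.≤-reflexive |L|≡M)
  ... | bs , r , triangular t = bs , r , t
  ... | _ , _ , skip _ s = contradiction (size-≤ s) (ℕₚ.<⇒≱ (ℕₚ.≤-reflexive (sym |L|≡M)))

  Independent : ∀ {M} → List X → Vec (X → ℤ) M → Set
  Independent L as = ∀ ds → (∀ x → x ∈ L → comb ds as x ≡ 0ℤ) → ds ≡ zeros

  independent-~ : ∀ {M L} {as bs : Vec (X → ℤ) M} → as ~ bs → Independent L as → Independent L bs
  independent-~ r ind ds eq with comb-~ r ds
  ... | es , eq′ , z = z (ind es (λ x x∈L → trans (eq′ x) (eq x x∈L)))

  data Pivots : ∀ {M L} {cs : Vec (X → ℤ) M} → Triangular L cs → Set where
    []  : Pivots []
    _∷_ : ∀ {M x L c} {cs : Vec (X → ℤ) M} {vc : Vanishes L c} {t : Triangular L cs} →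
          c x ≢ 0ℤ → Pivots t → Pivots (_∷_ {x = x} vc t)

  comb-zeros : ∀ {M} (as : Vec (X → ℤ) M) x → comb zeros as x ≡ 0ℤ
  comb-zeros []       x = refl
  comb-zeros (a ∷ as) x = trans (ℤₚ.+-identityˡ (comb zeros as x)) (comb-zeros as x)

  comb-scale : ∀ {M} p ds (as : Vec (X → ℤ) M) x → comb (Vec.map (p ℤ.*_) ds) as x ≡ p ℤ.* comb ds as x
  comb-scale p []       []       x = sym (ℤₚ.*-zeroʳ p)
  comb-scale p (d ∷ ds) (a ∷ as) x =
    trans (cong (λ r → p ℤ.* d ℤ.* a x ℤ.+ r) (comb-scale p ds as x))
      (solveᶻ 4 (λ p d a r → p ⊗ d ⊗ a ⊕ p ⊗ r ≔ p ⊗ (d ⊗ a ⊕ r)) refl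
        p d (a x) (comb ds as x))

  comb-minus : ∀ {M} ds es (as : Vec (X → ℤ) M) x →
           comb (Vec.zipWith ℤ._-_ ds es) as x ≡ comb ds as x ℤ.- comb es as x
  comb-minus [] [] [] x = refl
  comb-minus (d ∷ ds) (e ∷ es) (a ∷ as) x =
    trans (cong (λ r → (d ℤ.- e) ℤ.* a x ℤ.+ r) (comb-minus ds es as x))
      (solveᶻ 5 (λ d e a r s →
        (d ⊝ e) ⊗ a ⊕ (r ⊝ s) ≔ (d ⊗ a ⊕ r) ⊝ (e ⊗ a ⊕ s)) refl
        d e (a x) (comb ds as x) (comb es as x))

  cancel-scale : ∀ {M} {p} (ds : Vec ℤ M) → p ≢ 0ℤ → Vec.map (p ℤ.*_) ds ≡ zeros → ds ≡ zeros
  cancel-scale []       p≢0 _  = refl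
  cancel-scale {p = p} (d ∷ ds) p≢0 eq with Vecₚ.∷-injective eq
  ... | pd≡0 , eq′ with ℤₚ.i*j≡0⇒i≡0∨j≡0 p pd≡0
  ...   | inj₁ p≡0 = contradiction p≡0 p≢0
  ...   | inj₂ d≡0 = cong₂ _∷_ d≡0 (cancel-scale ds p≢0 eq′)

  -- If the first pivot vanished, `c` would be zero on all coordinates and give a relation by
  -- itself. A relation among the remaining vectors holds on `L` but may fail at `x`; multiplied by
  -- the pivot and corrected by a multiple of `c` it holds at `x` too.
  pivots : ∀ {M L} {cs : Vec (X → ℤ) M} (t : Triangular L cs) → Independent L cs → Pivots t
  pivots [] ind = []
  pivots (_∷_ {x = x} {L} {c} {cs} vc t) ind = p≢0 ∷ pivots t ind′
    where
    p≢0 : c x ≢ 0ℤ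
    p≢0 p≡0 with ind (1ℤ ∷ zeros) (λ y y∈ → trans (cong₂ ℤ._+_ (trans (ℤₚ.*-identityˡ (c y)) (c≡0 y y∈)) (comb-zeros cs y)) refl)
      where
      c≡0 : ∀ y → y ∈ x ∷ L → c y ≡ 0ℤ
      c≡0 y (here refl)  = p≡0
      c≡0 y (there y∈L) = vc y y∈L
    ... | ()
    ind′ : Independent L cs
    ind′ ds eq = cancel-scale ds p≢0
      (proj₂ (∷-injective-zeros (ind (ℤ.- s ∷ Vec.map (c x ℤ.*_) ds) eq′)))
      where
      s = comb ds cs x
      eq′ : ∀ y → y ∈ x ∷ L → ℤ.- s ℤ.* c y ℤ.+ comb (Vec.map (c x ℤ.*_) ds) cs y ≡ 0ℤ
      eq′ y (here refl)  = trans (cong (λ r → ℤ.- s ℤ.* c x ℤ.+ r) (comb-scale (c x) ds cs x))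
        (solveᶻ 2 (λ s p → (⊝′ s) ⊗ p ⊕ p ⊗ s ≔ conᶻ 0ℤ) refl s (c x))
      eq′ y (there y∈L) = trans (cong₂ (λ p r → ℤ.- s ℤ.* p ℤ.+ r) (vc y y∈L)
          (trans (comb-scale (c x) ds cs y) (cong (c x ℤ.*_) (eq y y∈L))))
        (solveᶻ 2 (λ s p → (⊝′ s) ⊗ conᶻ 0ℤ ⊕ p ⊗ conᶻ 0ℤ ≔ conᶻ 0ℤ) refl s (c x))

  -- For nonzero pivots, the index of the generated lattice in the integer functions on `L`.
  pivotProduct : ∀ {M L} {cs : Vec (X → ℤ) M} → Triangular L cs → ℕ
  pivotProduct []                          = 1
  pivotProduct (_∷_ {x = x} {c = c} vc t) = ℤ.∣ c x ∣ ℕ.* pivotProduct t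

  -- Vectors are functions on all of `X`; this confines a form to finitely many coordinates, such as
  -- the sets of one size.
  DependsOn : List X → Form X → Set
  DependsOn L B = ∀ {u u′} v → (∀ x → x ∈ L → u x ≡ u′ x) → ⟪_,_⟫ B u v ≡ ⟪_,_⟫ B u′ v

  schur-dependsOn : ∀ {L} B a → DependsOn L B → DependsOn L (schur B a)
  schur-dependsOn B a dep v eq = cong₂ (λ p q → p - q * ⟪_,_⟫ B v a * invℚ (⟪_,_⟫ B a a))
    (dep v eq) (dep a eq)

-- Index and covolume

module Coordinates {X : Set} (_≟_ : DecidableEquality X) where

  unit : X → X → ℤ
  unit x y = if does (x ≟ y) then 1ℤ else 0ℤ

  unit-≡ : ∀ x → unit x x ≡ 1ℤ
  unit-≡ x = cong (if_then 1ℤ else 0ℤ) (dec-true (x ≟ x) refl)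

  unit-≢ : ∀ {x y} → x ≢ y → unit x y ≡ 0ℤ
  unit-≢ {x} {y} x≢y = cong (if_then 1ℤ else 0ℤ) (dec-false (x ≟ y) x≢y)

  unit-∉ : ∀ {x y L} → All (x ≢_) L → y ∈ L → unit x y ≡ 0ℤ
  unit-∉ x∉L y∈L = unit-≢ (All.lookup x∉L y∈L)

  axis : X → X → ℚ
  axis x = ι ∘ unit x

  axis-≡ : ∀ x → axis x x ≡ 1ℚ
  axis-≡ x = trans (cong ι (unit-≡ x)) ι-1

  axis-∉ : ∀ {x y L} → All (x ≢_) L → y ∈ L → axis x y ≡ 0ℚ
  axis-∉ x∉L y∈L = trans (cong ι (unit-∉ x∉L y∈L)) ι-0

  -- Functions agreeing on `L` differ on `x ∷ L` by a multiple of `axis x`, which is in the radical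
  -- of the complement.
  schur-axis : ∀ {x L} B → All (x ≢_) L → DependsOn (x ∷ L) B → DependsOn L (schur B (axis x))
  schur-axis {x} {L} B x∉L dep {u} {u′} v eq = begin
    S.⟪ u , v ⟫                                 ≡⟨ schur-dependsOn B (axis x) dep v eq′ ⟩
    S.⟪ u′ +[ c ] axis x , v ⟫                  ≡⟨ S.linearˡ u′ c (axis x) v ⟩
    S.⟪ u′ , v ⟫ + c * S.⟪ axis x , v ⟫         ≡⟨ cong (λ p → S.⟪ u′ , v ⟫ + c * p) (schur-kill B (axis x) v) ⟩
    S.⟪ u′ , v ⟫ + c * 0ℚ                       ≡⟨ solve 2 (λ s c → s :+ c :* con 0ℚ := s) refl S.⟪ u′ , v ⟫ c ⟩
    S.⟪ u′ , v ⟫                                ∎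
    where
    open ≡-Reasoning
    module S = Form (schur B (axis x))
    c = u x - u′ x
    eq′ : ∀ y → y ∈ x ∷ L → u y ≡ u′ y + c * axis x y
    eq′ y (here refl) = sym (trans (cong (λ e → u′ x + c * e) (axis-≡ x))
      (solve 2 (λ a b → b :+ (a :- b) :* con 1ℚ := a) refl (u x) (u′ x)))
    eq′ y (there y∈L) = trans (eq y y∈L) (sym (trans (cong (λ e → u′ y + c * e) (axis-∉ x∉L y∈L))
      (solve 2 (λ s c → s :+ c :* con 0ℚ := s) refl (u′ y) c)))

  -- For the form, the first row is its pivot times `axis x`. A nonzero multiple of a vector has the
  -- same complement, and that complement no longer sees `x`; so the entries of the other rows at
  -- `x` do not matter.
  gram-triangular : ∀ {M L} {cs : Vec (X → ℤ) M} {t : Triangular L cs} → Pivots t → Unique L →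
                    ∀ B → DependsOn L B →
                    gram B (rational cs) ≡ ι (+ pivotProduct t) * ι (+ pivotProduct t) * gram B (map axis L)
  gram-triangular [] _ B dep = trans (gram-[] B) (sym (cong₂ (λ p g → p * p * g) ι-1 (gram-[] B)))
  gram-triangular {cs = c ∷ cs} (_∷_ {x = x} {L} {vc = vc} {t = t} p≢0 ps) (x∉L ∷ uL) B dep = begin
    gram B (rational (c ∷ cs))
      ≡⟨ gram-∷ B (ι ∘ c) (rational cs) ⟩
    B.⟪ ι ∘ c , ι ∘ c ⟫ * gram (schur B (ι ∘ c)) (rational cs)
      ≡⟨ cong₂ _*_ (B⟪c,c⟫) (gram-≅ {B = schur B (ι ∘ c)} {S} (rational cs) S≅) ⟩
    p * p * β * gram S (rational cs)
      ≡⟨ cong (p * p * β *_) (gram-triangular ps uL S (schur-axis B x∉L dep)) ⟩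
    p * p * β * (P * P * G)
      ≡⟨ cong (λ q → q * β * (P * P * G)) (ι-abs² (c x)) ⟩
    q * q * β * (P * P * G)
      ≡⟨ solve 4 (λ q b P G → q :* q :* b :* (P :* P :* G) := (q :* P) :* (q :* P) :* (b :* G)) refl q β P G ⟩
    (q * P) * (q * P) * (β * G)
      ≡⟨ cong (λ r → r * r * (β * G)) (trans (cong ι (ℤₚ.pos-* ℤ.∣ c x ∣ (pivotProduct t))) (ι-* (+ ℤ.∣ c x ∣) (+ pivotProduct t))) ⟨
    ι (+ (ℤ.∣ c x ∣ ℕ.* pivotProduct t)) * ι (+ (ℤ.∣ c x ∣ ℕ.* pivotProduct t)) * (β * G)
      ≡⟨ cong (ι (+ (ℤ.∣ c x ∣ ℕ.* pivotProduct t)) * ι (+ (ℤ.∣ c x ∣ ℕ.* pivotProduct t)) *_) (gram-∷ B e (map axis L)) ⟨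
    ι (+ (ℤ.∣ c x ∣ ℕ.* pivotProduct t)) * ι (+ (ℤ.∣ c x ∣ ℕ.* pivotProduct t)) * gram B (map axis (x ∷ L)) ∎
    where
    open ≡-Reasoning
    module B = Form B
    p = ι (c x)
    q = ι (+ ℤ.∣ c x ∣)
    P = ι (+ pivotProduct t)
    e = axis x
    β = B.⟪ e , e ⟫
    S = schur B e
    G = gram S (map axis L)
    c≡pe : ∀ y → y ∈ x ∷ L → ι (c y) ≡ p * e y
    c≡pe y (here refl) = sym (trans (cong (p *_) (axis-≡ x)) (ℚₚ.*-identityʳ p))
    c≡pe y (there y∈L) = trans (trans (cong ι (vc y y∈L)) ι-0)
      (sym (trans (cong (p *_) (axis-∉ x∉L y∈L)) (ℚₚ.*-zeroʳ p)))
    B⟪c,_⟫ : ∀ v → B.⟪ ι ∘ c , v ⟫ ≡ p * B.⟪ e , v ⟫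
    B⟪c, v ⟫ = trans (dep v c≡pe) (B.scaleˡ p e v)
    B⟪_,c⟫ : ∀ v → B.⟪ v , ι ∘ c ⟫ ≡ p * B.⟪ v , e ⟫
    B⟪ v ,c⟫ = trans (B.symmetric v _) (trans B⟪c, v ⟫ (cong (p *_) (B.symmetric e v)))
    B⟪c,c⟫ : B.⟪ ι ∘ c , ι ∘ c ⟫ ≡ p * p * β
    B⟪c,c⟫ = trans B⟪c, _ ⟫ (trans (cong (p *_) B⟪ e ,c⟫) (sym (ℚₚ.*-assoc p p β)))
    ιp≢0 : p ≢ 0ℚ
    ιp≢0 eq = p≢0 (ι-injective (trans eq (sym ι-0)))
    S≅ : schur B (ι ∘ c) ≅ S
    S≅ u v = cong (λ r → B.⟪ u , v ⟫ - r) (begin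
      B.⟪ u , ι ∘ c ⟫ * B.⟪ v , ι ∘ c ⟫ * invℚ B.⟪ ι ∘ c , ι ∘ c ⟫
        ≡⟨ cong₂ _*_ (cong₂ _*_ B⟪ u ,c⟫ B⟪ v ,c⟫)
             (trans (cong invℚ B⟪c,c⟫) (trans (invℚ-* (p * p) β) (cong (_* invℚ β) (invℚ-* p p)))) ⟩
      p * B.⟪ u , e ⟫ * (p * B.⟪ v , e ⟫) * (invℚ p * invℚ p * invℚ β)
        ≡⟨ solve 5 (λ p i a b j → p :* a :* (p :* b) :* (i :* i :* j) := (p :* i) :* (p :* i) :* (a :* b :* j)) refl
             p (invℚ p) B.⟪ u , e ⟫ B.⟪ v , e ⟫ (invℚ β) ⟩
      (p * invℚ p) * (p * invℚ p) * (B.⟪ u , e ⟫ * B.⟪ v , e ⟫ * invℚ β)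
        ≡⟨ cong (λ r → r * r * (B.⟪ u , e ⟫ * B.⟪ v , e ⟫ * invℚ β)) (*-invℚ ιp≢0) ⟩
      1ℚ * 1ℚ * (B.⟪ u , e ⟫ * B.⟪ v , e ⟫ * invℚ β)
        ≡⟨ solve 1 (λ a → con 1ℚ :* con 1ℚ :* a := a) refl (B.⟪ u , e ⟫ * B.⟪ v , e ⟫ * invℚ β) ⟩
      B.⟪ u , e ⟫ * B.⟪ v , e ⟫ * invℚ β ∎)

  -- Coset representatives: the integer points of the box whose sides are the absolute values of the
  -- pivots, numbered in mixed radix.
  residue : ∀ {M L} {cs : Vec (X → ℤ) M} (t : Triangular L cs) → Fin (pivotProduct t) → X → ℤ
  residue []                          _ y = 0ℤ
  residue (_∷_ {x = x} {c = c} vc t) i y =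
    let r , j = remQuot {ℤ.∣ c x ∣} (pivotProduct t) i in residue t j y ℤ.+ + toℕ r ℤ.* unit x y

  -- The coordinates in `L` are settled before `x`: the multiple of `c` subtracted to reduce the
  -- value at `x` vanishes on `L` and disturbs nothing there.
  reduce : ∀ {M L} {cs : Vec (X → ℤ) M} {t : Triangular L cs} → Pivots t → Unique L → ∀ (z : X → ℤ) →
           Σ (Fin (pivotProduct t)) λ i → Σ (Vec ℤ M) λ ds → ∀ (y : X) → y ∈ L → z y ≡ residue t i y ℤ.+ comb ds cs y
  reduce [] _ z = Fin.zero , [] , λ _ ()
  reduce {cs = c ∷ cs} (_∷_ {x = x} {L} {vc = vc} {t = t} p≢0 ps) (x∉L ∷ uL) z =
    combine (fromℕ< r<p) j , q ∷ ds , eq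
    where
    IH = reduce ps uL z
    j = proj₁ IH
    ds = proj₁ (proj₂ IH)
    instance _ = ℤ.≢-nonZero p≢0
    p = c x
    w : X → ℤ
    w y = residue t j y ℤ.+ comb ds cs y
    a = z x ℤ.- w x
    q = a ℤ./ p
    r = a ℤ.% p
    r<p : r < ℤ.∣ p ∣
    r<p = ℤDivMod.n%d<d a p
    residue≡ : ∀ y → residue (_∷_ {x = x} vc t) (combine (fromℕ< r<p) j) y ≡ residue t j y ℤ.+ + r ℤ.* unit x y
    residue≡ y = trans
      (cong (λ (s , k) → residue t k y ℤ.+ + toℕ s ℤ.* unit x y) (Finₚ.remQuot-combine {ℤ.∣ p ∣} (fromℕ< r<p) j))
      (cong (λ s → residue t j y ℤ.+ + s ℤ.* unit x y) (Finₚ.toℕ-fromℕ< r<p))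
    eq : ∀ y → y ∈ x ∷ L → z y ≡ residue (_∷_ {x = x} vc t) (combine (fromℕ< r<p) j) y ℤ.+ (q ℤ.* c y ℤ.+ comb ds cs y)
    eq y (here refl) = begin
      z x                        ≡⟨ solveᶻ 2 (λ z w → z ≔ w ⊕ (z ⊝ w)) refl (z x) (w x) ⟩
      w x ℤ.+ a                  ≡⟨ cong (λ s → w x ℤ.+ s) (ℤDivMod.a≡a%n+[a/n]*n a p) ⟩
      w x ℤ.+ (+ r ℤ.+ q ℤ.* p)  ≡⟨ solveᶻ 4 (λ s t r m → (s ⊕ t) ⊕ (r ⊕ m) ≔ (s ⊕ r ⊗ conᶻ 1ℤ) ⊕ (m ⊕ t)) refl
                                      (residue t j x) (comb ds cs x) (+ r) (q ℤ.* p) ⟩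
      residue t j x ℤ.+ + r ℤ.* 1ℤ ℤ.+ (q ℤ.* p ℤ.+ comb ds cs x)
        ≡⟨ cong (λ e → residue t j x ℤ.+ + r ℤ.* e ℤ.+ (q ℤ.* p ℤ.+ comb ds cs x)) (unit-≡ x) ⟨
      residue t j x ℤ.+ + r ℤ.* unit x x ℤ.+ (q ℤ.* p ℤ.+ comb ds cs x)
        ≡⟨ cong (ℤ._+ (q ℤ.* p ℤ.+ comb ds cs x)) (residue≡ x) ⟨
      residue (_∷_ {x = x} vc t) (combine (fromℕ< r<p) j) x ℤ.+ (q ℤ.* p ℤ.+ comb ds cs x) ∎
      where open ≡-Reasoning
    eq y (there y∈L) = trans (proj₂ (proj₂ IH) y y∈L) (sym (trans
      (cong₂ (λ s m → s ℤ.+ (q ℤ.* m ℤ.+ comb ds cs y)) (residue≡ y) (vc y y∈L))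
      (trans (cong (λ e → residue t j y ℤ.+ + r ℤ.* e ℤ.+ (q ℤ.* 0ℤ ℤ.+ comb ds cs y)) (unit-∉ x∉L y∈L))
        (solveᶻ 4 (λ s r q t → s ⊕ r ⊗ conᶻ 0ℤ ⊕ (q ⊗ conᶻ 0ℤ ⊕ t) ≔ s ⊕ t) refl
          (residue t j y) (+ r) q (comb ds cs y)))))

  module _ {M h : ℕ} (L : List X) (uL : Unique L) (as : Vec (X → ℤ) M) (|L|≡M : length L ≡ M)
           (ind : Independent L as) (z : Fin h → X → ℤ)
           (distinct : ∀ i j ds → (∀ y → y ∈ L → z i y ℤ.- z j y ≡ comb ds as y) → i ≡ j)
           where

    -- The `z i` are pairwise incongruent modulo the lattice, so their number is at most its index.
    -- The squared index times the Gram determinant of the axes is that of `as`, to which Hadamard's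
    -- inequality applies.
    covolume : ∀ B → DependsOn L B → ι (+ (h ^ 2)) * gram B (map axis L) ℚ.≤ norms B (rational as)
    covolume B dep with hermite L as |L|≡M
    ... | cs , as~cs , t = begin
      ι (+ (h ^ 2)) * G              ≤⟨ ℚₚ.*-monoʳ-≤-nonNeg G {{ℚ.nonNegative (0≤gram B (map axis L))}} h²≤P² ⟩
      P * P * G                      ≡⟨ gram-triangular ps uL B dep ⟨
      gram B (rational cs)           ≡⟨ gram-~ as~cs B ⟨
      gram B (rational as)           ≤⟨ hadamard B (rational as) ⟩
      norms B (rational as)          ∎
      where
      open ℚₚ.≤-Reasoning
      P = ι (+ pivotProduct t)
      G = gram B (map axis L)
      ps = pivots t (independent-~ as~cs ind)
      code : Fin h → Fin (pivotProduct t)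
      code i = proj₁ (reduce ps uL (z i))
      code-injective : ∀ {i j} → code i ≡ code j → i ≡ j
      code-injective {i} {j} eq with comb-~ as~cs
        (Vec.zipWith ℤ._-_ (proj₁ (proj₂ (reduce ps uL (z i)))) (proj₁ (proj₂ (reduce ps uL (z j)))))
      ... | es , eq′ , _ = distinct i j es λ y y∈L → let
          ds = proj₁ (proj₂ (reduce ps uL (z i)))
          ds′ = proj₁ (proj₂ (reduce ps uL (z j)))
          s = residue t (code j) y
        in trans (cong₂ ℤ._-_
             (trans (proj₂ (proj₂ (reduce ps uL (z i))) y y∈L) (cong (λ k → residue t k y ℤ.+ comb ds cs y) eq))
             (proj₂ (proj₂ (reduce ps uL (z j))) y y∈L))
           (trans (solveᶻ 3 (λ s p q → (s ⊕ p) ⊝ (s ⊕ q) ≔ p ⊝ q) refl s (comb ds cs y) (comb ds′ cs y))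
           (sym (trans (eq′ y) (comb-minus ds ds′ cs y))))
      h≤P : h ≤ pivotProduct t
      h≤P = Finₚ.injective⇒≤ code-injective
      h²≤P² : ι (+ (h ^ 2)) ℚ.≤ P * P
      h²≤P² = ℚₚ.≤-trans
        (ι-mono-≤ (ℤ.+≤+ (ℕₚ.*-mono-≤ h≤P (ℕₚ.≤-trans (ℕₚ.≤-reflexive (ℕₚ.*-identityʳ h)) h≤P))))
        (ℚₚ.≤-reflexive (trans (cong ι (ℤₚ.pos-* (pivotProduct t) (pivotProduct t))) (ι-* (+ pivotProduct t) (+ pivotProduct t))))

-- The Gram determinant of the cycle lattice of the simplex

infixr 8 _^ℚ_
_^ℚ_ : ℚ → ℕ → ℚ
q ^ℚ zero  = 1ℚ
q ^ℚ suc n = q * q ^ℚ n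

^ℚ-+ : ∀ q m n → q ^ℚ (m ℕ.+ n) ≡ q ^ℚ m * q ^ℚ n
^ℚ-+ q zero    n = sym (ℚₚ.*-identityˡ (q ^ℚ n))
^ℚ-+ q (suc m) n = trans (cong (q *_) (^ℚ-+ q m n)) (sym (ℚₚ.*-assoc q (q ^ℚ m) (q ^ℚ n)))

^ℚ-* : ∀ p q n → (p * q) ^ℚ n ≡ p ^ℚ n * q ^ℚ n
^ℚ-* p q zero    = refl
^ℚ-* p q (suc n) = trans (cong (p * q *_) (^ℚ-* p q n))
  (solve 4 (λ p q a b → p :* q :* (a :* b) := p :* a :* (q :* b)) refl p q (p ^ℚ n) (q ^ℚ n))

1^ℚ : ∀ n → 1ℚ ^ℚ n ≡ 1ℚ
1^ℚ zero    = refl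
1^ℚ (suc n) = trans (ℚₚ.*-identityˡ (1ℚ ^ℚ n)) (1^ℚ n)

record LinearMap (X Y : Set) : Set where
  field
    apply  : (X → ℚ) → Y → ℚ
    linear : ∀ u c w → apply (u +[ c ] w) ≐ apply u +[ c ] apply w
    ≐-cong : ∀ {u u′} → u ≐ u′ → apply u ≐ apply u′

orthogonalSum : ∀ {X Y Z} α → 0ℚ ℚ.≤ α → Form Y → LinearMap X Y → Form Z → LinearMap X Z → Form X
orthogonalSum α 0≤α B₁ φ B₂ π = record
  { ⟪_,_⟫     = λ u v → α * B₁.⟪ φ.apply u , φ.apply v ⟫ + B₂.⟪ π.apply u , π.apply v ⟫
  ; symmetric = λ u v → cong₂ (λ p q → α * p + q) (B₁.symmetric _ _) (B₂.symmetric _ _)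
  ; linearˡ   = λ u c w v → trans
      (cong₂ (λ p q → α * p + q)
        (trans (B₁.congˡ _ (φ.linear u c w)) (B₁.linearˡ (φ.apply u) c (φ.apply w) _))
        (trans (B₂.congˡ _ (π.linear u c w)) (B₂.linearˡ (π.apply u) c (π.apply w) _)))
      (solve 6 (λ α p c q r s → α :* (p :+ c :* q) :+ (r :+ c :* s) :=
        (α :* p :+ r) :+ c :* (α :* q :+ s)) refl
        α B₁.⟪ φ.apply u , φ.apply v ⟫ c B₁.⟪ φ.apply w , φ.apply v ⟫
        B₂.⟪ π.apply u , π.apply v ⟫ B₂.⟪ π.apply w , π.apply v ⟫)
  ; congˡ     = λ v eq → cong₂ (λ p q → α * p + q)
      (B₁.congˡ _ (φ.≐-cong eq)) (B₂.congˡ _ (π.≐-cong eq))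
  ; nonneg    = λ u → ℚₚ.+-mono-≤ (0≤* 0≤α (B₁.nonneg (φ.apply u))) (B₂.nonneg (π.apply u))
  }
  where
  module B₁ = Form B₁
  module B₂ = Form B₂
  module φ = LinearMap φ
  module π = LinearMap π

open LinearMap using (apply)

gram-pullback : ∀ {X Z} (F : Form X) (B : Form Z) (π : (X → ℚ) → Z → ℚ) →
                (∀ u v → ⟪_,_⟫ F u v ≡ ⟪_,_⟫ B (π u) (π v)) → ∀ as → gram F as ≡ gram B (map π as)
gram-pullback F B π eq []       = trans (gram-[] F) (sym (gram-[] B))
gram-pullback F B π eq (a ∷ as) = trans (gram-∷ F a as) (trans
  (cong₂ _*_ (eq a a) (gram-pullback (schur F a) (schur B (π a)) π eq′ as))
  (sym (gram-∷ B (π a) (map π as))))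
  where
  eq′ : ∀ u v → ⟪_,_⟫ (schur F a) u v ≡ ⟪_,_⟫ (schur B (π a)) (π u) (π v)
  eq′ u v = cong₂ _-_ (eq u v) (cong₂ _*_ (cong₂ _*_ (eq u a) (eq v a)) (cong invℚ (eq a a)))

module _ {X Y Z : Set} (_≟_ : DecidableEquality Y) {α : ℚ} (α≢0 : α ≢ 0ℚ)
         (φ : (X → ℚ) → Y → ℚ) (π : (X → ℚ) → Z → ℚ) (lift : Y → X → ℚ) where

  open Coordinates _≟_

  -- The lifts have no second component and so are orthogonalised inside the first summand only,
  -- each giving a factor `α`. Once `L` is exhausted that summand has no coordinates left and is
  -- zero; only `B₂` acts on `bs`.
  gram-sum : ∀ L → Unique L → (∀ y → φ (lift y) ≐ axis y) → (∀ y → π (lift y) ≐ (λ _ → 0ℚ)) →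
             (F : Form X) (B₁ : Form Y) (B₂ : Form Z) → DependsOn L B₁ →
             (∀ u v → ⟪_,_⟫ F u v ≡ α * ⟪_,_⟫ B₁ (φ u) (φ v) + ⟪_,_⟫ B₂ (π u) (π v)) →
             ∀ bs → gram F (map lift L ++ bs) ≡
                    α ^ℚ length L * gram B₁ (map axis L) * gram B₂ (map π bs)
  gram-sum [] _ _ _ F B₁ B₂ dep eq bs = trans (gram-pullback F B₂ π eq′ bs) (sym (trans
      (cong (λ g → 1ℚ * g * gram B₂ (map π bs)) (gram-[] B₁))
      (solve 1 (λ g → con 1ℚ :* con 1ℚ :* g := g) refl (gram B₂ (map π bs)))))
    where
    eq′ : ∀ u v → ⟪_,_⟫ F u v ≡ ⟪_,_⟫ B₂ (π u) (π v)
    eq′ u v = trans (eq u v) (trans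
      (cong (λ p → α * p + ⟪_,_⟫ B₂ (π u) (π v)) (trans (dep (φ v) (λ _ ())) (Form.zeroˡ B₁ (φ v))))
      (solve 2 (λ α q → α :* con 0ℚ :+ q := q) refl α (⟪_,_⟫ B₂ (π u) (π v))))
  gram-sum (y ∷ L) (y∉L ∷ uL) φ-lift π-lift F B₁ B₂ dep eq bs = begin
    gram F (a ∷ map lift L ++ bs)
      ≡⟨ gram-∷ F a (map lift L ++ bs) ⟩
    F.⟪ a , a ⟫ * gram (schur F a) (map lift L ++ bs)
      ≡⟨ cong₂ _*_ (trans (F⟪ a ,a⟫) (cong (α *_) (B₁.congˡ e (φ-lift y))))
          (gram-sum L uL φ-lift π-lift (schur F a) S B₂ (schur-axis B₁ y∉L dep) eq′ bs) ⟩
    α * β * (α ^ℚ length L * gram S (map axis L) * gram B₂ (map π bs))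
      ≡⟨ solve 5 (λ α β p g h → α :* β :* (p :* g :* h) := α :* p :* (β :* g) :* h) refl
           α β (α ^ℚ length L) (gram S (map axis L)) (gram B₂ (map π bs)) ⟩
    α * α ^ℚ length L * (β * gram S (map axis L)) * gram B₂ (map π bs)
      ≡⟨ cong (λ g → α * α ^ℚ length L * g * gram B₂ (map π bs)) (gram-∷ B₁ e (map axis L)) ⟨
    α * α ^ℚ length L * gram B₁ (map axis (y ∷ L)) * gram B₂ (map π bs) ∎
    where
    open ≡-Reasoning
    module F = Form F
    module B₁ = Form B₁
    module B₂ = Form B₂
    a = lift y
    e = axis y
    β = B₁.⟪ e , e ⟫
    S = schur B₁ e
    F⟪_,a⟫ : ∀ u → F.⟪ u , a ⟫ ≡ α * B₁.⟪ φ u , e ⟫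
    F⟪ u ,a⟫ = trans (eq u a) (trans
      (cong₂ (λ p q → α * p + q) (B₁.congʳ (φ u) (φ-lift y))
        (trans (B₂.congʳ (π u) (π-lift y)) (trans (B₂.symmetric (π u) _) (B₂.zeroˡ (π u)))))
      (ℚₚ.+-identityʳ _))
    eq′ : ∀ u v → ⟪_,_⟫ (schur F a) u v ≡ α * ⟪_,_⟫ S (φ u) (φ v) + B₂.⟪ π u , π v ⟫
    eq′ u v = begin
      F.⟪ u , v ⟫ - F.⟪ u , a ⟫ * F.⟪ v , a ⟫ * invℚ F.⟪ a , a ⟫
        ≡⟨ cong₂ _-_ (eq u v) (cong₂ _*_ (cong₂ _*_ F⟪ u ,a⟫ F⟪ v ,a⟫)
             (trans (cong invℚ (trans F⟪ a ,a⟫ (cong (α *_) (B₁.congˡ e (φ-lift y))))) (invℚ-* α β))) ⟩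
      α * uv + w - α * ue * (α * ve) * (invℚ α * invℚ β)
        ≡⟨ modulo (α * invℚ α) 1ℚ (- (α * (ue * ve * invℚ β))) (*-invℚ α≢0)
             (solve 7 (λ α i uv w ue ve j →
               α :* uv :+ w :- α :* ue :* (α :* ve) :* (i :* j) :=
               α :* (uv :- ue :* ve :* j) :+ w :+ (α :* i :- con 1ℚ) :* (:- (α :* (ue :* ve :* j)))) refl
               α (invℚ α) uv w ue ve (invℚ β)) ⟩
      α * (uv - ue * ve * invℚ β) + w ∎
      where
      uv = B₁.⟪ φ u , φ v ⟫
      w = B₂.⟪ π u , π v ⟫
      ue = B₁.⟪ φ u , e ⟫
      ve = B₁.⟪ φ v , e ⟫

-- The boundary operator and the sets of a given size

infix 4 _≟ˢ_
_≟ˢ_ : ∀ {m} → DecidableEquality (Subset m)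
_≟ˢ_ = Vecₚ.≡-dec Boolₚ._≟_

open module Axes {m} = Coordinates (_≟ˢ_ {m})

-- The simplicial boundary in all degrees at once: at `σ`, the signed sum of `f` over the sets with
-- one more vertex. If the first vertex lies in `σ` it precedes every added vertex, whence the sign.
boundary : ∀ {m} → (Subset m → ℚ) → Subset m → ℚ
boundary f []            = 0ℚ
boundary f (inside  ∷ σ) = - boundary (f ∘ (inside ∷_)) σ
boundary f (outside ∷ σ) = f (inside ∷ σ) + boundary (f ∘ (outside ∷_)) σ

boundary-cong : ∀ {m} k {f g : Subset m → ℚ} → (∀ σ → ∣ σ ∣ ≡ suc k → f σ ≡ g σ) →
                ∀ ρ → ∣ ρ ∣ ≡ k → boundary f ρ ≡ boundary g ρ
boundary-cong k       eq []            _    = refl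
boundary-cong (suc k) eq (inside  ∷ ρ) |ρ|≡ =
  cong -_ (boundary-cong k (λ σ |σ|≡ → eq (inside ∷ σ) (cong suc |σ|≡)) ρ (ℕₚ.suc-injective |ρ|≡))
boundary-cong k       eq (outside ∷ ρ) |ρ|≡ =
  cong₂ _+_ (eq (inside ∷ ρ) (cong suc |ρ|≡)) (boundary-cong k (λ σ → eq (outside ∷ σ)) ρ |ρ|≡)

boundary-≐ : ∀ {m} {f g : Subset m → ℚ} → f ≐ g → boundary f ≐ boundary g
boundary-≐ eq ρ = boundary-cong _ (λ σ _ → eq σ) ρ refl

boundary-linear : ∀ {m} (f : Subset m → ℚ) c g → boundary (f +[ c ] g) ≐ boundary f +[ c ] boundary g
boundary-linear f c g []            = solve 1 (λ c → con 0ℚ := con 0ℚ :+ c :* con 0ℚ) refl c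
boundary-linear f c g (inside  ∷ σ) =
  trans (cong -_ (boundary-linear (f ∘ (inside ∷_)) c (g ∘ (inside ∷_)) σ))
    (solve 3 (λ a c b → :- (a :+ c :* b) := :- a :+ c :* (:- b)) refl
      (boundary (f ∘ (inside ∷_)) σ) c (boundary (g ∘ (inside ∷_)) σ))
boundary-linear f c g (outside ∷ σ) =
  trans (cong (λ z → f (inside ∷ σ) + c * g (inside ∷ σ) + z) (boundary-linear (f ∘ (outside ∷_)) c (g ∘ (outside ∷_)) σ))
    (solve 5 (λ p q a c b → p :+ c :* q :+ (a :+ c :* b) := (p :+ a) :+ c :* (q :+ b)) refl
      (f (inside ∷ σ)) (g (inside ∷ σ)) (boundary (f ∘ (outside ∷_)) σ) c (boundary (g ∘ (outside ∷_)) σ))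

boundary-0 : ∀ {m} (σ : Subset m) → boundary (λ _ → 0ℚ) σ ≡ 0ℚ
boundary-0 []            = refl
boundary-0 (inside  ∷ σ) = cong -_ (boundary-0 σ)
boundary-0 (outside ∷ σ) = trans (ℚₚ.+-identityˡ _) (boundary-0 σ)

boundary-neg : ∀ {m} (f : Subset m → ℚ) σ → boundary (λ τ → - f τ) σ ≡ - boundary f σ
boundary-neg f σ = trans
  (boundary-≐ (λ τ → solve 1 (λ a → :- a := con 0ℚ :+ con (- 1ℚ) :* a) refl (f τ)) σ)
  (trans (boundary-linear (λ _ → 0ℚ) (- 1ℚ) f σ) (trans
    (cong (λ z → z + - 1ℚ * boundary f σ) (boundary-0 σ))
    (solve 1 (λ a → con 0ℚ :+ con (- 1ℚ) :* a := :- a) refl (boundary f σ))))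

boundary² : ∀ {m} (f : Subset m → ℚ) σ → boundary (boundary f) σ ≡ 0ℚ
boundary² f []            = refl
boundary² f (inside  ∷ σ) = cong -_ (trans (boundary-neg (boundary (f ∘ (inside ∷_))) σ)
                                           (cong -_ (boundary² (f ∘ (inside ∷_)) σ)))
boundary² f (outside ∷ σ) = begin
  - boundary g σ + boundary (λ τ → g τ + boundary h τ) σ
    ≡⟨ cong (λ z → - boundary g σ + z) (boundary-≐ (λ τ → cong (λ z → g τ + z) (sym (ℚₚ.*-identityˡ (boundary h τ)))) σ) ⟩
  - boundary g σ + boundary (g +[ 1ℚ ] boundary h) σ
    ≡⟨ cong (λ z → - boundary g σ + z) (trans (boundary-linear g 1ℚ (boundary h) σ)
         (cong (λ z → boundary g σ + 1ℚ * z) (boundary² h σ))) ⟩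
  - boundary g σ + (boundary g σ + 1ℚ * 0ℚ)
    ≡⟨ solve 1 (λ a → :- a :+ (a :+ con 1ℚ :* con 0ℚ) := con 0ℚ) refl (boundary g σ) ⟩
  0ℚ ∎
  where
  open ≡-Reasoning
  g = f ∘ (inside ∷_)
  h = f ∘ (outside ∷_)

grade : ∀ m → ℕ → List (Subset m)
grade m       zero    = ⊥ ∷ []
grade zero    (suc k) = []
grade (suc m) (suc k) = map (inside ∷_) (grade m k) ++ map (outside ∷_) (grade m (suc k))

∣σ∣≡0⇒σ≡⊥ : ∀ {m} (σ : Subset m) → ∣ σ ∣ ≡ 0 → σ ≡ ⊥
∣σ∣≡0⇒σ≡⊥ []            _    = refl
∣σ∣≡0⇒σ≡⊥ (outside ∷ σ) |σ|≡0 = cong (outside ∷_) (∣σ∣≡0⇒σ≡⊥ σ |σ|≡0)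

grade-complete : ∀ {m} k (σ : Subset m) → ∣ σ ∣ ≡ k → σ ∈ grade m k
grade-complete zero    σ             |σ|≡0 = here (∣σ∣≡0⇒σ≡⊥ σ |σ|≡0)
grade-complete (suc k) (inside  ∷ σ) |σ|≡ =
  ∈-++⁺ˡ (∈-map⁺ (inside ∷_) (grade-complete k σ (ℕₚ.suc-injective |σ|≡)))
grade-complete {suc m} (suc k) (outside ∷ σ) |σ|≡ =
  ∈-++⁺ʳ (map (inside ∷_) (grade m k)) (∈-map⁺ (outside ∷_) (grade-complete (suc k) σ |σ|≡))

grade-sound : ∀ m k {σ : Subset m} → σ ∈ grade m k → ∣ σ ∣ ≡ k
grade-sound m       zero    (here refl) = Subsetₚ.∣⊥∣≡0 m
grade-sound (suc m) (suc k) σ∈ with ∈-++⁻ (map (inside ∷_) (grade m k)) σ∈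
... | inj₁ σ∈ˡ with ∈-map⁻ (inside ∷_) σ∈ˡ
...   | ρ , ρ∈ , refl = cong suc (grade-sound m k ρ∈)
grade-sound (suc m) (suc k) σ∈ | inj₂ σ∈ʳ with ∈-map⁻ (outside ∷_) σ∈ʳ
...   | ρ , ρ∈ , refl = grade-sound m (suc k) ρ∈

grade-unique : ∀ m k → Unique (grade m k)
grade-unique m       zero    = [] ∷ []
grade-unique zero    (suc k) = []
grade-unique (suc m) (suc k) = Uniqueₚ.++⁺
  (Uniqueₚ.map⁺ Vecₚ.∷-injectiveʳ (grade-unique m k))
  (Uniqueₚ.map⁺ Vecₚ.∷-injectiveʳ (grade-unique m (suc k)))
  λ (σ∈ˡ , σ∈ʳ) → disjoint (∈-map⁻ (inside ∷_) σ∈ˡ) (∈-map⁻ (outside ∷_) σ∈ʳ)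
  where
  disjoint : ∀ {σ : Subset (suc m)} → (∃[ ρ ] ρ ∈ grade m k × σ ≡ inside ∷ ρ) →
             ¬ (∃[ ρ ] ρ ∈ grade m (suc k) × σ ≡ outside ∷ ρ)
  disjoint (_ , _ , refl) (_ , _ , ())

length-grade : ∀ m k → length (grade m k) ≡ m C k
length-grade m       zero    = refl
length-grade zero    (suc k) = refl
length-grade (suc m) (suc k) = begin
  length (map (inside ∷_) (grade m k) ++ map (outside ∷_) (grade m (suc k)))
    ≡⟨ Listₚ.length-++ (map (inside ∷_) (grade m k)) ⟩
  length (map (inside ∷_) (grade m k)) ℕ.+ length (map (outside ∷_) (grade m (suc k)))
    ≡⟨ cong₂ ℕ._+_ (trans (Listₚ.length-map _ (grade m k)) (length-grade m k))
                   (trans (Listₚ.length-map _ (grade m (suc k))) (length-grade m (suc k))) ⟩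
  m C k ℕ.+ m C suc k
    ≡⟨ nCk+nC[k+1]≡[n+1]C[k+1] m k ⟩
  suc m C suc k ∎
  where open ≡-Reasoning

-- The weighted norm of cycles and its Gram determinant

ℚ⁺ : Set
ℚ⁺ = Σ ℚ (0ℚ ℚ.<_)

infixl 6 _+⁺_
_+⁺_ : ℚ⁺ → ℚ⁺ → ℚ⁺
(p , 0<p) +⁺ (q , 0<q) = p + q , ℚₚ.+-mono-< 0<p 0<q

pos⇒≢0 : ∀ {p} → 0ℚ ℚ.< p → p ≢ 0ℚ
pos⇒≢0 0<p p≡0 = ℚₚ.<⇒≢ 0<p (sym p≡0)

*-inv⁺ : ∀ ((p , _) : ℚ⁺) → p * invℚ p ≡ 1ℚ
*-inv⁺ (p , 0<p) = *-invℚ (pos⇒≢0 0<p)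

inv-≢0 : ∀ {p} → p ≢ 0ℚ → invℚ p ≢ 0ℚ
inv-≢0 {p} p≢0 eq = contradiction
  (trans (sym (*-invℚ p≢0)) (trans (cong (p *_) eq) (ℚₚ.*-zeroʳ p))) (λ ())

∑ˢ ∏ˢ : ∀ {m} → Subset m → (Fin m → ℚ⁺) → ℚ
∑ˢ []            y = 0ℚ
∑ˢ (inside  ∷ σ) y = proj₁ (y Fin.zero) + ∑ˢ σ (y ∘ Fin.suc)
∑ˢ (outside ∷ σ) y = ∑ˢ σ (y ∘ Fin.suc)
∏ˢ []            y = 1ℚ
∏ˢ (inside  ∷ σ) y = proj₁ (y Fin.zero) * ∏ˢ σ (y ∘ Fin.suc)
∏ˢ (outside ∷ σ) y = ∏ˢ σ (y ∘ Fin.suc)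

restrict : ∀ {m} b → LinearMap (Subset (suc m)) (Subset m)
restrict b = record
  { apply  = _∘ (b ∷_)
  ; linear = λ _ _ _ _ → refl
  ; ≐-cong = λ eq σ → eq (b ∷ σ)
  }

-- The linear form under the completed square: the part of the chain through the first vertex, plus
-- `c` times the boundary of the part avoiding it.
merge : ∀ {m} → ℚ → LinearMap (Subset (suc m)) (Subset m)
merge c = record
  { apply  = λ u → (u ∘ (inside ∷_)) +[ c ] boundary (u ∘ (outside ∷_))
  ; linear = λ u d w ρ → trans
      (cong (λ z → u (inside ∷ ρ) + d * w (inside ∷ ρ) + c * z)
        (boundary-linear (u ∘ (outside ∷_)) d (w ∘ (outside ∷_)) ρ))
      (solve 6 (λ p q d a b c → p :+ d :* q :+ c :* (a :+ d :* b) := (p :+ c :* a) :+ d :* (q :+ c :* b)) refl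
        (u (inside ∷ ρ)) (w (inside ∷ ρ)) d
        (boundary (u ∘ (outside ∷_)) ρ) (boundary (w ∘ (outside ∷_)) ρ) c)
  ; ≐-cong = λ eq ρ → cong₂ (λ p q → p + c * q) (eq (inside ∷ ρ))
      (boundary-≐ (λ σ → eq (outside ∷ σ)) ρ)
  }

-- Equals `1/t + 1/y`, the leading coefficient when the square is completed.
ratio : ℚ⁺ → ℚ⁺ → ℚ
ratio t y = proj₁ (t +⁺ y) * (invℚ (proj₁ t) * invℚ (proj₁ y))

0≤ratio : ∀ t y → 0ℚ ℚ.≤ ratio t y
0≤ratio t y = 0≤* (ℚₚ.<⇒≤ (proj₂ (t +⁺ y))) (0≤* (0≤invℚ (ℚₚ.<⇒≤ (proj₂ t))) (0≤invℚ (ℚₚ.<⇒≤ (proj₂ y))))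

ratio≢0 : ∀ t y → ratio t y ≢ 0ℚ
ratio≢0 t y = *≢0 (pos⇒≢0 (proj₂ (t +⁺ y))) (*≢0 (inv-≢0 (pos⇒≢0 (proj₂ t))) (inv-≢0 (pos⇒≢0 (proj₂ y))))

weight : ℚ⁺ → ℚ⁺ → ℚ
weight t y = proj₁ y * invℚ (proj₁ (t +⁺ y))

-- For a chain u of k-element subsets of the vertices other than the apex, let z
-- be the boundary of the cone over u, up to sign. With t the weight of the apex
-- and y the other weights, ⟪ u , u ⟫ is Σ_σ z(σ)² / ∏_{i∈σ} y_i. For the vertex with
-- weight y₀ write h and g for the parts of u on the subsets containing it or not;
-- the recursion comes from
--   h²/y₀ + (h + ∂g)²/t = (t + y₀)/(t y₀) (h + y₀/(t + y₀) ∂g)² + (∂g)²/(t + y₀).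
energy : ∀ {m} → ℕ → ℚ⁺ → (Fin m → ℚ⁺) → Form (Subset m)
energy zero t y = record
  { ⟪_,_⟫     = λ u v → u ⊥ * v ⊥
  ; symmetric = λ u v → ℚₚ.*-comm (u ⊥) (v ⊥)
  ; linearˡ   = λ u c w v → solve 4 (λ u c w v → (u :+ c :* w) :* v := u :* v :+ c :* (w :* v)) refl
                  (u ⊥) c (w ⊥) (v ⊥)
  ; congˡ     = λ v eq → cong (_* v ⊥) (eq ⊥)
  ; nonneg    = λ u → 0≤² (u ⊥)
  }
energy {zero} (suc k) t y = record
  { ⟪_,_⟫     = λ _ _ → 0ℚ
  ; symmetric = λ _ _ → refl
  ; linearˡ   = λ _ c _ _ → solve 1 (λ c → con 0ℚ := con 0ℚ :+ c :* con 0ℚ) refl c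
  ; congˡ     = λ _ _ → refl
  ; nonneg    = λ _ → ℚₚ.≤-refl
  }
energy {suc m} (suc k) t y = orthogonalSum (ratio t (y Fin.zero)) (0≤ratio t (y Fin.zero))
  (energy k t′ (y ∘ Fin.suc)) (merge (weight t (y Fin.zero)))
  (energy (suc k) t′ (y ∘ Fin.suc)) (restrict outside)
  where t′ = t +⁺ y Fin.zero

energy-dependsOn : ∀ m k t y → DependsOn (grade m k) (energy k t y)
energy-dependsOn m       zero    t y v eq = cong (_* v ⊥) (eq ⊥ (here refl))
energy-dependsOn zero    (suc k) t y v eq = refl
energy-dependsOn (suc m) (suc k) t y {u} {u′} v eq = cong₂ (λ p q → ratio t (y Fin.zero) * p + q)
  (energy-dependsOn m k _ _ _ λ ρ ρ∈ → cong₂ (λ p q → p + weight t (y Fin.zero) * q)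
    (eq (inside ∷ ρ) (∈-++⁺ˡ (∈-map⁺ (inside ∷_) ρ∈)))
    (boundary-cong k (λ σ |σ|≡ → out σ (grade-complete (suc k) σ |σ|≡)) ρ (grade-sound m k ρ∈)))
  (energy-dependsOn m (suc k) _ _ _ out)
  where
  out : ∀ σ → σ ∈ grade m (suc k) → u (outside ∷ σ) ≡ u′ (outside ∷ σ)
  out σ σ∈ = eq (outside ∷ σ) (∈-++⁺ʳ (map (inside ∷_) (grade m k)) (∈-map⁺ (outside ∷_) σ∈))

∑⁺ ∏⁺ : ∀ {m} → (Fin m → ℚ⁺) → ℚ
∑⁺ {zero}  y = 0ℚ
∑⁺ {suc m} y = proj₁ (y Fin.zero) + ∑⁺ (y ∘ Fin.suc)
∏⁺ {zero}  y = 1ℚ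
∏⁺ {suc m} y = proj₁ (y Fin.zero) * ∏⁺ (y ∘ Fin.suc)

-- Sum over product of all weights, apex included.
density : ∀ {m} → ℚ⁺ → (Fin m → ℚ⁺) → ℚ
density t y = (proj₁ t + ∑⁺ y) * (invℚ (proj₁ t) * invℚ (∏⁺ y))

density-suc : ∀ {m} t (y : Fin (suc m) → ℚ⁺) →
              density t y ≡ ratio t (y Fin.zero) * density (t +⁺ y Fin.zero) (y ∘ Fin.suc)
density-suc t y = sym (trans
  (modulo ((T + Y) * invℚ (T + Y)) 1ℚ ((T + Y + s) * (invℚ T * (invℚ Y * p))) (*-inv⁺ (t +⁺ y Fin.zero))
    (solve 7 (λ T Y s i j l p → (T :+ Y) :* (i :* j) :* ((T :+ Y :+ s) :* (l :* p)) :=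
      (T :+ (Y :+ s)) :* (i :* (j :* p)) :+ ((T :+ Y) :* l :- con 1ℚ) :* ((T :+ Y :+ s) :* (i :* (j :* p)))) refl
      T Y s (invℚ T) (invℚ Y) (invℚ (T + Y)) p))
  (cong (λ q → (T + (Y + s)) * (invℚ T * q)) (sym (invℚ-* Y (∏⁺ (y ∘ Fin.suc))))))
  where
  T = proj₁ t
  Y = proj₁ (y Fin.zero)
  s = ∑⁺ (y ∘ Fin.suc)
  p = invℚ (∏⁺ (y ∘ Fin.suc))

-- The binomial coefficient of `m - 1` over `k - 1`, set to 0 if `m` or `k` is 0. Since `m` counts
-- the vertices other than the apex, this is the exponent `m₁`.
exponent : ℕ → ℕ → ℕ
exponent zero    k       = 0
exponent (suc m) zero    = 0
exponent (suc m) (suc k) = m C k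

exponent-pascal : ∀ m k → exponent (suc m) k ℕ.+ exponent (suc m) (suc k) ≡ suc m C k
exponent-pascal m zero    = refl
exponent-pascal m (suc k) = nCk+nC[k+1]≡[n+1]C[k+1] m k

-- Pascal's rule for `exponent` fails at `m` and `k` both 0, where it would read 0 + 0 = 1; but
-- without further vertices the density is 1.
density-exponent : ∀ m k t (y : Fin m → ℚ⁺) →
                   density t y ^ℚ (exponent m k ℕ.+ exponent m (suc k)) ≡ density t y ^ℚ (m C k)
density-exponent zero k t y = trans (sym (1^ℚ (zero C k))) (cong (_^ℚ (zero C k)) (sym eq))
  where
  T = proj₁ t
  eq : (T + 0ℚ) * (invℚ T * invℚ 1ℚ) ≡ 1ℚ
  eq = trans (solve 2 (λ T i → (T :+ con 0ℚ) :* (i :* con 1ℚ) := T :* i) refl T (invℚ T)) (*-inv⁺ t)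
density-exponent (suc m) k t y = cong (density t y ^ℚ_) (exponent-pascal m k)

merge-axis : ∀ {m} t (y : Fin (suc m) → ℚ⁺) (ρ : Subset m) →
             apply (merge (weight t (y Fin.zero))) (axis (inside ∷ ρ)) ≐ axis ρ
merge-axis t y ρ σ = trans
  (cong (λ z → axis ρ σ + weight t (y Fin.zero) * z) (trans (boundary-≐ (λ _ → ι-0) σ) (boundary-0 σ)))
  (solve 2 (λ a c → a :+ c :* con 0ℚ := a) refl (axis ρ σ) (weight t (y Fin.zero)))

-- The sets through the first vertex serve as lifts: `merge` maps their axes to axes and restriction
-- to the other sets kills them. They contribute a power of `ratio`; the two remaining determinants
-- are powers of the same density, with exponents added by Pascal's rule.
gram-energy : ∀ m k t y → gram (energy k t y) (map axis (grade m k)) ≡ density t y ^ℚ exponent m k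
gram-energy m zero t y = trans (gram-∷ E (axis ⊥) []) (trans
    (cong₂ _*_ (cong (λ p → p * p) (axis-≡ (⊥ {m}))) (gram-[] (schur E (axis ⊥))))
    (sym (cong (density t y ^ℚ_) (e≡0 m))))
  where
  E = energy {m} zero t y
  e≡0 : ∀ m → exponent m zero ≡ 0
  e≡0 zero    = refl
  e≡0 (suc m) = refl
gram-energy zero (suc k) t y = gram-[] (energy (suc k) t y)
gram-energy (suc m) (suc k) t y = begin
  gram E (map axis (map (inside ∷_) L ++ map (outside ∷_) L′))
    ≡⟨ cong (gram E) (trans (Listₚ.map-++ axis (map (inside ∷_) L) (map (outside ∷_) L′))
         (cong (_++ map axis (map (outside ∷_) L′)) (sym (Listₚ.map-∘ L)))) ⟩
  gram E (map (axis ∘ (inside ∷_)) L ++ map axis (map (outside ∷_) L′))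
    ≡⟨ gram-sum _≟ˢ_ (ratio≢0 t y₀) (apply (merge (weight t y₀))) (apply (restrict outside)) (axis ∘ (inside ∷_))
         L (grade-unique m k) (merge-axis t y) (λ _ _ → ι-0) E E₁ E₂ (energy-dependsOn m k t′ y′) (λ _ _ → refl)
         (map axis (map (outside ∷_) L′)) ⟩
  α ^ℚ length L * gram E₁ (map axis L) * gram E₂ (map (apply (restrict outside)) (map axis (map (outside ∷_) L′)))
    ≡⟨ cong₂ (λ g as → α ^ℚ length L * g * gram E₂ as) (gram-energy m k t′ y′)
         (trans (sym (Listₚ.map-∘ (map (outside ∷_) L′))) (sym (Listₚ.map-∘ L′))) ⟩
  α ^ℚ length L * R ^ℚ exponent m k * gram E₂ (map axis L′)
    ≡⟨ cong₂ (λ n g → α ^ℚ n * R ^ℚ exponent m k * g) (length-grade m k) (gram-energy m (suc k) t′ y′) ⟩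
  α ^ℚ (m C k) * R ^ℚ exponent m k * R ^ℚ exponent m (suc k)
    ≡⟨ trans (ℚₚ.*-assoc (α ^ℚ (m C k)) (R ^ℚ exponent m k) (R ^ℚ exponent m (suc k)))
         (cong (α ^ℚ (m C k) *_) (trans (sym (^ℚ-+ R (exponent m k) (exponent m (suc k)))) (density-exponent m k t′ y′))) ⟩
  α ^ℚ (m C k) * R ^ℚ (m C k)
    ≡⟨ ^ℚ-* α R (m C k) ⟨
  (α * R) ^ℚ (m C k)
    ≡⟨ cong (_^ℚ (m C k)) (density-suc t y) ⟨
  density t y ^ℚ (m C k) ∎
  where
  open ≡-Reasoning
  y₀ = y Fin.zero
  y′ = y ∘ Fin.suc
  t′ = t +⁺ y₀
  L = grade m k
  L′ = grade m (suc k)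
  α = ratio t y₀
  R = density t′ y′
  E = energy (suc k) t y
  E₁ = energy k t′ y′
  E₂ = energy (suc k) t′ y′

∏ˢ-⊥ : ∀ {m} (y : Fin m → ℚ⁺) → ∏ˢ ⊥ y ≡ 1ℚ
∏ˢ-⊥ {zero}  y = refl
∏ˢ-⊥ {suc m} y = ∏ˢ-⊥ (y ∘ Fin.suc)

∑ˢ-⊥ : ∀ {m} (y : Fin m → ℚ⁺) → ∑ˢ ⊥ y ≡ 0ℚ
∑ˢ-⊥ {zero}  y = refl
∑ˢ-⊥ {suc m} y = ∑ˢ-⊥ (y ∘ Fin.suc)

0<∏ˢ : ∀ {m} (σ : Subset m) (y : Fin m → ℚ⁺) → 0ℚ ℚ.< ∏ˢ σ y
0<∏ˢ []            y = ℚₚ.positive⁻¹ 1ℚ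
0<∏ˢ (inside  ∷ σ) y = 0<* (proj₂ (y Fin.zero)) (0<∏ˢ σ (y ∘ Fin.suc))
0<∏ˢ (outside ∷ σ) y = 0<∏ˢ σ (y ∘ Fin.suc)

singleton : ∀ {m} (τ : Subset m) (y : Fin m → ℚ⁺) → ∣ τ ∣ ≡ 1 → boundary (axis τ) ⊥ ≡ 1ℚ × ∑ˢ τ y ≡ ∏ˢ τ y
singleton {suc m} (inside ∷ τ) y |τ|≡1 with ∣σ∣≡0⇒σ≡⊥ τ (ℕₚ.suc-injective |τ|≡1)
... | refl = trans (cong₂ _+_ (axis-≡ (⊥ {m})) (trans (boundary-≐ (λ _ → ι-0) (⊥ {m})) (boundary-0 (⊥ {m})))) (ℚₚ.+-identityʳ 1ℚ)
           , trans (cong (λ z → proj₁ (y Fin.zero) + z) (∑ˢ-⊥ (y ∘ Fin.suc)))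
               (trans (solve 1 (λ a → a :+ con 0ℚ := a :* con 1ℚ) refl (proj₁ (y Fin.zero)))
                 (cong (proj₁ (y Fin.zero) *_) (sym (∏ˢ-⊥ (y ∘ Fin.suc)))))
singleton (outside ∷ τ) y |τ|≡1 with singleton τ (y ∘ Fin.suc) |τ|≡1
... | b , s = trans (cong₂ _+_ ι-0 b) (ℚₚ.+-identityˡ 1ℚ) , s

-- Squared norms of the columns

norm : ∀ {X} → Form X → (X → ℚ) → ℚ
norm B u = ⟪_,_⟫ B u u

norm-≐ : ∀ {X} (B : Form X) {u v} → u ≐ v → norm B u ≡ norm B v
norm-≐ B {u} {v} eq = trans (Form.congˡ B u eq) (Form.congʳ B v eq)

norm-scale : ∀ {X} (B : Form X) c {u v} → (∀ x → u x ≡ c * v x) → norm B u ≡ c * c * norm B v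
norm-scale B c {v = v} eq = trans (norm-≐ B eq) (Form.scale² B c v)

norm-0 : ∀ {X} (B : Form X) {u} → (∀ x → u x ≡ 0ℚ) → norm B u ≡ 0ℚ
norm-0 B {u} eq = trans (norm-≐ B eq) (Form.zeroˡ B (λ _ → 0ℚ))

mutual

  -- The facets of `τ` have coefficients 1 or -1, so the norm is the sum over `i` in `τ` of the
  -- inverse product of the other weights. In the recursion, if the first vertex lies in `τ`, the
  -- part of the boundary avoiding it is an axis; hence the mutual induction with `energy-axis`.
  energy-boundary : ∀ {m} k t y (τ : Subset m) → ∣ τ ∣ ≡ suc k →
                    norm (energy k t y) (boundary (axis τ)) ≡ ∑ˢ τ y * invℚ (∏ˢ τ y)
  energy-boundary zero t y τ |τ|≡1 with singleton τ y |τ|≡1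
  ... | b , s = trans (cong (λ p → p * p) b)
    (sym (trans (cong (_* invℚ (∏ˢ τ y)) s) (*-invℚ (pos⇒≢0 (0<∏ˢ τ y)))))
  energy-boundary (suc k) t y (outside ∷ τ) |τ|≡ = trans
    (cong₂ (λ p q → ratio t (y Fin.zero) * p + q)
      (norm-0 (energy k t′ y′) merge≡0)
      (trans (norm-≐ (energy (suc k) t′ y′)
               (λ σ → trans (cong (_+ boundary (axis τ) σ) ι-0) (ℚₚ.+-identityˡ _)))
             (energy-boundary (suc k) t′ y′ τ |τ|≡)))
    (solve 2 (λ α q → α :* con 0ℚ :+ q := q) refl (ratio t (y Fin.zero)) (∑ˢ τ y′ * invℚ (∏ˢ τ y′)))
    where
    t′ = t +⁺ y Fin.zero
    y′ = y ∘ Fin.suc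
    c = weight t (y Fin.zero)
    merge≡0 : ∀ ρ → apply (merge c) (boundary (axis (outside ∷ τ))) ρ ≡ 0ℚ
    merge≡0 ρ = trans (cong₂ (λ p q → - p + c * q)
        (trans (boundary-≐ (λ _ → ι-0) ρ) (boundary-0 ρ))
        (trans (boundary-≐ (λ σ → trans (cong (_+ boundary (axis τ) σ) ι-0) (ℚₚ.+-identityˡ _)) ρ)
               (boundary² (axis τ) ρ)))
      (solve 1 (λ c → :- con 0ℚ :+ c :* con 0ℚ := con 0ℚ) refl c)
  energy-boundary (suc k) t y (inside ∷ τ) |τ|≡ = begin
    ratio t y₀ * norm (energy k t′ y′) (apply (merge c) u) + norm (energy (suc k) t′ y′) (u ∘ (outside ∷_))
      ≡⟨ cong₂ (λ p q → ratio t y₀ * p + q)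
           (trans (norm-scale (energy k t′ y′) d scaled)
                  (cong (d * d *_) (energy-boundary k t′ y′ τ (ℕₚ.suc-injective |τ|≡))))
           (trans (norm-≐ (energy (suc k) t′ y′) out) (energy-axis (suc k) t′ y′ τ (ℕₚ.suc-injective |τ|≡))) ⟩
    ratio t y₀ * (d * d * (s * w)) + (T + Y + s) * (invℚ (T + Y) * w)
      ≡⟨ identity ⟩
    (Y + s) * (invℚ Y * w)
      ≡⟨ cong ((Y + s) *_) (invℚ-* Y (∏ˢ τ y′)) ⟨
    (Y + s) * invℚ (Y * ∏ˢ τ y′) ∎
    where
    open ≡-Reasoning
    y₀ = y Fin.zero
    t′ = t +⁺ y₀
    y′ = y ∘ Fin.suc
    c = weight t y₀
    T = proj₁ t
    Y = proj₁ y₀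
    -- The two parts of `u` are minus the boundary of `τ`, and `τ` itself; merging gives the factor
    -- `-1 + c`, and `1 - c = T / (T + Y)`.
    d = - (T * invℚ (T + Y))
    s = ∑ˢ τ y′
    w = invℚ (∏ˢ τ y′)
    u = boundary (axis (inside ∷ τ))
    out : ∀ ρ → u (outside ∷ ρ) ≡ axis τ ρ
    out ρ = trans (cong (λ z → axis τ ρ + z) (trans (boundary-≐ (λ _ → ι-0) ρ) (boundary-0 ρ)))
                  (ℚₚ.+-identityʳ (axis τ ρ))
    scaled : ∀ ρ → apply (merge c) u ρ ≡ d * boundary (axis τ) ρ
    scaled ρ = trans (cong (λ z → - boundary (axis τ) ρ + c * z) (boundary-≐ out ρ))
      (modulo ((T + Y) * invℚ (T + Y)) 1ℚ (boundary (axis τ) ρ) (*-inv⁺ t′)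
        (solve 4 (λ T Y l b → :- b :+ Y :* l :* b :=
          :- (T :* l) :* b :+ ((T :+ Y) :* l :- con 1ℚ) :* b) refl T Y (invℚ (T + Y)) (boundary (axis τ) ρ)))
    -- Up to the factor `w` this is `T s / (Y (T + Y)) + (T + Y + s) / (T + Y) = (Y + s) / Y`.
    identity : ratio t y₀ * (d * d * (s * w)) + (T + Y + s) * (invℚ (T + Y) * w) ≡ (Y + s) * (invℚ Y * w)
    identity =
      modulo (Y * j) 1ℚ (- w - l * s * w) (*-inv⁺ y₀)
      (modulo ((T + Y) * l) 1ℚ (T * j * l * s * w + w + s * j * w) (*-inv⁺ t′)
      (modulo (T * i) 1ℚ ((T + Y) * l * (T * j * l * s * w)) (*-inv⁺ t)
        (solve 7 (λ T Y i j l s w →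
          (T :+ Y) :* (i :* j) :* ((:- (T :* l)) :* (:- (T :* l)) :* (s :* w)) :+ (T :+ Y :+ s) :* (l :* w) :=
          (Y :+ s) :* (j :* w) :+ (Y :* j :- con 1ℚ) :* (:- w :- l :* s :* w)
            :+ ((T :+ Y) :* l :- con 1ℚ) :* (T :* j :* l :* s :* w :+ w :+ s :* j :* w)
            :+ (T :* i :- con 1ℚ) :* ((T :+ Y) :* l :* (T :* j :* l :* s :* w))) refl
          T Y i j l s w)))
      where
      i = invℚ T
      j = invℚ Y
      l = invℚ (T + Y)

  -- Here `axis σ` stands, up to sign, for the boundary of the face spanned by `σ` and the apex, so
  -- `t` joins both the sum and the product. A first vertex outside `σ` leaves a multiple of the
  -- boundary of `σ` after merging, which leads back to `energy-boundary`.
  energy-axis : ∀ {m} k t y (σ : Subset m) → ∣ σ ∣ ≡ k →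
                norm (energy k t y) (axis σ) ≡ (proj₁ t + ∑ˢ σ y) * (invℚ (proj₁ t) * invℚ (∏ˢ σ y))
  energy-axis {m} zero t y σ |σ|≡0 with ∣σ∣≡0⇒σ≡⊥ σ |σ|≡0
  ... | refl = trans (cong (λ p → p * p) (axis-≡ (⊥ {m}))) (sym (trans
    (cong₂ (λ a b → (proj₁ t + a) * (invℚ (proj₁ t) * invℚ b)) (∑ˢ-⊥ y) (∏ˢ-⊥ y))
    (trans (solve 2 (λ T i → (T :+ con 0ℚ) :* (i :* con 1ℚ) := T :* i) refl (proj₁ t) (invℚ (proj₁ t)))
           (*-inv⁺ t))))
  energy-axis (suc k) t y (inside ∷ ρ) |σ|≡ = begin
    ratio t y₀ * norm (energy k t′ y′) (apply (merge c) (axis (inside ∷ ρ)))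
      + norm (energy (suc k) t′ y′) (λ σ → axis (inside ∷ ρ) (outside ∷ σ))
      ≡⟨ cong₂ (λ p q → ratio t y₀ * p + q)
           (trans (norm-≐ (energy k t′ y′) (merge-axis t y ρ)) (energy-axis k t′ y′ ρ (ℕₚ.suc-injective |σ|≡)))
           (norm-0 (energy (suc k) t′ y′) (λ _ → ι-0)) ⟩
    ratio t y₀ * ((T + Y + s) * (invℚ (T + Y) * w)) + 0ℚ
      ≡⟨ modulo ((T + Y) * invℚ (T + Y)) 1ℚ (invℚ T * invℚ Y * (T + Y + s) * w) (*-inv⁺ t′)
          (solve 7 (λ T Y i j l s w →
            (T :+ Y) :* (i :* j) :* ((T :+ Y :+ s) :* (l :* w)) :+ con 0ℚ :=
            (T :+ (Y :+ s)) :* (i :* (j :* w)) :+ ((T :+ Y) :* l :- con 1ℚ) :* (i :* j :* (T :+ Y :+ s) :* w)) refl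
            T Y (invℚ T) (invℚ Y) (invℚ (T + Y)) s w) ⟩
    (T + (Y + s)) * (invℚ T * (invℚ Y * w))
      ≡⟨ cong (λ z → (T + (Y + s)) * (invℚ T * z)) (invℚ-* Y (∏ˢ ρ y′)) ⟨
    (T + (Y + s)) * (invℚ T * invℚ (Y * ∏ˢ ρ y′)) ∎
    where
    open ≡-Reasoning
    y₀ = y Fin.zero
    t′ = t +⁺ y₀
    y′ = y ∘ Fin.suc
    c = weight t y₀
    T = proj₁ t
    Y = proj₁ y₀
    s = ∑ˢ ρ y′
    w = invℚ (∏ˢ ρ y′)
  energy-axis (suc k) t y (outside ∷ σ) |σ|≡ = begin
    ratio t y₀ * norm (energy k t′ y′) (apply (merge c) (axis (outside ∷ σ))) + norm (energy (suc k) t′ y′) (axis σ)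
      ≡⟨ cong₂ (λ p q → ratio t y₀ * p + q)
           (trans (norm-scale (energy k t′ y′) c
                    (λ ρ → trans (cong (_+ c * boundary (axis σ) ρ) ι-0) (ℚₚ.+-identityˡ _)))
                  (cong (c * c *_) (energy-boundary k t′ y′ σ |σ|≡)))
           (energy-axis (suc k) t′ y′ σ |σ|≡) ⟩
    ratio t y₀ * (c * c * (s * w)) + (T + Y + s) * (invℚ (T + Y) * w)
      ≡⟨ identity ⟩
    (T + s) * (invℚ T * w) ∎
    where
    open ≡-Reasoning
    y₀ = y Fin.zero
    t′ = t +⁺ y₀
    y′ = y ∘ Fin.suc
    c = weight t y₀
    T = proj₁ t
    Y = proj₁ y₀
    s = ∑ˢ σ y′
    w = invℚ (∏ˢ σ y′)
    -- The identity of `energy-boundary` with the roles of `T` and `Y` exchanged.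
    identity : ratio t y₀ * (c * c * (s * w)) + (T + Y + s) * (invℚ (T + Y) * w) ≡ (T + s) * (invℚ T * w)
    identity =
      modulo (T * i) 1ℚ (- w - l * s * w) (*-inv⁺ t)
      (modulo ((T + Y) * l) 1ℚ (Y * i * l * s * w + w + s * i * w) (*-inv⁺ t′)
      (modulo (Y * j) 1ℚ ((T + Y) * l * (Y * i * l * s * w)) (*-inv⁺ y₀)
        (solve 7 (λ T Y i j l s w →
          (T :+ Y) :* (i :* j) :* (Y :* l :* (Y :* l) :* (s :* w)) :+ (T :+ Y :+ s) :* (l :* w) :=
          (T :+ s) :* (i :* w) :+ (T :* i :- con 1ℚ) :* (:- w :- l :* s :* w)
            :+ ((T :+ Y) :* l :- con 1ℚ) :* (Y :* i :* l :* s :* w :+ w :+ s :* i :* w)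
            :+ (Y :* j :- con 1ℚ) :* ((T :+ Y) :* l :* (Y :* i :* l :* s :* w))) refl
          T Y i j l s w)))
      where
      i = invℚ T
      j = invℚ Y
      l = invℚ (T + Y)

-- The cycle lattice of a ℚ-acyclic complex

∑ᶻ-cong : ∀ {n} {f g : Vector ℤ n} → (∀ i → f i ≡ g i) → ∑ᶻ f ≡ ∑ᶻ g
∑ᶻ-cong {zero}  eq = refl
∑ᶻ-cong {suc n} eq = cong₂ ℤ._+_ (eq Fin.zero) (∑ᶻ-cong (λ i → eq (Fin.suc i)))

∑ᶻ-0 : ∀ {n} {f : Vector ℤ n} → (∀ i → f i ≡ 0ℤ) → ∑ᶻ f ≡ 0ℤ
∑ᶻ-0 {zero}  eq = refl
∑ᶻ-0 {suc n} eq = cong₂ ℤ._+_ (eq Fin.zero) (∑ᶻ-0 (λ i → eq (Fin.suc i)))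

∑ᶻ-neg : ∀ {n} (f : Vector ℤ n) → ∑ᶻ (λ i → ℤ.- f i) ≡ ℤ.- ∑ᶻ f
∑ᶻ-neg {zero}  f = refl
∑ᶻ-neg {suc n} f = trans (cong (λ z → ℤ.- f Fin.zero ℤ.+ z) (∑ᶻ-neg (f ∘ Fin.suc)))
  (sym (ℤₚ.neg-distrib-+ (f Fin.zero) (∑ᶻ (f ∘ Fin.suc))))

length-filter-tabulate : ∀ {n} {A B : Set} {P : A → Set} {Q : B → Set} (P? : Decidable P) (Q? : Decidable Q)
                         (f : Fin n → A) (g : Fin n → B) → (∀ i → does (P? (f i)) ≡ does (Q? (g i))) →
                         length (filter P? (tabulate f)) ≡ length (filter Q? (tabulate g))
length-filter-tabulate {zero}  P? Q? f g eq = refl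
length-filter-tabulate {suc n} P? Q? f g eq
  with does (P? (f Fin.zero)) | does (Q? (g Fin.zero)) | eq Fin.zero
... | true  | true  | _ = cong suc (length-filter-tabulate P? Q? (f ∘ Fin.suc) (g ∘ Fin.suc) (eq ∘ Fin.suc))
... | false | false | _ = length-filter-tabulate P? Q? (f ∘ Fin.suc) (g ∘ Fin.suc) (eq ∘ Fin.suc)

position-inside : ∀ {m} v (τ : Subset m) → position (Fin.suc v) (inside ∷ τ) ≡ suc (position v τ)
position-inside v τ = cong suc (length-filter-tabulate
  (λ u → (u ∈? (inside ∷ τ)) ×-dec (u <? Fin.suc v)) (λ u → (u ∈? τ) ×-dec (u <? v)) Fin.suc id (λ _ → refl))

position-outside : ∀ {m} v (τ : Subset m) → position (Fin.suc v) (outside ∷ τ) ≡ position v τ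
position-outside v τ = length-filter-tabulate
  (λ u → (u ∈? (outside ∷ τ)) ×-dec (u <? Fin.suc v)) (λ u → (u ∈? τ) ×-dec (u <? v)) Fin.suc id (λ _ → refl)

position-zero : ∀ {m} (τ : Subset (suc m)) → position Fin.zero τ ≡ 0
position-zero {m} τ = cong length (Listₚ.filter-none (λ u → (u ∈? τ) ×-dec (u <? Fin.zero {m}))
  (All.universal {P = λ u → ¬ (u Subset.∈ τ × u Fin.< Fin.zero {m})} (λ _ ()) (allFin (suc m))))

sign-term : ∀ {m} → Subset m → Subset m → Fin m → ℤ
sign-term τ σ v = if does ((v ∈? τ) ×-dec (σ ≟ˢ (τ ∖ v))) then -1ℤ ℤ.^ position v τ else 0ℤ

if-false : ∀ {A : Set} {b} {x y : A} → b ≡ false → (if b then x else y) ≡ y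
if-false refl = refl

does-≟ˢ-sym : ∀ {m} (σ τ : Subset m) → does (σ ≟ˢ τ) ≡ does (τ ≟ˢ σ)
does-≟ˢ-sym σ τ = cases (σ ≟ˢ τ)
  where
  cases : Dec (σ ≡ τ) → does (σ ≟ˢ τ) ≡ does (τ ≟ˢ σ)
  cases (yes refl) = refl
  cases (no σ≢τ) = trans (dec-false (σ ≟ˢ τ) σ≢τ) (sym (dec-false (τ ≟ˢ σ) (σ≢τ ∘ sym)))

incidence-in-out : ∀ {m} (τ σ : Subset m) → incidence (inside ∷ τ) (outside ∷ σ) ≡ unit τ σ
incidence-in-out τ σ = trans (cong₂ ℤ._+_ first (∑ᶻ-0 rest)) (ℤₚ.+-identityʳ (unit τ σ))
  where
  first : sign-term (inside ∷ τ) (outside ∷ σ) Fin.zero ≡ unit τ σ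
  first = cong₂ (λ b p → if b then -1ℤ ℤ.^ p else 0ℤ)
    (trans (cong (λ ρ → does (σ ≟ˢ ρ)) (Subsetₚ.p─⊥≡p τ)) (does-≟ˢ-sym σ τ)) (position-zero (inside ∷ τ))
  rest : ∀ v → sign-term (inside ∷ τ) (outside ∷ σ) (Fin.suc v) ≡ 0ℤ
  rest v = if-false (Boolₚ.∧-zeroʳ (does (v ∈? τ)))

incidence-in-in : ∀ {m} (τ σ : Subset m) → incidence (inside ∷ τ) (inside ∷ σ) ≡ ℤ.- incidence τ σ
incidence-in-in τ σ = trans (ℤₚ.+-identityˡ _) (trans (∑ᶻ-cong term) (∑ᶻ-neg (sign-term τ σ)))
  where
  term : ∀ v → sign-term (inside ∷ τ) (inside ∷ σ) (Fin.suc v) ≡ ℤ.- sign-term τ σ v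
  term v = trans
    (cong (λ p → if does ((v ∈? τ) ×-dec (σ ≟ˢ (τ ∖ v))) then -1ℤ ℤ.^ p else 0ℤ) (position-inside v τ))
    (if-neg (does ((v ∈? τ) ×-dec (σ ≟ˢ (τ ∖ v)))) (position v τ))
    where
    if-neg : ∀ b p → (if b then -1ℤ ℤ.^ suc p else 0ℤ) ≡ ℤ.- (if b then -1ℤ ℤ.^ p else 0ℤ)
    if-neg true  p = ℤₚ.-1*i≡-i (-1ℤ ℤ.^ p)
    if-neg false p = refl

incidence-out-out : ∀ {m} (τ σ : Subset m) → incidence (outside ∷ τ) (outside ∷ σ) ≡ incidence τ σ
incidence-out-out τ σ = trans (ℤₚ.+-identityˡ _) (∑ᶻ-cong λ v →
  cong (λ p → if does ((v ∈? τ) ×-dec (σ ≟ˢ (τ ∖ v))) then -1ℤ ℤ.^ p else 0ℤ) (position-outside v τ))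

incidence-out-in : ∀ {m} (τ σ : Subset m) → incidence (outside ∷ τ) (inside ∷ σ) ≡ 0ℤ
incidence-out-in τ σ = trans (ℤₚ.+-identityˡ _) (∑ᶻ-0 λ v → if-false (Boolₚ.∧-zeroʳ (does (v ∈? τ))))

ι-neg : ∀ z → ι (ℤ.- z) ≡ - ι z
ι-neg z = trans (cong ι (sym (ℤₚ.-1*i≡-i z))) (trans (ι-* -1ℤ z) (trans
  (cong (_* ι z) ι--1) (solve 1 (λ a → con (- 1ℚ) :* a := :- a) refl (ι z))))
  where
  ι--1 : ι -1ℤ ≡ - 1ℚ
  ι--1 = trans (ι-/1 -1ℤ) refl

-- The four cases for the first vertex reproduce the recursion of `boundary`: a vertex of `τ` in
-- front raises all later positions by one and flips the sign.
ι-incidence : ∀ {m} (τ σ : Subset m) → ι (incidence τ σ) ≡ boundary (axis τ) σ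
ι-incidence []            []            = ι-0
ι-incidence (inside  ∷ τ) (inside  ∷ σ) = trans (cong ι (incidence-in-in τ σ))
  (trans (ι-neg (incidence τ σ)) (cong -_ (ι-incidence τ σ)))
ι-incidence (inside  ∷ τ) (outside ∷ σ) = trans (cong ι (incidence-in-out τ σ)) (sym (trans
  (cong (λ z → axis τ σ + z) (trans (boundary-≐ (λ _ → ι-0) σ) (boundary-0 σ))) (ℚₚ.+-identityʳ (axis τ σ))))
ι-incidence (outside ∷ τ) (inside  ∷ σ) = trans (cong ι (incidence-out-in τ σ)) (trans ι-0 (sym
  (cong -_ (trans (boundary-≐ (λ _ → ι-0) σ) (boundary-0 σ)))))
ι-incidence (outside ∷ τ) (outside ∷ σ) = trans (cong ι (incidence-out-out τ σ)) (trans (ι-incidence τ σ)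
  (sym (trans (cong (_+ boundary (axis τ) σ) ι-0) (ℚₚ.+-identityˡ _))))

-- Chains as functions on all subsets

extend : ∀ {n} (F : List (Subset n)) → (Fin (length F) → ℤ) → Subset n → ℤ
extend []      c σ = 0ℤ
extend (τ ∷ F) c σ = extend F (c ∘ Fin.suc) σ ℤ.+ c Fin.zero ℤ.* unit τ σ

extend-∉ : ∀ {n} (F : List (Subset n)) c {σ} → All (σ ≢_) F → extend F c σ ≡ 0ℤ
extend-∉ []      c []            = refl
extend-∉ (τ ∷ F) c (σ≢τ ∷ σ∉F) = trans
  (cong₂ (λ p q → p ℤ.+ c Fin.zero ℤ.* q) (extend-∉ F (c ∘ Fin.suc) σ∉F) (unit-≢ (σ≢τ ∘ sym)))
  (trans (ℤₚ.+-identityˡ _) (ℤₚ.*-zeroʳ (c Fin.zero)))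

extend-lookup : ∀ {n} (F : List (Subset n)) c → Unique F → ∀ i → extend F c (lookup F i) ≡ c i
extend-lookup (τ ∷ F) c (τ∉F ∷ uF) Fin.zero = trans
  (cong₂ (λ p q → p ℤ.+ c Fin.zero ℤ.* q) (extend-∉ F (c ∘ Fin.suc) τ∉F) (unit-≡ τ))
  (trans (ℤₚ.+-identityˡ _) (ℤₚ.*-identityʳ (c Fin.zero)))
extend-lookup (τ ∷ F) c (τ∉F ∷ uF) (Fin.suc i) = trans
  (cong₂ (λ p q → p ℤ.+ c Fin.zero ℤ.* q) (extend-lookup F (c ∘ Fin.suc) uF i) (unit-∉ τ∉F (∈-lookup i)))
  (trans (cong (λ z → c (Fin.suc i) ℤ.+ z) (ℤₚ.*-zeroʳ (c Fin.zero))) (ℤₚ.+-identityʳ _))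

boundary-extend : ∀ {n} (F : List (Subset n)) c σ →
                  boundary (ι ∘ extend F c) σ ≡ ι (∑ᶻ (λ j → incidence (lookup F j) σ ℤ.* c j))
boundary-extend []      c σ = trans (boundary-≐ (λ _ → ι-0) σ) (trans (boundary-0 σ) (sym ι-0))
boundary-extend (τ ∷ F) c σ = begin
  boundary (ι ∘ extend (τ ∷ F) c) σ
    ≡⟨ boundary-≐ (λ ρ → trans (ι-+ (extend F c′ ρ) (c Fin.zero ℤ.* unit τ ρ))
         (cong (λ z → ι (extend F c′ ρ) + z) (ι-* (c Fin.zero) (unit τ ρ)))) σ ⟩
  boundary ((ι ∘ extend F c′) +[ ι (c Fin.zero) ] axis τ) σ
    ≡⟨ boundary-linear (ι ∘ extend F c′) (ι (c Fin.zero)) (axis τ) σ ⟩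
  boundary (ι ∘ extend F c′) σ + ι (c Fin.zero) * boundary (axis τ) σ
    ≡⟨ cong₂ (λ p q → p + ι (c Fin.zero) * q) (boundary-extend F c′ σ) (sym (ι-incidence τ σ)) ⟩
  ι s + ι (c Fin.zero) * ι (incidence τ σ)
    ≡⟨ solve 3 (λ a b d → a :+ b :* d := d :* b :+ a) refl (ι s) (ι (c Fin.zero)) (ι (incidence τ σ)) ⟩
  ι (incidence τ σ) * ι (c Fin.zero) + ι s
    ≡⟨ trans (ι-+ (incidence τ σ ℤ.* c Fin.zero) s) (cong (_+ ι s) (ι-* (incidence τ σ) (c Fin.zero))) ⟨
  ι (incidence τ σ ℤ.* c Fin.zero ℤ.+ s) ∎
  where
  open ≡-Reasoning
  c′ = c ∘ Fin.suc
  s = ∑ᶻ (λ j → incidence (lookup F j) σ ℤ.* c′ j)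

-- The cycle condition at a set `ρ` off the apex contains one value through the apex, at `ρ` with
-- the apex added; all other terms are off the apex and vanish. This allows the rows through the
-- apex to be dropped.
cone-determined : ∀ {m} k (g : Subset (suc m) → ℚ) →
                  (∀ σ → ∣ σ ∣ ≡ suc k → g (outside ∷ σ) ≡ 0ℚ) →
                  (∀ ρ → ∣ ρ ∣ ≡ k → boundary g ρ ≡ 0ℚ) →
                  ∀ σ → ∣ σ ∣ ≡ suc k → g σ ≡ 0ℚ
cone-determined k g out cycle (outside ∷ σ) |σ|≡ = out σ |σ|≡
cone-determined k g out cycle (inside  ∷ ρ) |ρ|≡ = begin
  g (inside ∷ ρ)
    ≡⟨ ℚₚ.+-identityʳ (g (inside ∷ ρ)) ⟨
  g (inside ∷ ρ) + 0ℚ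
    ≡⟨ cong (λ z → g (inside ∷ ρ) + z) (trans (boundary-cong k out ρ |ρ|≡k) (boundary-0 ρ)) ⟨
  boundary g (outside ∷ ρ)
    ≡⟨ cycle (outside ∷ ρ) |ρ|≡k ⟩
  0ℚ ∎
  where
  open ≡-Reasoning
  |ρ|≡k = ℕₚ.suc-injective |ρ|≡

subsets-complete : ∀ {n} (σ : Subset n) → σ ∈ subsets n
subsets-complete []            = here refl
subsets-complete (inside  ∷ σ) = ∈-++⁺ˡ (∈-map⁺ (inside ∷_) (subsets-complete σ))
subsets-complete {suc n} (outside ∷ σ) =
  ∈-++⁺ʳ (map (inside ∷_) (subsets n)) (∈-map⁺ (outside ∷_) (subsets-complete σ))

subsets-unique : ∀ n → Unique (subsets n)
subsets-unique zero    = [] ∷ []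
subsets-unique (suc n) = Uniqueₚ.++⁺
  (Uniqueₚ.map⁺ Vecₚ.∷-injectiveʳ (subsets-unique n))
  (Uniqueₚ.map⁺ Vecₚ.∷-injectiveʳ (subsets-unique n))
  λ (σ∈ˡ , σ∈ʳ) → disjoint (∈-map⁻ (inside ∷_) σ∈ˡ) (∈-map⁻ (outside ∷_) σ∈ʳ)
  where
  disjoint : ∀ {σ : Subset (suc n)} → (∃[ ρ ] ρ ∈ subsets n × σ ≡ inside ∷ ρ) →
             ¬ (∃[ ρ ] ρ ∈ subsets n × σ ≡ outside ∷ ρ)
  disjoint (_ , _ , refl) (_ , _ , ())

column : ∀ {m} → Subset (suc m) → Subset m → ℤ
column τ σ = incidence τ (outside ∷ σ)

columns : ∀ {m} (F : List (Subset (suc m))) → Vec (Subset m → ℤ) (length F)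
columns F = Vec.map column (Vec.fromList F)

comb-columns : ∀ {m} (F : List (Subset (suc m))) ds σ →
               comb ds (columns F) σ ≡ ∑ᶻ (λ j → incidence (lookup F j) (outside ∷ σ) ℤ.* Vec.lookup ds j)
comb-columns []      []       σ = refl
comb-columns (τ ∷ F) (d ∷ ds) σ = cong₂ ℤ._+_ (ℤₚ.*-comm d (column τ σ)) (comb-columns F ds σ)

rational-columns : ∀ {m} (F : List (Subset (suc m))) →
                   rational (columns F) ≡ map (λ τ → ι ∘ column τ) F
rational-columns []      = refl
rational-columns (τ ∷ F) = cong ((ι ∘ column τ) ∷_) (rational-columns F)

-- Off the apex, a face through the apex contributes the axis of its other vertices, any other face
-- its whole boundary. Both cases give one formula, symmetric in all vertices.
norm-column : ∀ {m} k (y : Fin (suc m) → ℚ⁺) τ → ∣ τ ∣ ≡ suc k →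
              norm (energy k (y Fin.zero) (y ∘ Fin.suc)) (ι ∘ column τ) ≡ ∑ˢ τ y * invℚ (∏ˢ τ y)
norm-column {m} k y (inside ∷ σ) |τ|≡ = trans
  (norm-≐ (energy k (y Fin.zero) (y ∘ Fin.suc)) (λ ρ → trans (ι-incidence (inside ∷ σ) (outside ∷ ρ)) (trans
    (cong (λ z → axis σ ρ + z) (trans (boundary-≐ (λ _ → ι-0) ρ) (boundary-0 ρ))) (ℚₚ.+-identityʳ (axis σ ρ)))))
  (trans (energy-axis k (y Fin.zero) (y ∘ Fin.suc) σ (ℕₚ.suc-injective |τ|≡))
    (cong (∑ˢ (inside ∷ σ) y *_) (sym (invℚ-* (proj₁ (y Fin.zero)) (∏ˢ σ (y ∘ Fin.suc))))))
norm-column {m} k y (outside ∷ τ) |τ|≡ = trans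
  (norm-≐ (energy k (y Fin.zero) (y ∘ Fin.suc)) (λ ρ → trans (ι-incidence (outside ∷ τ) (outside ∷ ρ))
    (trans (cong (_+ boundary (axis τ) ρ) ι-0) (ℚₚ.+-identityˡ _))))
  (energy-boundary k (y Fin.zero) (y ∘ Fin.suc) τ |τ|≡)

module _ {m k} (T : SimplicialComplex (suc m)) (acyc : IsℚAcyclic (suc k) T) where

  open IsℚAcyclic acyc

  private
    isFace? : ∀ p → Decidable (λ σ → Face T σ × ∣ σ ∣ ≡ p)
    isFace? p σ = face? T σ ×-dec (∣ σ ∣ ℕₚ.≟ p)

    isFace : ∀ {p} (i : Fin (#faces T p)) → Face T (face T i) × ∣ face T i ∣ ≡ p
    isFace {p} i = proj₂ (∈-filter⁻ (isFace? p) {xs = subsets (suc m)} (∈-lookup {xs = faces T p} i))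

    faceIndex : ∀ {p} σ → ∣ σ ∣ ≡ p → p ≤ suc k → ∃[ i ] face T {p} i ≡ σ
    faceIndex {p} σ |σ|≡p p≤k = index σ∈ , sym (lookup-index σ∈)
      where
      σ∈ : σ ∈ faces T p
      σ∈ = ∈-filter⁺ (isFace? p) (subsets-complete σ) (skeleton σ (subst (_≤ suc k) (sym |σ|≡p) p≤k) , |σ|≡p)

    faces-unique : ∀ p → Unique (faces T p)
    faces-unique p = Uniqueₚ.filter⁺ (isFace? p) (subsets-unique (suc m))

    F = faces T (suc (suc k))
    G = faces T (suc k)

    -- By the full skeleton every set of size `p` is a face, so a cycle condition indexed by faces
    -- covers all such sets.
    boundary-chain : ∀ {p} (c : Chain T (suc p)) σ → ∣ σ ∣ ≡ p → p ≤ suc k →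
                     (∀ i → ∂ T c i ≡ 0ℤ) → boundary (ι ∘ extend (faces T (suc p)) c) σ ≡ 0ℚ
    boundary-chain {p} c σ |σ|≡p p≤k cycle with faceIndex σ |σ|≡p p≤k
    ... | i , refl = trans (boundary-extend (faces T (suc p)) c (face T i)) (trans (cong ι (cycle i)) ι-0)

  -- A relation off the apex is one on all rows, because boundaries are cycles. It is then a
  -- top-dimensional cycle of `T`, hence zero in homology, and there are no larger faces that could
  -- bound.
  independent : Independent (grade m (suc k)) (columns F)
  independent ds eq = trans (sym (Vecₚ.tabulate∘lookup ds))
    (trans (Vecₚ.tabulate-cong b≡0) (tabulate-0 _))
    where
    b : Chain T (suc (suc k))
    b = Vec.lookup ds
    tabulate-0 : ∀ n → Vec.tabulate {n = n} (λ _ → 0ℤ) ≡ zeros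
    tabulate-0 zero    = refl
    tabulate-0 (suc n) = cong (0ℤ ∷_) (tabulate-0 n)
    g = boundary (ι ∘ extend F b)
    g≡0 : ∀ σ → ∣ σ ∣ ≡ suc k → g σ ≡ 0ℚ
    g≡0 = cone-determined k g
      (λ σ |σ|≡ → trans (boundary-extend F b (outside ∷ σ)) (trans
        (cong ι (trans (sym (comb-columns F ds σ)) (eq σ (grade-complete (suc k) σ |σ|≡)))) ι-0))
      (λ ρ _ → boundary² (ι ∘ extend F b) ρ)
    cycle : ∀ i → ∂ T b i ≡ 0ℤ
    cycle i = ι-injective (trans (sym (boundary-extend F b (face T i)))
      (trans (g≡0 (face T i) (proj₂ (isFace i))) (sym ι-0)))
    b≡0 : ∀ i → b i ≡ 0ℤ
    b≡0 i with acyclic (b , cycle)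
    ... | e , eq′ = trans (sym (ℤₚ.+-identityʳ (b i))) (trans (eq′ i) (∑ᶻ-0 λ j →
      contradiction (proj₂ dimension (face T j) (proj₁ (isFace j)))
        (ℕₚ.<⇒≱ (ℕₚ.≤-reflexive (sym (proj₂ (isFace j)))))))

  module _ {h} (order : HasOrder (H̃ T (suc k)) h) where

    private
      open module Order = Bijection order using (to)

      chain : Fin h → Chain T (suc k)
      chain i = proj₁ (to i)

    cycleValue : Fin h → Subset m → ℤ
    cycleValue i σ = extend G (chain i) (outside ∷ σ)

    -- Two cycles differing off the apex by the boundary of `b` differ by it everywhere, again
    -- because all of these are cycles. So the classes coincide, and the enumeration of the homology
    -- group is injective.
    distinct : ∀ i j ds → (∀ σ → σ ∈ grade m (suc k) → cycleValue i σ ℤ.- cycleValue j σ ≡ comb ds (columns F) σ) → i ≡ j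
    distinct i j ds eq = Order.injective (b , homologous)
      where
      b : Chain T (suc (suc k))
      b = Vec.lookup ds
      u = ι ∘ extend G (chain i)
      v = ι ∘ extend G (chain j)
      w = boundary (ι ∘ extend F b)
      g = (u +[ - 1ℚ ] v) +[ - 1ℚ ] w
      regroup : ∀ a b → ι a + - 1ℚ * ι b ≡ ι (a ℤ.- b)
      regroup a b = trans (solve 2 (λ a b → a :+ con (- 1ℚ) :* b := a :+ (:- b)) refl (ι a) (ι b))
        (sym (trans (ι-+ a (ℤ.- b)) (cong (λ z → ι a + z) (ι-neg b))))
      g≡0 : ∀ σ → ∣ σ ∣ ≡ suc k → g σ ≡ 0ℚ
      g≡0 = cone-determined k g
        (λ σ |σ|≡ → trans (cong₂ (λ p q → p + - 1ℚ * q)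
            (trans (regroup (cycleValue i σ) (cycleValue j σ)) (cong ι (trans (eq σ (grade-complete (suc k) σ |σ|≡)) (comb-columns F ds σ))))
            (boundary-extend F b (outside ∷ σ)))
          (solve 1 (λ a → a :+ con (- 1ℚ) :* a := con 0ℚ) refl
            (ι (∑ᶻ (λ l → incidence (lookup F l) (outside ∷ σ) ℤ.* b l)))))
        (λ ρ |ρ|≡ → trans (boundary-linear (u +[ - 1ℚ ] v) (- 1ℚ) w ρ) (trans
          (cong₂ (λ p q → p + - 1ℚ * q)
            (trans (boundary-linear u (- 1ℚ) v ρ) (cong₂ (λ p q → p + - 1ℚ * q)
              (boundary-chain (chain i) ρ |ρ|≡ (ℕₚ.n≤1+n k) (proj₂ (to i)))
              (boundary-chain (chain j) ρ |ρ|≡ (ℕₚ.n≤1+n k) (proj₂ (to j)))))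
            (boundary² (ι ∘ extend F b) ρ))
          refl))
      homologous : ∀ p → chain i p ℤ.- chain j p ≡ ∂ T b p
      homologous p = ι-injective (begin
        ι (chain i p ℤ.- chain j p)
          ≡⟨ cong₂ (λ x y → ι (x ℤ.- y)) (extend-lookup G (chain i) (faces-unique (suc k)) p)
                                         (extend-lookup G (chain j) (faces-unique (suc k)) p) ⟨
        ι (extend G (chain i) σ ℤ.- extend G (chain j) σ)
          ≡⟨ regroup (extend G (chain i) σ) (extend G (chain j) σ) ⟨
        u σ + - 1ℚ * v σ
          ≡⟨ solve 2 (λ a b → a := (a :+ con (- 1ℚ) :* b) :+ b) refl (u σ + - 1ℚ * v σ) (w σ) ⟩
        g σ + w σ
          ≡⟨ cong₂ _+_ (g≡0 σ (proj₂ (isFace p))) (boundary-extend F b σ) ⟩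
        0ℚ + ι (∂ T b p)
          ≡⟨ ℚₚ.+-identityˡ (ι (∂ T b p)) ⟩
        ι (∂ T b p) ∎)
        where
        open ≡-Reasoning
        σ = face T p

    rational-bound : ∀ (y : Fin (suc m) → ℚ⁺) →
      ι (+ (h ^ 2)) * density (y Fin.zero) (y ∘ Fin.suc) ^ℚ exponent m (suc k) ℚ.≤
      product (map (λ τ → ∑ˢ τ y * invℚ (∏ˢ τ y)) F)
    rational-bound y = begin
      ι (+ (h ^ 2)) * density (y Fin.zero) (y ∘ Fin.suc) ^ℚ exponent m (suc k)
        ≡⟨ cong (ι (+ (h ^ 2)) *_) (gram-energy m (suc k) (y Fin.zero) (y ∘ Fin.suc)) ⟨
      ι (+ (h ^ 2)) * gram E (map axis (grade m (suc k)))
        ≤⟨ covolume (grade m (suc k)) (grade-unique m (suc k)) (columns F)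
             -- By `count` there are as many columns as sets of size `suc k` off the apex: the
             -- matrix is square.
             (trans (length-grade m (suc k)) (sym count)) independent cycleValue distinct
             E (energy-dependsOn m (suc k) (y Fin.zero) (y ∘ Fin.suc)) ⟩
      product (map (norm E) (rational (columns F)))
        ≡⟨ cong (λ as → product (map (norm E) as)) (rational-columns F) ⟩
      product (map (norm E) (map (λ τ → ι ∘ column τ) F))
        ≡⟨ cong product (trans (sym (Listₚ.map-∘ F)) (Listₚ.map-cong-local (All.tabulate λ {τ} τ∈ →
             norm-column (suc k) y τ (proj₂ (proj₂ (∈-filter⁻ (isFace? (suc (suc k))) {xs = subsets (suc m)} τ∈)))))) ⟩
      product (map (λ τ → ∑ˢ τ y * invℚ (∏ˢ τ y)) F) ∎
      where
      open ℚₚ.≤-Reasoning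
      E : Form (Subset m)
      E = energy (suc k) (y Fin.zero) (y ∘ Fin.suc)

-- From ℚ to ℝ

∏ℚ : ∀ {n} → Vector ℚ n → ℚ
∏ℚ = foldr _*_ 1ℚ

∏ℚ-cong : ∀ {n} {f g : Vector ℚ n} → (∀ i → f i ≡ g i) → ∏ℚ f ≡ ∏ℚ g
∏ℚ-cong {zero}  eq = refl
∏ℚ-cong {suc n} eq = cong₂ _*_ (eq Fin.zero) (∏ℚ-cong (eq ∘ Fin.suc))

∏ℚ-1 : ∀ n → ∏ℚ {n} (λ _ → 1ℚ) ≡ 1ℚ
∏ℚ-1 zero    = refl
∏ℚ-1 (suc n) = trans (ℚₚ.*-identityˡ _) (∏ℚ-1 n)

∏ℚ-* : ∀ {n} (f g : Vector ℚ n) → ∏ℚ (λ i → f i * g i) ≡ ∏ℚ f * ∏ℚ g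
∏ℚ-* {zero}  f g = refl
∏ℚ-* {suc n} f g = trans (cong (f Fin.zero * g Fin.zero *_) (∏ℚ-* (f ∘ Fin.suc) (g ∘ Fin.suc)))
  (solve 4 (λ a b c d → a :* b :* (c :* d) := a :* c :* (b :* d)) refl
    (f Fin.zero) (g Fin.zero) (∏ℚ (f ∘ Fin.suc)) (∏ℚ (g ∘ Fin.suc)))

product-map-* : ∀ {A : Set} (f g : A → ℚ) xs →
                product (map (λ x → f x * g x) xs) ≡ product (map f xs) * product (map g xs)
product-map-* f g []       = refl
product-map-* f g (x ∷ xs) = trans (cong (f x * g x *_) (product-map-* f g xs))
  (solve 4 (λ a b c d → a :* b :* (c :* d) := a :* c :* (b :* d)) refl
    (f x) (g x) (product (map f xs)) (product (map g xs)))

infixr 8 _^ᶻ_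
_^ᶻ_ : ℚ → ℤ → ℚ
q ^ᶻ (+ n)    = q ^ℚ n
q ^ᶻ -[1+ n ] = invℚ q ^ℚ suc n

^ᶻ-⊖ : ∀ {q} → q ≢ 0ℚ → ∀ m n → q ^ᶻ (m ⊖ n) ≡ q ^ℚ m * invℚ q ^ℚ n
^ᶻ-⊖ q≢0 zero    zero    = refl
^ᶻ-⊖ {q} q≢0 zero    (suc n) = sym (ℚₚ.*-identityˡ (invℚ q ^ℚ suc n))
^ᶻ-⊖ {q} q≢0 (suc m) zero    = sym (ℚₚ.*-identityʳ (q ^ℚ suc m))
^ᶻ-⊖ {q} q≢0 (suc m) (suc n) = begin
  q ^ᶻ (suc m ⊖ suc n)                     ≡⟨ cong (q ^ᶻ_) (ℤₚ.[1+m]⊖[1+n]≡m⊖n m n) ⟩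
  q ^ᶻ (m ⊖ n)                             ≡⟨ ^ᶻ-⊖ q≢0 m n ⟩
  q ^ℚ m * invℚ q ^ℚ n
    ≡⟨ modulo (q * invℚ q) 1ℚ (q ^ℚ m * invℚ q ^ℚ n) (*-invℚ q≢0)
         (solve 4 (λ q i a b → (q :* a) :* (i :* b) := a :* b :+ (q :* i :- con 1ℚ) :* (a :* b)) refl
           q (invℚ q) (q ^ℚ m) (invℚ q ^ℚ n)) ⟨
  q * q ^ℚ m * (invℚ q * invℚ q ^ℚ n)      ∎
  where open ≡-Reasoning

invℚ-^ : ∀ q n → invℚ (q ^ℚ n) ≡ invℚ q ^ℚ n
invℚ-^ q zero    = refl
invℚ-^ q (suc n) = trans (invℚ-* q (q ^ℚ n)) (cong (invℚ q *_) (invℚ-^ q n))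

-- Double counting of the pairs of a face and a vertex of it.
∏ℚ-degree : ∀ {n} (p : Vector ℚ n) (F : List (Subset n)) →
            ∏ℚ (λ i → p i ^ℚ length (filter (i ∈?_) F)) ≡
            product (map (λ τ → ∏ℚ (λ i → if does (i ∈? τ) then p i else 1ℚ)) F)
∏ℚ-degree {n} p []      = ∏ℚ-1 n
∏ℚ-degree p (τ ∷ F) = begin
  ∏ℚ (λ i → p i ^ℚ length (filter (i ∈?_) (τ ∷ F)))
    ≡⟨ ∏ℚ-cong step ⟩
  ∏ℚ (λ i → (if does (i ∈? τ) then p i else 1ℚ) * p i ^ℚ length (filter (i ∈?_) F))
    ≡⟨ ∏ℚ-* (λ i → if does (i ∈? τ) then p i else 1ℚ) (λ i → p i ^ℚ length (filter (i ∈?_) F)) ⟩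
  ∏ℚ (λ i → if does (i ∈? τ) then p i else 1ℚ) * ∏ℚ (λ i → p i ^ℚ length (filter (i ∈?_) F))
    ≡⟨ cong (∏ℚ (λ i → if does (i ∈? τ) then p i else 1ℚ) *_) (∏ℚ-degree p F) ⟩
  ∏ℚ (λ i → if does (i ∈? τ) then p i else 1ℚ) *
    product (map (λ τ → ∏ℚ (λ i → if does (i ∈? τ) then p i else 1ℚ)) F) ∎
  where
  open ≡-Reasoning
  step : ∀ i → p i ^ℚ length (filter (i ∈?_) (τ ∷ F)) ≡
               (if does (i ∈? τ) then p i else 1ℚ) * p i ^ℚ length (filter (i ∈?_) F)
  step i with does (i ∈? τ)
  ... | true  = refl
  ... | false = sym (ℚₚ.*-identityˡ _)

∏ℚ-∏ˢ : ∀ {n} (y : Fin n → ℚ⁺) τ → ∏ℚ (λ i → if does (i ∈? τ) then invℚ (proj₁ (y i)) else 1ℚ) ≡ invℚ (∏ˢ τ y)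
∏ℚ-∏ˢ y []            = refl
∏ℚ-∏ˢ y (inside  ∷ τ) = trans (cong (invℚ (proj₁ (y Fin.zero)) *_) (∏ℚ-∏ˢ (y ∘ Fin.suc) τ))
  (sym (invℚ-* (proj₁ (y Fin.zero)) (∏ˢ τ (y ∘ Fin.suc))))
∏ℚ-∏ˢ y (outside ∷ τ) = trans (ℚₚ.*-identityˡ _) (∏ℚ-∏ˢ (y ∘ Fin.suc) τ)

∏ℚ-^ : ∀ {n} (y : Fin n → ℚ⁺) e → ∏ℚ (λ i → proj₁ (y i) ^ℚ e) ≡ ∏⁺ y ^ℚ e
∏ℚ-^ {zero}  y e = sym (1^ℚ e)
∏ℚ-^ {suc n} y e = trans (cong (proj₁ (y Fin.zero) ^ℚ e *_) (∏ℚ-^ (y ∘ Fin.suc) e))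
  (sym (^ℚ-* (proj₁ (y Fin.zero)) (∏⁺ (y ∘ Fin.suc)) e))

0<∏⁺ : ∀ {n} (y : Fin n → ℚ⁺) → 0ℚ ℚ.< ∏⁺ y
0<∏⁺ {zero}  y = ℚₚ.positive⁻¹ 1ℚ
0<∏⁺ {suc n} y = 0<* (proj₂ (y Fin.zero)) (0<∏⁺ (y ∘ Fin.suc))

0≤∑⁺ : ∀ {n} (y : Fin n → ℚ⁺) → 0ℚ ℚ.≤ ∑⁺ y
0≤∑⁺ {zero}  y = ℚₚ.≤-refl
0≤∑⁺ {suc n} y = ℚₚ.+-mono-≤ (ℚₚ.<⇒≤ (proj₂ (y Fin.zero))) (0≤∑⁺ (y ∘ Fin.suc))

0<∑⁺ : ∀ {n} (y : Fin (suc n) → ℚ⁺) → 0ℚ ℚ.< ∑⁺ y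
0<∑⁺ y = ℚₚ.+-mono-<-≤ (proj₂ (y Fin.zero)) (0≤∑⁺ (y ∘ Fin.suc))

0≤^ℚ : ∀ {q} n → 0ℚ ℚ.≤ q → 0ℚ ℚ.≤ q ^ℚ n
0≤^ℚ zero    0≤q = ℚₚ.nonNegative⁻¹ 1ℚ
0≤^ℚ (suc n) 0≤q = 0≤* 0≤q (0≤^ℚ n 0≤q)

boundℚ : ∀ {n} → (Fin n → ℚ⁺) → List (Subset n) → ℕ → ℚ
boundℚ y F e = ∏ℚ (λ i → proj₁ (y i) ^ᶻ (e ⊖ length (filter (i ∈?_) F))) * invℚ (∑⁺ y ^ℚ e)
               * product (map (λ τ → ∑ˢ τ y) F)

-- The density has inverse `r`, so multiplying by `r ^ℚ e` moves it to the other side. The products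
-- of weights left in the column norms regroup into the negative powers given by the vertex degrees.
boundℚ-density : ∀ {n} (y : Fin (suc n) → ℚ⁺) F e a →
                 a * density (y Fin.zero) (y ∘ Fin.suc) ^ℚ e ℚ.≤ product (map (λ τ → ∑ˢ τ y * invℚ (∏ˢ τ y)) F) →
                 a ℚ.≤ boundℚ y F e
boundℚ-density y F e a a*d≤ = begin
  a
    ≡⟨ ℚₚ.*-identityʳ a ⟨
  a * 1ℚ
    ≡⟨ cong (a *_) (trans (sym (1^ℚ e)) (trans (cong (_^ℚ e) (sym D*r≡1)) (^ℚ-* D r e))) ⟩
  a * (D ^ℚ e * r ^ℚ e)
    ≡⟨ ℚₚ.*-assoc a (D ^ℚ e) (r ^ℚ e) ⟨
  a * D ^ℚ e * r ^ℚ e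
    ≤⟨ ℚₚ.*-monoʳ-≤-nonNeg (r ^ℚ e) {{ℚ.nonNegative (0≤^ℚ e 0≤r)}} a*d≤ ⟩
  product (map (λ τ → ∑ˢ τ y * invℚ (∏ˢ τ y)) F) * r ^ℚ e
    ≡⟨ cong₂ _*_ (product-map-* (λ τ → ∑ˢ τ y) (λ τ → invℚ (∏ˢ τ y)) F) (^ℚ-* P (invℚ S) e) ⟩
  A * B * (P ^ℚ e * invℚ S ^ℚ e)
    ≡⟨ solve 4 (λ a b p s → a :* b :* (p :* s) := p :* b :* s :* a) refl A B (P ^ℚ e) (invℚ S ^ℚ e) ⟩
  P ^ℚ e * B * invℚ S ^ℚ e * A
    ≡⟨ cong₂ (λ p s → p * s * A) powers (invℚ-^ S e) ⟨
  boundℚ y F e ∎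
  where
  open ℚₚ.≤-Reasoning
  S = ∑⁺ y
  P = ∏⁺ y
  D = density (y Fin.zero) (y ∘ Fin.suc)
  r = P * invℚ S
  A = product (map (λ τ → ∑ˢ τ y) F)
  B = product (map (λ τ → invℚ (∏ˢ τ y)) F)
  0≤r : 0ℚ ℚ.≤ r
  0≤r = 0≤* (ℚₚ.<⇒≤ (0<∏⁺ y)) (0≤invℚ (ℚₚ.<⇒≤ (0<∑⁺ y)))
  D*r≡1 : D * r ≡ 1ℚ
  D*r≡1 = trans (cong (λ i → S * i * r) (sym (invℚ-* (proj₁ (y Fin.zero)) (∏⁺ (y ∘ Fin.suc)))))
    (trans (solve 4 (λ S i P j → S :* i :* (P :* j) := (P :* i) :* (S :* j)) refl S (invℚ P) P (invℚ S))
      (cong₂ _*_ (*-invℚ (pos⇒≢0 (0<∏⁺ y))) (*-invℚ (pos⇒≢0 (0<∑⁺ y)))))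
  powers : ∏ℚ (λ i → proj₁ (y i) ^ᶻ (e ⊖ length (filter (i ∈?_) F))) ≡ P ^ℚ e * B
  powers = trans (∏ℚ-cong (λ i → ^ᶻ-⊖ (pos⇒≢0 (proj₂ (y i))) e (length (filter (i ∈?_) F))))
    (trans (∏ℚ-* (λ i → proj₁ (y i) ^ℚ e) (λ i → invℚ (proj₁ (y i)) ^ℚ length (filter (i ∈?_) F)))
      (cong₂ _*_ (∏ℚ-^ y e) (trans (∏ℚ-degree (λ i → invℚ (proj₁ (y i))) F)
        (cong product (Listₚ.map-cong (∏ℚ-∏ˢ y) F)))))

seq-^ : ∀ x n l → seq (x ^ᴿ n) l ≡ seq x l ^ℚ n
seq-^ x zero    l = refl
seq-^ x (suc n) l = cong (seq x l *_) (seq-^ x n l)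

seq-^[] : ∀ x z x#0 l → seq (x ^ᴿ z [ x#0 ]) l ≡ seq x l ^ᶻ z
seq-^[] x (+ n)    x#0 l = seq-^ x n l
seq-^[] x -[1+ n ] x#0 l = seq-^ (invᴿ x x#0) (suc n) l

seq-∏ : ∀ {n} (f : Vector ℝ n) l → seq (∏ᴿ f) l ≡ ∏ℚ (λ i → seq (f i) l)
seq-∏ {zero}  f l = refl
seq-∏ {suc n} f l = cong (seq (f Fin.zero) l *_) (seq-∏ (f ∘ Fin.suc) l)

seq-∑ : ∀ {n} (f : Vector ℝ n) (y : Fin n → ℚ⁺) l → (∀ i → seq (f i) l ≡ proj₁ (y i)) → seq (∑ᴿ f) l ≡ ∑⁺ y
seq-∑ {zero}  f y l eq = refl
seq-∑ {suc n} f y l eq = cong₂ _+_ (eq Fin.zero) (seq-∑ (f ∘ Fin.suc) (y ∘ Fin.suc) l (eq ∘ Fin.suc))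

seq-∑∈ : ∀ {n} τ (f : Vector ℝ n) (y : Fin n → ℚ⁺) l → (∀ i → seq (f i) l ≡ proj₁ (y i)) →
         seq (∑∈ τ f) l ≡ ∑ˢ τ y
seq-∑∈ []            f y l eq = refl
seq-∑∈ (inside  ∷ τ) f y l eq = cong₂ _+_ (eq Fin.zero) (seq-∑∈ τ (f ∘ Fin.suc) (y ∘ Fin.suc) l (eq ∘ Fin.suc))
seq-∑∈ (outside ∷ τ) f y l eq = trans (ℚₚ.+-identityˡ _) (seq-∑∈ τ (f ∘ Fin.suc) (y ∘ Fin.suc) l (eq ∘ Fin.suc))

∏ℚ-lookup : ∀ {A : Set} (f : A → ℚ) xs → ∏ℚ (λ j → f (lookup xs j)) ≡ product (map f xs)
∏ℚ-lookup f []       = refl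
∏ℚ-lookup f (x ∷ xs) = cong (f x *_) (∏ℚ-lookup f xs)

-- The real operations act index by index, the inverse through `invℚ`, so the equation is exact,
-- with no error term.
seq-bound : ∀ {n k} (k<n : k < n) T x x#0 l (y : Fin n → ℚ⁺) → (∀ i → seq (x i) l * seq (x i) l ≡ proj₁ (y i)) →
            seq (bound {n} {k} k<n T x x#0) l ≡ boundℚ y (faces T (suc k)) ((n ∸ 2) C (k ∸ 1))
seq-bound {n} {k} k<n T x x#0 l y eq = cong₂ _*_ (cong₂ _*_ powers
    (cong invℚ (trans (seq-^ (∑ᴿ (λ i → x i ²)) e l) (cong (_^ℚ e) (seq-∑ (λ i → x i ²) y l eq)))))
    (trans (seq-∏ (λ j → ∑∈ (face T {suc k} j) (λ i → x i ²)) l)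
      (trans (∏ℚ-cong (λ j → seq-∑∈ (face T {suc k} j) (λ i → x i ²) y l eq)) (∏ℚ-lookup (λ τ → ∑ˢ τ y) (faces T (suc k)))))
  where
  e = (n ∸ 2) C (k ∸ 1)
  powers : seq (∏ᴿ (λ i → (x i ²) ^ᴿ (e ⊖ degree k T i) [ ²-#0 {x i} (x#0 i) ])) l ≡
           ∏ℚ (λ i → proj₁ (y i) ^ᶻ (e ⊖ degree k T i))
  powers = trans (seq-∏ (λ i → (x i ²) ^ᴿ (e ⊖ degree k T i) [ ²-#0 {x i} (x#0 i) ]) l)
    (∏ℚ-cong (λ i → trans (seq-^[] (x i ²) (e ⊖ degree k T i) (²-#0 {x i} (x#0 i)) l)
      (cong (_^ᶻ (e ⊖ degree k T i)) (eq i))))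

-- Order and limits of reals

eventually-≢0 : ∀ {n} (x : Vector ℝ n) → (∀ i → x i #0) → ∃[ N ] ∀ l → N ≤ l → ∀ i → seq (x i) l ≢ 0ℚ
eventually-≢0 {zero}  x x#0 = 0 , λ _ _ ()
eventually-≢0 {suc n} x x#0 with x#0 Fin.zero | eventually-≢0 (x ∘ Fin.suc) (x#0 ∘ Fin.suc)
... | δ , 0<δ , N , away | M , rest = N ℕ.⊔ M , λ where
  l ⊔≤l Fin.zero eq → ℚₚ.<-irrefl refl (ℚₚ.<-≤-trans 0<δ
    (subst (λ p → δ ℚ.≤ ℚ.∣ p ∣) eq (away l (ℕₚ.≤-trans (ℕₚ.m≤m⊔n N M) ⊔≤l))))
  l ⊔≤l (Fin.suc i) → rest l (ℕₚ.≤-trans (ℕₚ.m≤n⊔m N M) ⊔≤l) i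

0<² : ∀ {p} → p ≢ 0ℚ → 0ℚ ℚ.< p * p
0<² {p} p≢0 = ℚₚ.≰⇒> (λ p²≤0 → *≢0 p≢0 p≢0 (ℚₚ.≤-antisym p²≤0 (0≤² p)))

half-double : ∀ ε → ε ≡ ℚ.½ * ε + ℚ.½ * ε
half-double = solve 1 (λ ε → ε := con ℚ.½ :* ε :+ con ℚ.½ :* ε) refl

≤ᴿ-trans : ∀ {x y z} → x ≤ᴿ y → y ≤ᴿ z → x ≤ᴿ z
≤ᴿ-trans {x} {y} {z} x≤y y≤z ε 0<ε with x≤y (ℚ.½ * ε) 0<ε/2 | y≤z (ℚ.½ * ε) 0<ε/2
  where 0<ε/2 = 0<* (ℚₚ.positive⁻¹ ℚ.½) 0<ε
... | M , p | N , q = M ℕ.⊔ N , λ n ⊔≤n → begin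
  seq x n                               ≤⟨ p n (ℕₚ.≤-trans (ℕₚ.m≤m⊔n M N) ⊔≤n) ⟩
  seq y n + ℚ.½ * ε                     ≤⟨ ℚₚ.+-monoˡ-≤ (ℚ.½ * ε) (q n (ℕₚ.≤-trans (ℕₚ.m≤n⊔m M N) ⊔≤n)) ⟩
  seq z n + ℚ.½ * ε + ℚ.½ * ε           ≡⟨ ℚₚ.+-assoc (seq z n) (ℚ.½ * ε) (ℚ.½ * ε) ⟩
  seq z n + (ℚ.½ * ε + ℚ.½ * ε)         ≡⟨ cong (λ p → seq z n + p) (half-double ε) ⟨
  seq z n + ε                           ∎
  where open ℚₚ.≤-Reasoning

≤ᴿ-closed : ∀ {x y} → (∀ ε → 0ℚ ℚ.< ε → x ≤ᴿ y +ᴿ ℚ→ℝ ε) → x ≤ᴿ y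
≤ᴿ-closed {x} {y} x≤y+ ε 0<ε with x≤y+ (ℚ.½ * ε) 0<ε/2 (ℚ.½ * ε) 0<ε/2
  where 0<ε/2 = 0<* (ℚₚ.positive⁻¹ ℚ.½) 0<ε
... | N , p = N , λ n N≤n → ℚₚ.≤-trans (p n N≤n) (ℚₚ.≤-reflexive (trans
  (ℚₚ.+-assoc (seq y n) (ℚ.½ * ε) (ℚ.½ * ε)) (cong (λ p → seq y n + p) (sym (half-double ε)))))

pointwise-bound : ∀ n k → 1 ≤ k → (k<n : k < n) (T : SimplicialComplex n) → IsℚAcyclic k T →
                  ∀ h → HasOrder (H̃ T k) h → (x : Vector ℝ n) (x#0 : ∀ i → x i #0) →
                  ℕ→ℝ (h ^ 2) ≤ᴿ bound k<n T x x#0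
-- With `n` and `k` in this form, `m C k` is by computation both `m₁` and
-- `exponent (suc m) (suc k)`.
pointwise-bound (suc (suc m)) (suc k) _ k<n@(ℕ.s≤s (ℕ.s≤s _)) T acyc h order x x#0 ε 0<ε =
  -- From this index on no coordinate vanishes, so the squares are positive weights and the rational
  -- inequality applies.
  proj₁ (eventually-≢0 x x#0) , bounded
  where
  y : ∀ l → proj₁ (eventually-≢0 x x#0) ≤ l → Fin (suc (suc m)) → ℚ⁺
  y l N≤l i = seq (x i) l * seq (x i) l , 0<² (proj₂ (eventually-≢0 x x#0) l N≤l i)
  bounded : ∀ l → proj₁ (eventually-≢0 x x#0) ≤ l → + (h ^ 2) ℚ./ 1 ℚ.≤ seq (bound k<n T x x#0) l + ε
  bounded l N≤l = begin
    + (h ^ 2) ℚ./ 1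
      ≡⟨ ι-/1 (+ (h ^ 2)) ⟨
    ι (+ (h ^ 2))
      ≤⟨ boundℚ-density (y l N≤l) (faces T (suc (suc k))) (m C k) (ι (+ (h ^ 2)))
           (rational-bound T acyc order (y l N≤l)) ⟩
    boundℚ (y l N≤l) (faces T (suc (suc k))) (m C k)
      ≡⟨ seq-bound k<n T x x#0 l (y l N≤l) (λ _ → refl) ⟨
    seq (bound k<n T x x#0) l
      ≡⟨ ℚₚ.+-identityʳ (seq (bound k<n T x x#0) l) ⟨
    seq (bound k<n T x x#0) l + 0ℚ
      ≤⟨ ℚₚ.+-monoʳ-≤ (seq (bound k<n T x x#0) l) (ℚₚ.<⇒≤ 0<ε) ⟩
    seq (bound k<n T x x#0) l + ε ∎
    where open ℚₚ.≤-Reasoning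

theorem2 : (n k : ℕ) → 1 ≤ k → (k<n : k < n) →
    (T : SimplicialComplex n) → IsℚAcyclic k T →
    (h : ℕ) → HasOrder (H̃ T k) h →
    ((x : Vector ℝ n) (x#0 : (i : Fin n) → x i #0) →
    ℕ→ℝ (h ^ 2) ≤ᴿ bound k<n T x x#0) ×
    ((L : ℝ) → IsInfimum (IsValue k<n T) L → ℕ→ℝ (h ^ 2) ≤ᴿ L) ×
    ((L : ℝ) → IsInfimum (IsLimitValue k<n T) L → ℕ→ℝ (h ^ 2) ≤ᴿ L)
theorem2 n k 1≤k k<n T acyc h order =
    le
  , (λ L (_ , greatest) → greatest h² λ v (x , x#0 , v≈) → ≤ᴿ-trans {h²} {bound k<n T x x#0} {v} (le x x#0) (proj₂ v≈))
  -- A limit value exceeds some term of its sequence up to any prescribed `ε`. That term obeys the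
  -- pointwise bound, and the order on the reals is closed.
  , (λ L (_ , greatest) → greatest h² λ v (x , _ , y , y#0 , _ , ⟶v) →
      ≤ᴿ-closed {h²} {v} λ ε 0<ε → let J , close = ⟶v ε 0<ε in
      ≤ᴿ-trans {h²} {bound k<n T (y J) (y#0 J)} {v +ᴿ ℚ→ℝ ε} (le (y J) (y#0 J)) (proj₁ (close J ℕₚ.≤-refl)))
  where
  h² = ℕ→ℝ (h ^ 2)
  le = pointwise-bound n k 1≤k k<n T acyc h order
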